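{- Let $P\subset\mathbb{Q}^d$ be a full-dimensional rational convex polytope (not necessarily simple). For each vertex $v$ of $P$, let $n_1,\dots,n_N\in(\mathbb{Q}^d)^*$ be the inner normals of the facets of $P$ containing $v$, and let $\mathcal{N}_v$ be the cone they generate (the inner normal cone at $v$). Let $\xi\in(\mathbb{Q}^d)^*$ be generic, meaning: for every vertex $v$ and every set of $d-1$ linearly independent inner facet normals at $v$, $\xi$ does not lie in their linear span. For a regular triangulation $\Delta$ of $\mathcal{N}_v$ with maximal cones $\sigma_1,\dots,\sigma_M$, and for each $i$, write $\xi=\sum_{n_j\in\sigma_i}\alpha_j n_j$ (sum over the $d$ generators $n_j$ of $\sigma_i$; all $\alpha_j\neq0$ by genericity), define $$\mathcal{T}^\xi_v\mathcal{T}_{\sigma_i}=\{x\in\mathbb{Q}^d:\ n_j(x)\ge n_j(v)\text{ for } n_j\in\sigma_i,\ \alpha_j>0;\ \ n_j(x)<n_j(v)\text{ for } n_j\in\sigma_i,\ \alpha_j<0\},$$ let $\operatorname{ind}_\xi(\sigma_i)=\#\{j: n_j\in\sigma_i,\ \alpha_j<0\}$, and set $$\mathbb{1}^\xi_{\Delta,v}=\sum_{i=1}^M(-1)^{\operatorname{ind}_\xi(\sigma_i)}\mathbb{1}_{\mathcal{T}^\xi_v\mathcal{T}_{\sigma_i}}.$$ Then $\mathbb{1}^\xi_{\Delta,v}$ does not depend on the choice of the regular triangulation $\Delta$ of $\mathcal{N}_v$; denoting it $\mathbb{1}^\xi_v$, we have $$\mathbb{1}_P(x)=\sum_{v\text{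 vertex of }P}\mathbb{1}^\xi_v(x)\quad\text{for all }x\in\mathbb{Q}^d.$$
   Context: $\mathbb{1}_S$ denotes the indicator function of $S\subseteq\mathbb{Q}^d$. A triangulation of the cone $\mathcal{N}_v$ is a face-to-face subdivision of $\mathcal{N}_v$ into simplicial cones $\sigma_1,\dots,\sigma_M$, each generated by $d$ linearly independent vectors among $n_1,\dots,n_N$ (the "generators" of $\sigma_i$). It is regular if there is a convex piecewise linear function on $\mathcal{N}_v$ whose domains of linearity are exactly the $\sigma_i$. -}

module Defs where

open import Data.Nat using (ℕ; zero; suc)
open import Data.Fin using (Fin; zero; suc)
open import Data.Vec using (Vec; []; _∷_)
open import Data.Bool using (Bool; true; false; if_then_else_; _∧_)
open import Data.Integer using (ℤ; +_) renaming (_+_ to _+ℤ_; _*_ to _*ℤ_; -_ to -ℤ_)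
open import Data.Rational using (ℚ; 0ℚ; 1ℚ; _+_; _*_; _-_; _≤_; _<_)
open import Data.Rational.Properties using (_≤?_; _<?_)
open import Data.Product using (Σ; ∃; _×_; _,_)
open import Data.List using (List; []; _∷_)
open import Data.List.Relation.Unary.All using (All; []; _∷_)
open import Relation.Nullary using (¬_; does)
open import Relation.Binary.PropositionalEquality using (_≡_; _≢_)
open import Function using (_∘_)

-- Linear algebra over ℚ^d (points are Vec ℚ d; covectors too)

Pt : ℕ → Set
Pt d = Vec ℚ d

zeroV : ∀ {d} → Pt d
zeroV {zero}  = []
zeroV {suc d} = 0ℚ ∷ zeroV

_⊕_ : ∀ {d} → Pt d → Pt d → Pt d
[] ⊕ [] = []
(x ∷ xs) ⊕ (y ∷ ys) = (x + y) ∷ (xs ⊕ ys)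

_•_ : ∀ {d} → ℚ → Pt d → Pt d
c • [] = []
c • (x ∷ xs) = (c * x) ∷ (c • xs)

_·_ : ∀ {d} → Pt d → Pt d → ℚ
[] · [] = 0ℚ
(x ∷ xs) · (y ∷ ys) = x * y + xs · ys

lincomb : ∀ {d k} → (Fin k → ℚ) → (Fin k → Pt d) → Pt d
lincomb {k = zero}  c g = zeroV
lincomb {k = suc k} c g = (c zero • g zero) ⊕ lincomb (c ∘ suc) (g ∘ suc)

LinIndep : ∀ {d k} → (Fin k → Pt d) → Set
LinIndep g = ∀ c → lincomb c g ≡ zeroV → ∀ i → c i ≡ 0ℚ

InSpan : ∀ {d k} → (Fin k → Pt d) → Pt d → Set
InSpan g x = ∃ λ c → lincomb c g ≡ x

InCone : ∀ {d k} → (Fin k → Pt d) → Pt d → Set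
InCone g x = ∃ λ c → (∀ i → 0ℚ ≤ c i) × lincomb c g ≡ x

_⇔_ : Set → Set → Set
P ⇔ Q = (P → Q) × (Q → P)

-- Polytope P = { x | b k ≤ A k · x for all k }, given by m inequalities
-- with inner normals A k.

module _ {d m : ℕ} (A : Fin m → Pt d) (b : Fin m → ℚ) where

  InP : Pt d → Set
  InP x = ∀ k → b k ≤ A k · x

  FullDim : Set
  FullDim = ∃ λ x → ∀ k → b k < A k · x

  Bounded : Set
  Bounded = ∃ λ (M : ℚ) → ∀ x → InP x → All (λ xi → (Data.Rational.- M) ≤ xi × xi ≤ M) (Data.Vec.toList x)

  -- irredundant: every inequality is needed, i.e. each defines a distinct facet
  Irredundant : Set
  Irredundant = ∀ k → ∃ λ x → (A k · x < b k) × (∀ k' → k' ≢ k → b k' ≤ A k' · x)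

  IsVertex : Pt d → Set
  IsVertex v = InP v × (∀ x y t → InP x → InP y → 0ℚ < t → t < 1ℚ →
                          v ≡ (t • x) ⊕ ((1ℚ - t) • y) → x ≡ y)

  Active : Pt d → Fin m → Set
  Active v k = A k · v ≡ b k

  InNormalCone : Pt d → Pt d → Set
  InNormalCone v x = ∃ λ (c : Fin m → ℚ) → (∀ k → 0ℚ ≤ c k) ×
                       (∀ k → ¬ Active v k → c k ≡ 0ℚ) × lincomb c A ≡ x

  Generic : Pt d → Set
  Generic ξ = ∀ v → IsVertex v → (g : Fin (Data.Nat._∸_ d 1) → Fin m) →
                (∀ j → Active v (g j)) → LinIndep (A ∘ g) → ¬ InSpan (A ∘ g) ξ

  InCommonCone : ∀ {p q} → (Fin p → Fin m) → (Fin q → Fin m) → Pt d → Set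
  InCommonCone s t x = ∃ λ (c : Fin m → ℚ) → (∀ k → 0ℚ ≤ c k) ×
      (∀ k → c k ≢ 0ℚ → (∃ λ j → s j ≡ k) × (∃ λ j → t j ≡ k)) × lincomb c A ≡ x

  -- A regular triangulation Δ of N_v (cones σ_1..σ_M, σ_i generated by the
  -- d normals A (cones i j), j : Fin d), together with the coefficients
  -- α of ξ in the generators of each σ_i.
  record RegTriang (v ξ : Pt d) : Set where
    field
      M      : ℕ
      cones  : Fin M → Fin d → Fin m
      active : ∀ i j → Active v (cones i j)
      indep  : ∀ i → LinIndep (A ∘ cones i)
      -- the σ_i cover N_v (each σ_i ⊆ N_v since its generators are active)
      cover  : ∀ x → InNormalCone v x → ∃ λ i → InCone (A ∘ cones i) x
      faces  : ∀ i j x → InCone (A ∘ cones i) x → InCone (A ∘ cones j) x →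
               InCommonCone (cones i) (cones j) x
      distinct : ∀ i i' → i ≢ i' → ¬ (∀ j → ∃ λ j' → cones i j ≡ cones i' j')
      regular : ∃ λ (f : Pt d → ℚ) →
        (∀ x y t → InNormalCone v x → InNormalCone v y → 0ℚ ≤ t → t ≤ 1ℚ →
           f ((t • x) ⊕ ((1ℚ - t) • y)) ≤ t * f x + (1ℚ - t) * f y) ×
        (∀ i → ∃ λ (ℓ : Pt d) → ∀ x → InNormalCone v x →
           (f x ≡ ℓ · x) ⇔ InCone (A ∘ cones i) x)
      α      : Fin M → Fin d → ℚ
      αspec  : ∀ i → lincomb (α i) (A ∘ cones i) ≡ ξ

sumFinℤ : ∀ {k} → (Fin k → ℤ) → ℤ
sumFinℤ {zero}  f = + 0
sumFinℤ {suc k} f = f zero +ℤ sumFinℤ (f ∘ suc)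

allFin : ∀ {k} → (Fin k → Bool) → Bool
allFin {zero}  p = true
allFin {suc k} p = p zero ∧ allFin (p ∘ suc)

countFin : ∀ {k} → (Fin k → Bool) → ℕ
countFin {zero}  p = 0
countFin {suc k} p = (if p zero then 1 else 0) Data.Nat.+ countFin (p ∘ suc)

signℤ : ℕ → ℤ
signℤ zero = + 1
signℤ (suc n) = -ℤ (signℤ n)

module _ {d m : ℕ} (A : Fin m → Pt d) (b : Fin m → ℚ) where

  indP : Pt d → ℤ
  indP x = if allFin (λ k → does (b k ≤? A k · x)) then + 1 else + 0

  inTσ : Pt d → (Fin d → Fin m) → (Fin d → ℚ) → Pt d → Bool
  inTσ v s a x = allFin λ j →
    if does (0ℚ <? a j) then does (A (s j) · v ≤? A (s j) · x)
    else if does (a j <? 0ℚ) then does (A (s j) · x <? A (s j) · v)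
    else true

  indξ : (Fin d → ℚ) → ℕ
  indξ a = countFin (λ j → does (a j <? 0ℚ))

  indΔ : ∀ {v ξ} → RegTriang A b v ξ → Pt d → ℤ
  indΔ {v} Δ x = sumFinℤ λ i →
    if inTσ v (cones i) (α i) x then signℤ (indξ (α i)) else + 0
    where open RegTriang Δ

  sumVerts : ∀ {ξ} {vs : List (Pt d)} → All (λ v → RegTriang A b v ξ) vs → Pt d → ℤ
  sumVerts [] x = + 0
  sumVerts (Δ ∷ Δs) x = indΔ Δ x +ℤ sumVerts Δs x

{-# OPTIONS --safe #-}

-- For a cone σ with generators n_j, ξ = Σ α_j n_j and y_j = n_j (x − v), the signed indicator
-- (−1)^ind(σ) [x ∈ T^ξ_v T_σ] is the product of the factors [α_j > 0] − [y_j < 0].  Let ξ move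
-- along a path ξ + t u with u (x − v) < 0 for every vertex v involved.  For t → ∞ all products
-- vanish, because a nonzero one forces ξ (x − v) = Σ α_j y_j ≥ 0; hence a signed sum over cones is
-- minus the sum of its jumps.  Jumps occur where ξ + t u crosses the span H of a facet of a cone;
-- the facets in H are simplicial cones of H, the jump of one of them is its own product, and their
-- signed sum covers generic points of H zero times as soon as the original sum of cones covers
-- generic points a constant number of times.  So jumps cancel by induction on the dimension,
-- whether or not the triangulations match along H.  If no u exists, all y_j are nonnegative and
-- the sum of the products is just the number of cones covering ξ.
--
-- Two triangulations of the same normal cone, taken with opposite signs, cover nothing.  All the
-- cones of all the vertices cover generic points once (linear programming duality), and for x
-- outside P the normal of a violated facet serves as u.

module Submission where

open import Defs
open import Level using (0ℓ)
open import Data.Bool using (Bool; true; false; if_then_else_; _∧_)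
open import Data.Nat as ℕ using (ℕ; zero; suc)
import Data.Nat.Properties as ℕ
open import Data.Fin using (Fin; zero; suc; punchIn)
open import Data.Fin.Properties using (any?; all?; punchInᵢ≢i; punchIn-injective; suc-injective) renaming (_≟_ to _≟F_)
open import Data.Integer using (ℤ; 0ℤ; 1ℤ; -1ℤ) renaming (_+_ to _+ℤ_; _*_ to _*ℤ_; _-_ to _-ℤ_)
import Data.Integer.Properties as ℤ
open import Data.Integer.Tactic.RingSolver using () renaming (solve-∀ to solveℤ-∀)
open import Data.Rational using (ℚ; 0ℚ; 1ℚ; _+_; _*_; _-_; -_; _≤_; _<_; 1/_; ≢-nonZero; positive; negative; nonNegative; _⊓_)
open import Data.Rational.Properties
open import Data.Maybe using (Maybe; just; nothing)
open import Data.Unit using (⊤; tt)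
open import Data.Vec using ([]; _∷_)
import Data.Vec as Vec
import Data.Vec.Functional as VF
open import Data.Vec.Functional.Properties using (insertAt-lookup; insertAt-punchIn)
open import Data.List as List using (List; []; _∷_; _++_; length; map; filter; tabulate; cartesianProduct; cartesianProductWith)
open import Data.List.Properties using (filter-notAll)
open import Data.List.Relation.Unary.All using (All; []; _∷_)
open import Data.List.Relation.Unary.All.Properties using (All¬⇒¬Any)
open import Data.List.Relation.Unary.AllPairs using ([]; _∷_)
open import Data.List.Relation.Unary.Any using (here; there) renaming (any? to anyL?)
open import Data.List.Relation.Unary.Unique.Propositional using (Unique)
open import Data.List.Membership.Propositional using (_∈_; find; lose)
open import Data.List.Membership.Propositional.Properties using (∈-map⁺; ∈-map⁻; ∈-filter⁺; ∈-filter⁻; ∈-++⁺ˡ; ∈-++⁺ʳ; ∈-++⁻; ∈-cartesianProduct⁺; ∈-cartesianProduct⁻; ∈-cartesianProductWith⁺; ∈-allFin; ∈-tabulate⁺; ∈-tabulate⁻)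
open import Data.Product using (∃; _×_; _,_; proj₁; proj₂)
open import Data.Sum using (_⊎_; inj₁; inj₂)
open import Relation.Nullary using (¬_; Dec; does; yes; no; contradiction)
open import Relation.Nullary.Decidable using (¬?; decidable-stable; dec-true; dec-false)
open import Relation.Unary using (Decidable)
open import Relation.Binary using (tri<; tri≈; tri>)
open import Relation.Binary.PropositionalEquality using (_≡_; _≢_; refl; sym; trans; cong; cong₂; subst; subst₂; module ≡-Reasoning)
open import Function using (_∘_; id; case_of_)
open import Algebra using (CommutativeRing)
open import Algebra.Properties.AbelianGroup ℤ.+-0-abelianGroup using () renaming (∙-cancelʳ to +ℤ-cancelʳ)
open import Algebra.Properties.Semiring.Sum (CommutativeRing.semiring +-*-commutativeRing) using (sum; sum-cong-≗; sum-remove; *-distribʳ-sum; ∑-distrib-+)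
open import Tactic.RingSolver using (solve-∀)
open import Tactic.RingSolver.Core.AlmostCommutativeRing using (AlmostCommutativeRing; fromCommutativeRing)


-- Two obstacles shape the induction. Several facets may be crossed at one moment, and if two facets
-- of the same cone were crossed together, its jump would no longer be a single product. Hence `u`
-- is chosen off the kernel of every `minor` of two wall covectors that does not vanish on the whole
-- subspace. Walls crossed together then have proportional covectors, so they share one hyperplane,
-- and no cone contributes two of them. Moreover, H may contain facets of cones at different
-- vertices. The inductive statement therefore lets every cone carry its own vector x - v and keeps
-- only an inequality between these vectors that facets inherit and that produces `u`. Subspaces are
-- predicates, with a basis read off from each cone, so no coordinates on H have to be chosen.

ringℚ : AlmostCommutativeRing 0ℓ 0ℓ
ringℚ = fromCommutativeRing +-*-commutativeRing isZero
  where
  isZero : ∀ x → Maybe (0ℚ ≡ x)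
  isZero x with 0ℚ ≟ x
  ... | yes p = just p
  ... | no  _ = nothing

-- Ordered field

*-pos : ∀ {a b} → 0ℚ < a → 0ℚ < b → 0ℚ < a * b
*-pos {a} {b} 0<a 0<b = positive⁻¹ (a * b) {{pos*pos⇒pos a {{positive 0<a}} b {{positive 0<b}}}}

*-pos-neg : ∀ {a b} → 0ℚ < a → b < 0ℚ → a * b < 0ℚ
*-pos-neg {a} {b} 0<a b<0 = negative⁻¹ (a * b) {{pos*neg⇒neg a {{positive 0<a}} b {{negative b<0}}}}

*-neg-pos : ∀ {a b} → a < 0ℚ → 0ℚ < b → a * b < 0ℚ
*-neg-pos {a} {b} a<0 0<b = subst (_< 0ℚ) (*-comm b a) (*-pos-neg 0<b a<0)

*-neg-neg : ∀ {a b} → a < 0ℚ → b < 0ℚ → 0ℚ < a * b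
*-neg-neg {a} {b} a<0 b<0 = positive⁻¹ (a * b) {{neg*neg⇒pos a {{negative a<0}} b {{negative b<0}}}}

*-nonNeg : ∀ {a b} → 0ℚ ≤ a → 0ℚ ≤ b → 0ℚ ≤ a * b
*-nonNeg {a} {b} 0≤a 0≤b = nonNegative⁻¹ (a * b) {{nonNeg*nonNeg⇒nonNeg a {{nonNegative 0≤a}} b {{nonNegative 0≤b}}}}

≤⇒0≤- : ∀ {a b} → a ≤ b → 0ℚ ≤ b - a
≤⇒0≤- {a} {b} a≤b = subst (_≤ b - a) (+-inverseʳ a) (+-monoˡ-≤ (- a) a≤b)

<⇒0<- : ∀ {a b} → a < b → 0ℚ < b - a
<⇒0<- {a} {b} a<b = subst (_< b - a) (+-inverseʳ a) (+-monoˡ-< (- a) a<b)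

<⇒-<0 : ∀ {a b} → a < b → a - b < 0ℚ
<⇒-<0 {a} {b} a<b = subst (a - b <_) (+-inverseʳ b) (+-monoˡ-< (- b) a<b)

0≤-⇒≤ : ∀ {a b} → 0ℚ ≤ b - a → a ≤ b
0≤-⇒≤ {a} {b} p = subst₂ _≤_ (+-identityˡ a) (eq a b) (+-monoˡ-≤ a p)
  where
  eq : ∀ a b → b - a + a ≡ b
  eq = solve-∀ ringℚ

0<-⇒< : ∀ {a b} → 0ℚ < b - a → a < b
0<-⇒< {a} {b} p = subst₂ _<_ (+-identityˡ a) (eq a b) (+-monoˡ-< a p)
  where
  eq : ∀ a b → b - a + a ≡ b
  eq = solve-∀ ringℚ

neg⇒0<- : ∀ {a} → a < 0ℚ → 0ℚ < - a
neg⇒0<- = neg-antimono-<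

pos⇒-<0 : ∀ {a} → 0ℚ < a → - a < 0ℚ
pos⇒-<0 = neg-antimono-<

≤∧≢⇒< : ∀ {a b} → a ≤ b → a ≢ b → a < b
≤∧≢⇒< {a} {b} a≤b a≢b with <-cmp a b
... | tri< a<b _ _ = a<b
... | tri≈ _ a≡b _ = contradiction a≡b a≢b
... | tri> _ _ b<a = contradiction (≤-<-trans a≤b b<a) (<-irrefl refl)

≢0⇒<⊎> : ∀ {a} → a ≢ 0ℚ → a < 0ℚ ⊎ 0ℚ < a
≢0⇒<⊎> {a} a≢0 with <-cmp a 0ℚ
... | tri< a<0 _ _ = inj₁ a<0
... | tri≈ _ a≡0 _ = contradiction a≡0 a≢0
... | tri> _ _ 0<a = inj₂ 0<a

⊓-pos : ∀ {a b} → 0ℚ < a → 0ℚ < b → 0ℚ < a ⊓ b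
⊓-pos {a} {b} 0<a 0<b with ≤-total a b
... | inj₁ a≤b = subst (0ℚ <_) (sym (p≤q⇒p⊓q≡p a≤b)) 0<a
... | inj₂ b≤a = subst (0ℚ <_) (sym (p≥q⇒p⊓q≡q b≤a)) 0<b

-- Totalised inverse: inv 0 = 0.
inv : ℚ → ℚ
inv a with a ≟ 0ℚ
... | yes _   = 0ℚ
... | no  a≢0 = (1/ a) {{≢-nonZero a≢0}}

*-inv : ∀ {a} → a ≢ 0ℚ → a * inv a ≡ 1ℚ
*-inv {a} a≢0 with a ≟ 0ℚ
... | yes a≡0 = contradiction a≡0 a≢0
... | no  a≢0 = *-inverseʳ a {{≢-nonZero a≢0}}

0<1 : 0ℚ < 1ℚ
0<1 = positive⁻¹ 1ℚ

inv-pos : ∀ {a} → 0ℚ < a → 0ℚ < inv a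
inv-pos {a} 0<a with <-cmp 0ℚ (inv a)
... | tri< p _ _ = p
... | tri≈ _ p _ = contradiction (trans (sym (*-zeroʳ a)) (trans (cong (a *_) p) (*-inv (<⇒≢ 0<a ∘ sym)))) (<⇒≢ 0<1)
... | tri> _ _ p = contradiction (subst (_< 0ℚ) (*-inv (<⇒≢ 0<a ∘ sym)) (*-pos-neg 0<a p)) (<-asym 0<1)

*≡0⇒≡0 : ∀ {a b} → a ≢ 0ℚ → a * b ≡ 0ℚ → b ≡ 0ℚ
*≡0⇒≡0 {a} {b} a≢0 ab≡0 = begin
  b                ≡⟨ *-identityˡ b ⟨
  1ℚ * b           ≡⟨ cong (_* b) (*-inv a≢0) ⟨
  a * inv a * b    ≡⟨ eq a (inv a) b ⟩
  inv a * (a * b)  ≡⟨ cong (inv a *_) ab≡0 ⟩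
  inv a * 0ℚ       ≡⟨ *-zeroʳ (inv a) ⟩
  0ℚ               ∎
  where
  open ≡-Reasoning
  eq : ∀ a i b → a * i * b ≡ i * (a * b)
  eq = solve-∀ ringℚ

sum-zero : ∀ {n} {f : Fin n → ℚ} → (∀ i → f i ≡ 0ℚ) → sum f ≡ 0ℚ
sum-zero {zero}  f≡0 = refl
sum-zero {suc n} f≡0 = cong₂ _+_ (f≡0 zero) (sum-zero (f≡0 ∘ suc))

sum-nonNeg : ∀ {n} {f : Fin n → ℚ} → (∀ i → 0ℚ ≤ f i) → 0ℚ ≤ sum f
sum-nonNeg {zero}  0≤f = ≤-refl
sum-nonNeg {suc n} 0≤f = +-mono-≤ (0≤f zero) (sum-nonNeg (0≤f ∘ suc))

sum-mono : ∀ {n} {f g : Fin n → ℚ} → (∀ i → f i ≤ g i) → sum f ≤ sum g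
sum-mono {zero}  f≤g = ≤-refl
sum-mono {suc n} f≤g = +-mono-≤ (f≤g zero) (sum-mono (f≤g ∘ suc))

sum-single : ∀ {n} (f : Fin n → ℚ) j → (∀ k → k ≢ j → f k ≡ 0ℚ) → sum f ≡ f j
sum-single {suc n} f j f≡0 = begin
  sum f                          ≡⟨ sum-remove {i = j} f ⟩
  f j + sum (f ∘ punchIn j)      ≡⟨ cong (f j +_) (sum-zero λ k → f≡0 (punchIn j k) (punchInᵢ≢i j k)) ⟩
  f j + 0ℚ                       ≡⟨ +-identityʳ (f j) ⟩
  f j                            ∎
  where open ≡-Reasoning

-- Vectors, handled through their products with arbitrary covectors

·-comm : ∀ {d} (u w : Pt d) → u · w ≡ w · u
·-comm []      []      = refl
·-comm (a ∷ u) (b ∷ w) = cong₂ _+_ (*-comm a b) (·-comm u w)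

·-zeroʳ : ∀ {d} (u : Pt d) → u · zeroV ≡ 0ℚ
·-zeroʳ []      = refl
·-zeroʳ (a ∷ u) = cong₂ _+_ (*-zeroʳ a) (·-zeroʳ u)

·-⊕ʳ : ∀ {d} (z u w : Pt d) → z · (u ⊕ w) ≡ z · u + z · w
·-⊕ʳ []      []      []      = refl
·-⊕ʳ (c ∷ z) (a ∷ u) (b ∷ w) = trans (cong (c * (a + b) +_) (·-⊕ʳ z u w)) (eq c a b (z · u) (z · w))
  where
  eq : ∀ c a b s t → c * (a + b) + (s + t) ≡ c * a + s + (c * b + t)
  eq = solve-∀ ringℚ

·-•ʳ : ∀ {d} (z : Pt d) t u → z · (t • u) ≡ t * (z · u)
·-•ʳ []      t []      = sym (*-zeroʳ t)
·-•ʳ (c ∷ z) t (a ∷ u) = trans (cong (c * (t * a) +_) (·-•ʳ z t u)) (eq c t a (z · u))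
  where
  eq : ∀ c t a s → c * (t * a) + t * s ≡ t * (c * a + s)
  eq = solve-∀ ringℚ

·-axpy : ∀ {d} (z u : Pt d) t w → z · (u ⊕ (t • w)) ≡ z · u + t * (z · w)
·-axpy z u t w = trans (·-⊕ʳ z u (t • w)) (cong (z · u +_) (·-•ʳ z t w))

·-comb : ∀ {d} (z : Pt d) s u t w → z · ((s • u) ⊕ (t • w)) ≡ s * (z · u) + t * (z · w)
·-comb z s u t w = trans (·-axpy z (s • u) t w) (cong (_+ t * (z · w)) (·-•ʳ z s u))

·-axpyˡ : ∀ {d} (u : Pt d) t w z → (u ⊕ (t • w)) · z ≡ u · z + t * (w · z)
·-axpyˡ u t w z = begin
  (u ⊕ (t • w)) · z        ≡⟨ ·-comm (u ⊕ (t • w)) z ⟩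
  z · (u ⊕ (t • w))        ≡⟨ ·-axpy z u t w ⟩
  z · u + t * (z · w)      ≡⟨ cong₂ (λ a b → a + t * b) (·-comm z u) (·-comm z w) ⟩
  u · z + t * (w · z)      ∎
  where open ≡-Reasoning

·-combˡ : ∀ {d} s (u : Pt d) t w z → ((s • u) ⊕ (t • w)) · z ≡ s * (u · z) + t * (w · z)
·-combˡ s u t w z = begin
  ((s • u) ⊕ (t • w)) · z        ≡⟨ ·-comm ((s • u) ⊕ (t • w)) z ⟩
  z · ((s • u) ⊕ (t • w))        ≡⟨ ·-comb z s u t w ⟩
  s * (z · u) + t * (z · w)      ≡⟨ cong₂ (λ a b → s * a + t * b) (·-comm z u) (·-comm z w) ⟩
  s * (u · z) + t * (w · z)      ∎
  where open ≡-Reasoning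

·-lincomb : ∀ {d k} (z : Pt d) (c : Fin k → ℚ) g → z · lincomb c g ≡ sum (λ i → c i * (z · g i))
·-lincomb {k = zero}  z c g = ·-zeroʳ z
·-lincomb {k = suc k} z c g = begin
  z · ((c zero • g zero) ⊕ lincomb (c ∘ suc) (g ∘ suc))
    ≡⟨ ·-⊕ʳ z (c zero • g zero) (lincomb (c ∘ suc) (g ∘ suc)) ⟩
  z · (c zero • g zero) + z · lincomb (c ∘ suc) (g ∘ suc)
    ≡⟨ cong₂ _+_ (·-•ʳ z (c zero) (g zero)) (·-lincomb z (c ∘ suc) (g ∘ suc)) ⟩
  c zero * (z · g zero) + sum (λ i → c (suc i) * (z · g (suc i)))  ∎
  where open ≡-Reasoning

·-ext : ∀ {d} (u w : Pt d) → (∀ z → z · u ≡ z · w) → u ≡ w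
·-ext []      []      eq = refl
·-ext (a ∷ u) (b ∷ w) eq = cong₂ _∷_ head≡ (·-ext u w tail≡)
  where
  unit : ∀ {d} a (v : Pt d) → (1ℚ ∷ zeroV) · (a ∷ v) ≡ a
  unit a v = trans (cong₂ _+_ (*-identityˡ a) (trans (·-comm zeroV v) (·-zeroʳ v))) (+-identityʳ a)
  head≡ : a ≡ b
  head≡ = trans (sym (unit a u)) (trans (eq (1ℚ ∷ zeroV)) (unit b w))
  shift : ∀ {d} a (z v : Pt d) → (0ℚ ∷ z) · (a ∷ v) ≡ z · v
  shift a z v = trans (cong (_+ z · v) (*-zeroˡ a)) (+-identityˡ (z · v))
  tail≡ : ∀ z → z · u ≡ z · w
  tail≡ z = trans (sym (shift a z u)) (trans (eq (0ℚ ∷ z)) (shift b z w))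

-- Stability of signs under small moves, and generic points

SameSign : ℚ → ℚ → Set
SameSign a b = (0ℚ < a → 0ℚ < b) × (a < 0ℚ → b < 0ℚ)

private
  pos-stable : ∀ a b → 0ℚ < a → ∃ λ δ → 0ℚ < δ × ∀ η → 0ℚ < η → η ≤ δ → 0ℚ < a + η * b
  pos-stable a b 0<a with <-cmp b 0ℚ
  ... | tri> _ _ 0<b = 1ℚ , 0<1 , λ η 0<η _ → +-mono-< 0<a (*-pos 0<η 0<b)
  ... | tri≈ _ refl _ = 1ℚ , 0<1 , λ η _ _ → subst (0ℚ <_) (eq a η) 0<a
    where
    eq : ∀ a η → a ≡ a + η * 0ℚ
    eq = solve-∀ ringℚ
  -- The bound a / (a - b) lies strictly before the zero a / (-b). The value there, a² / (a - b),
  -- bounds the values at all smaller `η` from below.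
  ... | tri< b<0 _ _ = a * inv (a - b) , *-pos 0<a (inv-pos 0<a-b) , λ η 0<η η≤δ →
      <-≤-trans (*-pos 0<a (*-pos 0<a (inv-pos 0<a-b)))
        (0≤-⇒≤ (subst (0ℚ ≤_) (eq₂ η) (*-nonNeg (≤⇒0≤- η≤δ) (<⇒≤ (neg⇒0<- b<0)))))
    where
    0<a-b : 0ℚ < a - b
    0<a-b = +-mono-< 0<a (neg⇒0<- b<0)
    eq₁ : ∀ a b i η → (a * i - η) * - b ≡ a + η * b + (a * (a - b) * i - a) - a * (a * i)
    eq₁ = solve-∀ ringℚ
    one : a * (a - b) * inv (a - b) - a ≡ 0ℚ
    one = trans (cong (_- a) (trans (*-assoc a (a - b) (inv (a - b)))
                 (trans (cong (a *_) (*-inv (<⇒≢ 0<a-b ∘ sym))) (*-identityʳ a)))) (+-inverseʳ a)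
    eq₂ : ∀ η → (a * inv (a - b) - η) * - b ≡ a + η * b - a * (a * inv (a - b))
    eq₂ η = trans (eq₁ a b (inv (a - b)) η)
              (cong (_- a * (a * inv (a - b))) (trans (cong (a + η * b +_) one) (+-identityʳ (a + η * b))))

  sign-stable : ∀ a b → ∃ λ δ → 0ℚ < δ × ∀ η → 0ℚ < η → η ≤ δ → SameSign a (a + η * b)
  sign-stable a b with <-cmp a 0ℚ
  ... | tri≈ a≮0 _ 0≮a = 1ℚ , 0<1 , λ _ _ _ → (λ 0<a → contradiction 0<a 0≮a) , λ a<0 → contradiction a<0 a≮0
  ... | tri> a≮0 _ 0<a = let δ , 0<δ , h = pos-stable a b 0<a in
    δ , 0<δ , λ η p q → (λ _ → h η p q) , λ a<0 → contradiction a<0 a≮0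
  ... | tri< a<0 _ 0≮a = let δ , 0<δ , h = pos-stable (- a) (- b) (neg⇒0<- a<0) in
    δ , 0<δ , λ η p q → (λ 0<a → contradiction 0<a 0≮a) ,
      λ _ → subst (_< 0ℚ) (eq a b η) (pos⇒-<0 (h η p q))
    where
    eq : ∀ a b η → - (- a + η * - b) ≡ a + η * b
    eq = solve-∀ ringℚ

-- The minimum of finitely many bounds. A value that is zero at `w` may acquire either sign, which
-- is why `SameSign` demands nothing of zero.
signs-stable : ∀ {d} (L : List (Pt d)) w z →
  ∃ λ δ → 0ℚ < δ × ∀ η → 0ℚ < η → η ≤ δ → ∀ {ℓ} → ℓ ∈ L → SameSign (ℓ · w) (ℓ · (w ⊕ (η • z)))
signs-stable []      w z = 1ℚ , 0<1 , λ _ _ _ ()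
signs-stable (ℓ ∷ L) w z =
  let δ₁ , 0<δ₁ , h₁ = sign-stable (ℓ · w) (ℓ · z)
      δ₂ , 0<δ₂ , h₂ = signs-stable L w z
  in δ₁ ⊓ δ₂ , ⊓-pos 0<δ₁ 0<δ₂ , λ η 0<η η≤δ → λ
    { (here refl) → subst (SameSign (ℓ · w)) (sym (·-axpy ℓ w η z)) (h₁ η 0<η (≤-trans η≤δ (p⊓q≤p δ₁ δ₂)))
    ; (there ℓ∈L) → h₂ η 0<η (≤-trans η≤δ (p⊓q≤q δ₁ δ₂)) ℓ∈L }

SameSign⇒≢0 : ∀ {a b} → SameSign a b → a ≢ 0ℚ → b ≢ 0ℚ
SameSign⇒≢0 (pos , neg) a≢0 b≡0 with ≢0⇒<⊎> a≢0
... | inj₁ a<0 = <⇒≢ (neg a<0) b≡0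
... | inj₂ 0<a = <⇒≢ (pos 0<a) (sym b≡0)

-- Subspaces of ℚ^d are predicates closed under u, w ↦ u + t w.
Closed : ∀ {d} → (Pt d → Set) → Set
Closed W = ∀ {u w} t → W u → W w → W (u ⊕ (t • w))

-- The functionals in `L` are treated one at a time: `u` is moved along a `z` on which the new one
-- is nonzero, so little that all strict signs already obtained survive. Functionals that vanish on
-- all of `W` cannot be avoided, so this alternative stays in the conclusion.
generic-point : ∀ {d} {W : Pt d → Set} → Closed W → (K L : List (Pt d)) →
  (∀ {m} → m ∈ L → (∃ λ z → W z × m · z ≢ 0ℚ) ⊎ (∀ w → W w → m · w ≡ 0ℚ)) →
  ∀ u₀ → W u₀ → (∀ {κ} → κ ∈ K → κ · u₀ < 0ℚ) →
  ∃ λ u → W u × (∀ {κ} → κ ∈ K → κ · u < 0ℚ) ×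
    (∀ {m} → m ∈ L → m · u ≢ 0ℚ ⊎ (∀ w → W w → m · w ≡ 0ℚ))
generic-point cl K []      dec u₀ Wu₀ K<0 = u₀ , Wu₀ , K<0 , λ ()
generic-point {d} {W} cl K (m ∷ L) dec u₀ Wu₀ K<0 with generic-point cl K L (dec ∘ there) u₀ Wu₀ K<0
... | u , Wu , Ku<0 , Lu with dec (here refl)
... | inj₂ m≡0 = u , Wu , Ku<0 , λ { (here refl) → inj₂ m≡0 ; (there m∈L) → Lu m∈L }
... | inj₁ (z , Wz , mz≢0) = u′ , cl η Wu Wz , (λ κ∈K → proj₂ (hK η 0<η ηK κ∈K) (Ku<0 κ∈K)) , avoid
  where
  stK = signs-stable K u z
  stL = signs-stable (m ∷ L) u z
  hK = proj₂ (proj₂ stK)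
  hL = proj₂ (proj₂ stL)
  η = proj₁ stK ⊓ proj₁ stL
  ηK : η ≤ proj₁ stK
  ηK = p⊓q≤p (proj₁ stK) (proj₁ stL)
  ηL : η ≤ proj₁ stL
  ηL = p⊓q≤q (proj₁ stK) (proj₁ stL)
  0<η : 0ℚ < η
  0<η = ⊓-pos (proj₁ (proj₂ stK)) (proj₁ (proj₂ stL))
  u′ : Pt d
  u′ = u ⊕ (η • z)
  avoid : ∀ {m′} → m′ ∈ m ∷ L → m′ · u′ ≢ 0ℚ ⊎ (∀ w → W w → m′ · w ≡ 0ℚ)
  avoid (there m′∈L) with Lu m′∈L
  ... | inj₁ ≢0 = inj₁ (SameSign⇒≢0 (hL η 0<η ηL (there m′∈L)) ≢0)
  ... | inj₂ ≡0 = inj₂ ≡0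
  avoid (here refl) with m · u ≟ 0ℚ
  ... | no  mu≢0 = inj₁ (SameSign⇒≢0 (hL η 0<η ηL (here refl)) mu≢0)
  ... | yes mu≡0 = inj₁ λ mu′≡0 → mz≢0 (*≡0⇒≡0 (<⇒≢ 0<η ∘ sym)
        (trans (sym (+-identityˡ (η * (m · z)))) (trans (cong (_+ η * (m · z)) (sym mu≡0)) (trans (sym (·-axpy m u η z)) mu′≡0))))

-- Theorems of the alternative

·-zeroˡ : ∀ {d} (u : Pt d) → zeroV · u ≡ 0ℚ
·-zeroˡ u = trans (·-comm zeroV u) (·-zeroʳ u)

sum-*-+ : ∀ {n} (c f g : Fin n → ℚ) s → sum (λ k → c k * (f k + g k * s)) ≡ sum (λ k → c k * f k) + sum (λ k → c k * g k) * s
sum-*-+ c f g s = begin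
  sum (λ k → c k * (f k + g k * s))                       ≡⟨ sum-cong-≗ (λ k → eq (c k) (f k) (g k) s) ⟩
  sum (λ k → c k * f k + c k * g k * s)                   ≡⟨ ∑-distrib-+ (λ k → c k * f k) (λ k → c k * g k * s) ⟩
  sum (λ k → c k * f k) + sum (λ k → c k * g k * s)       ≡⟨ cong (sum (λ k → c k * f k) +_) (*-distribʳ-sum s (λ k → c k * g k)) ⟨
  sum (λ k → c k * f k) + sum (λ k → c k * g k) * s       ∎
  where
  open ≡-Reasoning
  eq : ∀ c f g s → c * (f + g * s) ≡ c * f + c * g * s
  eq = solve-∀ ringℚ

zero? : ∀ {d} (w : Pt d) → w ≡ zeroV ⊎ ∃ λ z → z · w < 0ℚ
zero? []      = inj₁ refl
zero? (a ∷ w) with <-cmp a 0ℚ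
... | tri< a<0 _ _ = inj₂ (1ℚ ∷ zeroV , subst (_< 0ℚ) (sym (trans (cong₂ _+_ (*-identityˡ a) (·-zeroˡ w)) (+-identityʳ a))) a<0)
... | tri> _ _ 0<a = inj₂ (- 1ℚ ∷ zeroV , subst (_< 0ℚ) (sym (trans (cong (- 1ℚ * a +_) (·-zeroˡ w)) (eq a))) (pos⇒-<0 0<a))
  where
  eq : ∀ a → - 1ℚ * a + 0ℚ ≡ - a
  eq = solve-∀ ringℚ
... | tri≈ _ refl _ with zero? w
...   | inj₁ w≡0       = inj₁ (cong (0ℚ ∷_) w≡0)
...   | inj₂ (z , zw<0) = inj₂ (0ℚ ∷ z , subst (_< 0ℚ) (sym (+-identityˡ (z · w))) zw<0)

-- Farkas' lemma and the Fredholm alternative at once: the kind of a vector says how its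
-- coefficient and its product with the separating covector are constrained.
data Kind : Set where
  nonneg free unused : Kind

Coeff Sep : Kind → ℚ → Set
Coeff nonneg c = 0ℚ ≤ c
Coeff free   c = ⊤
Coeff unused c = c ≡ 0ℚ
Sep nonneg t = 0ℚ ≤ t
Sep free   t = t ≡ 0ℚ
Sep unused t = ⊤

Solvable Separable : ∀ {d n} → (Fin n → Kind) → (Fin n → Pt d) → Pt d → Set
Solvable κ a w = ∃ λ c → (∀ k → Coeff (κ k) (c k)) × lincomb c a ≡ w
Separable κ a w = ∃ λ z → (∀ k → Sep (κ k) (z · a k)) × z · w < 0ℚ

-- Bartl's induction: a covector z̄ separating w from all vectors but the first one allows us to
-- project along the first vector onto the kernel of z̄.
farkas : ∀ {d n} (κ : Fin n → Kind) (a : Fin n → Pt d) w → Solvable κ a w ⊎ Separable κ a w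
farkas {n = zero} κ a w with zero? w
... | inj₁ w≡0        = inj₁ ((λ ()) , (λ ()) , sym w≡0)
... | inj₂ (z , zw<0) = inj₂ (z , (λ ()) , zw<0)
farkas {d} {suc n} κ a w with farkas (κ ∘ suc) (a ∘ suc) w
... | inj₁ (c , c-ok , eq) = inj₁ (0ℚ VF.∷ c , ok , ·-ext _ w λ z → trans (·-lincomb z (0ℚ VF.∷ c) a)
        (trans (cong (0ℚ * (z · a zero) +_) (sym (·-lincomb z c (a ∘ suc)))) (trans (drop (z · a zero) _) (cong (z ·_) eq))))
  where
  drop : ∀ x y → 0ℚ * x + y ≡ y
  drop = solve-∀ ringℚ
  ok₀ : ∀ κ → Coeff κ 0ℚ
  ok₀ nonneg = ≤-refl
  ok₀ free   = tt
  ok₀ unused = refl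
  ok : ∀ k → Coeff (κ k) ((0ℚ VF.∷ c) k)
  ok zero    = ok₀ (κ zero)
  ok (suc k) = c-ok k
... | inj₂ (z̄ , z̄-ok , z̄w<0) = cases (κ zero) refl
  where
  p = z̄ · a zero
  extend : Sep (κ zero) p → ∀ k → Sep (κ k) (z̄ · a k)
  extend ok zero    = ok
  extend ok (suc k) = z̄-ok k
  -- `z̄` fails only because of its value `p` on the first vector: nonzero on a free vector, or
  -- negative on a nonneg one.
  project : p ≢ 0ℚ → κ zero ≡ free ⊎ (κ zero ≡ nonneg × p < 0ℚ) → Solvable κ a w ⊎ Separable κ a w
  project p≢0 kind with farkas (κ ∘ suc) a′ w′
    where
    a′ : Fin n → Pt d
    a′ k = a (suc k) ⊕ ((- (z̄ · a (suc k) * inv p)) • a zero)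
    w′ = w ⊕ ((- (z̄ · w * inv p)) • a zero)
  ... | inj₁ (c , c-ok , eq) = inj₁ (c₀ VF.∷ c , ok , ·-ext _ w λ z → begin
          z · lincomb (c₀ VF.∷ c) a
            ≡⟨ ·-lincomb z (c₀ VF.∷ c) a ⟩
          c₀ * (z · a zero) + sum (λ k → c k * (z · a (suc k)))
            ≡⟨ ring (sum (λ k → c k * r k)) (z̄ · w * inv p) (z · a zero) (sum (λ k → c k * (z · a (suc k)))) ⟩
          sum (λ k → c k * (z · a (suc k))) + sum (λ k → c k * r k) * (z · a zero) + (z̄ · w * inv p) * (z · a zero)
            ≡⟨ cong (_+ (z̄ · w * inv p) * (z · a zero)) (trans (sym (sum-*-+ c (λ k → z · a (suc k)) r (z · a zero)))
                 (trans (sum-cong-≗ λ k → cong (c k *_) (sym (·-axpy z (a (suc k)) (r k) (a zero))))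
                   (trans (sym (·-lincomb z c _)) (trans (cong (z ·_) eq) (·-axpy z w (- (z̄ · w * inv p)) (a zero)))))) ⟩
          z · w + - (z̄ · w * inv p) * (z · a zero) + (z̄ · w * inv p) * (z · a zero)
            ≡⟨ ring′ (z · w) (z̄ · w * inv p) (z · a zero) ⟩
          z · w ∎)
    where
    open ≡-Reasoning
    r : Fin n → ℚ
    r k = - (z̄ · a (suc k) * inv p)
    -- The first vector collects everything the projections subtracted. If `p` is negative, every
    -- summand is nonnegative: `z̄ · w` and `inv p` are both negative, and for each kind the product
    -- of `c k` with `z̄ · a (suc k)` is at least 0.
    c₀ = sum (λ k → c k * r k) + z̄ · w * inv p
    ring : ∀ s t x y → (s + t) * x + y ≡ y + s * x + t * x
    ring = solve-∀ ringℚ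
    ring′ : ∀ x t y → x + - t * y + t * y ≡ x
    ring′ = solve-∀ ringℚ
    -inv-pos : p < 0ℚ → inv p < 0ℚ
    -inv-pos p<0 with <-cmp (inv p) 0ℚ
    ... | tri< i<0 _ _ = i<0
    ... | tri≈ _ i≡0 _ = contradiction (trans (sym (*-zeroʳ p)) (trans (cong (p *_) (sym i≡0)) (*-inv p≢0))) (<⇒≢ 0<1)
    ... | tri> _ _ 0<i = contradiction (subst (_< 0ℚ) (*-inv p≢0) (*-neg-pos p<0 0<i)) (<-asym 0<1)
    0≤cr : p < 0ℚ → ∀ κ {c} {x} → Coeff κ c → Sep κ x → 0ℚ ≤ c * - (x * inv p)
    0≤cr p<0 nonneg {c} {x} 0≤c 0≤x = subst (0ℚ ≤_) (eq′ c x (inv p)) (*-nonNeg (*-nonNeg 0≤c 0≤x) (<⇒≤ (neg⇒0<- (-inv-pos p<0))))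
      where
      eq′ : ∀ c x i → c * x * - i ≡ c * - (x * i)
      eq′ = solve-∀ ringℚ
    0≤cr p<0 free {c} {x} _ refl = ≤-reflexive (eq′ c (inv p))
      where
      eq′ : ∀ c i → 0ℚ ≡ c * - (0ℚ * i)
      eq′ = solve-∀ ringℚ
    0≤cr p<0 unused {c} {x} refl _ = ≤-reflexive (sym (*-zeroˡ (- (x * inv p))))
    ok₀ : κ zero ≡ free ⊎ (κ zero ≡ nonneg × p < 0ℚ) → Coeff (κ zero) c₀
    ok₀ (inj₁ isFree)         = subst (λ κ → Coeff κ c₀) (sym isFree) tt
    ok₀ (inj₂ (isNonneg , p<0)) = subst (λ κ → Coeff κ c₀) (sym isNonneg)
      (+-mono-≤ (sum-nonNeg λ k → 0≤cr p<0 (κ (suc k)) (c-ok k) (z̄-ok k)) (<⇒≤ (*-neg-neg z̄w<0 (-inv-pos p<0))))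
    ok : ∀ k → Coeff (κ k) ((c₀ VF.∷ c) k)
    ok zero    = ok₀ kind
    ok (suc k) = c-ok k
  ... | inj₂ (z , z-ok , zw′<0) = inj₂ (z′ , ok , subst (_< 0ℚ) (sym (moved w)) zw′<0)
    where
    -- The adjoint of the projection applied to `z`: it kills the first vector and takes on any
    -- other vector the value of `z` on its projection.
    z′ = z ⊕ ((- (z · a zero * inv p)) • z̄)
    moved : ∀ v → z′ · v ≡ z · (v ⊕ ((- (z̄ · v * inv p)) • a zero))
    moved v = trans (·-axpyˡ z (- (z · a zero * inv p)) z̄ v)
      (trans (ring (z · v) (z · a zero) (inv p) (z̄ · v)) (sym (·-axpy z v (- (z̄ · v * inv p)) (a zero))))
      where
      ring : ∀ x y i t → x + - (y * i) * t ≡ x + - (t * i) * y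
      ring = solve-∀ ringℚ
    zero≡ : z′ · a zero ≡ 0ℚ
    zero≡ = trans (·-axpyˡ z (- (z · a zero * inv p)) z̄ (a zero))
      (trans (ring (z · a zero) (inv p) p) (trans (cong (λ o → z · a zero + - (z · a zero) * o) (*-inv p≢0)) (ring′ (z · a zero))))
      where
      ring : ∀ y i p → y + - (y * i) * p ≡ y + - y * (p * i)
      ring = solve-∀ ringℚ
      ring′ : ∀ y → y + - y * 1ℚ ≡ 0ℚ
      ring′ = solve-∀ ringℚ
    ok₀ : ∀ κ → Sep κ 0ℚ
    ok₀ nonneg = ≤-refl
    ok₀ free   = refl
    ok₀ unused = tt
    ok : ∀ k → Sep (κ k) (z′ · a k)
    ok zero    = subst (Sep (κ zero)) (sym zero≡) (ok₀ (κ zero))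
    ok (suc k) = subst (Sep (κ (suc k))) (sym (moved (a (suc k)))) (z-ok k)
  cases : ∀ κ₀ → κ zero ≡ κ₀ → Solvable κ a w ⊎ Separable κ a w
  cases unused κ≡ = inj₂ (z̄ , extend (subst (λ κ → Sep κ p) (sym κ≡) tt) , z̄w<0)
  cases free κ≡ with p ≟ 0ℚ
  ... | yes p≡0 = inj₂ (z̄ , extend (subst (λ κ → Sep κ p) (sym κ≡) p≡0) , z̄w<0)
  ... | no  p≢0 = project p≢0 (inj₁ κ≡)
  cases nonneg κ≡ with 0ℚ ≤? p
  ... | yes 0≤p = inj₂ (z̄ , extend (subst (λ κ → Sep κ p) (sym κ≡) 0≤p) , z̄w<0)
  ... | no  0≰p = project (<⇒≢ (≰⇒> 0≰p)) (inj₂ (κ≡ , ≰⇒> 0≰p))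

-- Linear independence and dual bases

too-many : ∀ {d} (g : Fin (suc d) → Pt d) → ¬ LinIndep g
too-many {zero} g indep = contradiction (sym (indep (λ _ → 1ℚ) (unique _ _) zero)) (<⇒≢ 0<1)
  where
  unique : (u w : Pt 0) → u ≡ w
  unique [] [] = refl
too-many {suc d} g indep = eliminate pivot
  where
  h : Fin (suc (suc d)) → ℚ
  h k = Vec.head (g k)
  Pivot : Set
  Pivot = ∃ λ p → ∃ λ (r : Fin (suc d) → ℚ) → ∀ k → h (punchIn p k) + r k * h p ≡ 0ℚ
  pivot : Pivot
  -- Gaussian elimination in the first coordinate. If all first coordinates vanish, nothing has to
  -- be cleared and any vector may be discarded as the pivot.
  pivot with any? (λ k → ¬? (h k ≟ 0ℚ))
  ... | yes (p , hp≢0) = p , (λ k → - (h (punchIn p k)) * inv (h p)) , λ k →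
        trans (ring (h (punchIn p k)) (inv (h p)) (h p)) (trans (cong (λ o → h (punchIn p k) + - (h (punchIn p k)) * o) (*-inv hp≢0)) (ring′ (h (punchIn p k))))
    where
    ring : ∀ y i p → y + - y * i * p ≡ y + - y * (p * i)
    ring = solve-∀ ringℚ
    ring′ : ∀ y → y + - y * 1ℚ ≡ 0ℚ
    ring′ = solve-∀ ringℚ
  ... | no none = zero , (λ _ → 0ℚ) , λ k →
        trans (cong (_+ 0ℚ * h zero) (decidable-stable (h (suc k) ≟ 0ℚ) λ ≢0 → none (suc k , ≢0))) (ring (h zero))
    where
    ring : ∀ y → 0ℚ + 0ℚ * y ≡ 0ℚ
    ring = solve-∀ ringℚ
  eliminate : ¬ Pivot
  eliminate (p , r , cancel) = too-many g′ indep′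
    where
    v : Fin (suc d) → Pt (suc d)
    v k = g (punchIn p k) ⊕ (r k • g p)
    g′ : Fin (suc d) → Pt d
    g′ k = Vec.tail (v k)
    uncons : ∀ (z : Pt (suc d)) u → Vec.head u ≡ 0ℚ → z · u ≡ Vec.tail z · Vec.tail u
    uncons (s ∷ z) (_ ∷ u) refl = trans (cong (_+ z · u) (*-zeroʳ s)) (+-identityˡ (z · u))
    head-axpy : ∀ (u : Pt (suc d)) s w → Vec.head (u ⊕ (s • w)) ≡ Vec.head u + s * Vec.head w
    head-axpy (_ ∷ _) s (_ ∷ _) = refl
    indep′ : LinIndep g′
    indep′ c c≡0 k = trans (sym (insertAt-punchIn c p s k)) (indep C C≡0 (punchIn p k))
      where
      -- The multiples of `g p` added during the elimination, gathered into its coefficient, so that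
      -- a relation among the tails lifts to one among the original vectors.
      s = sum (λ k → c k * r k)
      C = VF.insertAt c p s
      open ≡-Reasoning
      C≡0 : lincomb C g ≡ zeroV
      C≡0 = ·-ext _ _ λ z → begin
        z · lincomb C g
          ≡⟨ ·-lincomb z C g ⟩
        sum (λ i → C i * (z · g i))
          ≡⟨ sum-remove {i = p} (λ i → C i * (z · g i)) ⟩
        C p * (z · g p) + sum (λ k → C (punchIn p k) * (z · g (punchIn p k)))
          ≡⟨ cong₂ (λ a b → a * (z · g p) + b) (insertAt-lookup c p s)
               (sum-cong-≗ λ k → cong (_* (z · g (punchIn p k))) (insertAt-punchIn c p s k)) ⟩
        s * (z · g p) + sum (λ k → c k * (z · g (punchIn p k)))
          ≡⟨ +-comm (s * (z · g p)) _ ⟩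
        sum (λ k → c k * (z · g (punchIn p k))) + s * (z · g p)
          ≡⟨ sum-*-+ c (λ k → z · g (punchIn p k)) r (z · g p) ⟨
        sum (λ k → c k * (z · g (punchIn p k) + r k * (z · g p)))
          ≡⟨ sum-cong-≗ (λ k → cong (c k *_) (trans (sym (·-axpy z (g (punchIn p k)) (r k) (g p)))
               (uncons z (v k) (trans (head-axpy (g (punchIn p k)) (r k) (g p)) (cancel k))))) ⟩
        sum (λ k → c k * (Vec.tail z · g′ k))
          ≡⟨ ·-lincomb (Vec.tail z) c g′ ⟨
        Vec.tail z · lincomb c g′
          ≡⟨ cong (Vec.tail z ·_) c≡0 ⟩
        Vec.tail z · zeroV
          ≡⟨ ·-zeroʳ (Vec.tail z) ⟩
        0ℚ
          ≡⟨ ·-zeroʳ z ⟨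
        z · zeroV ∎

record Dual {d} (g : Fin d → Pt d) : Set where
  field
    dual   : Fin d → Pt d
    same   : ∀ j → dual j · g j ≡ 1ℚ
    other  : ∀ {j k} → j ≢ k → dual j · g k ≡ 0ℚ
    expand : ∀ w z → z · w ≡ sum (λ j → (dual j · w) * (z · g j))

dual-lincomb : ∀ {d n} {g : Fin n → Pt d} (dual : Fin n → Pt d) → (∀ j → dual j · g j ≡ 1ℚ) →
  (∀ {j k} → j ≢ k → dual j · g k ≡ 0ℚ) → ∀ c j → dual j · lincomb c g ≡ c j
dual-lincomb {g = g} dual same other c j = begin
  dual j · lincomb c g                ≡⟨ ·-lincomb (dual j) c g ⟩
  sum (λ k → c k * (dual j · g k))    ≡⟨ sum-single (λ k → c k * (dual j · g k)) j (λ k k≢j →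
                                           trans (cong (c k *_) (other (k≢j ∘ sym))) (*-zeroʳ (c k))) ⟩
  c j * (dual j · g j)                ≡⟨ trans (cong (c j *_) (same j)) (*-identityʳ (c j)) ⟩
  c j                                 ∎
  where open ≡-Reasoning

-- By the Fredholm alternative, either `g j` is a combination of the other vectors, which
-- independence excludes, or some covector kills the others but not `g j`; rescaled, it is the dual
-- vector. The expansion holds because a `w` outside the span would give one independent vector too
-- many.
dual-basis : ∀ {d} (g : Fin d → Pt d) → LinIndep g → Dual g
dual-basis {d} g indep = record { dual = dual ; same = same ; other = other ; expand = expand }
  where
  open ≡-Reasoning
  kind : ∀ {j k : Fin d} → Dec (k ≡ j) → Kind
  kind (yes _) = unused
  kind (no _)  = free
  kind-free : ∀ {j k} → k ≢ j → kind (k ≟F j) ≡ free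
  kind-free {j} {k} k≢j with k ≟F j
  ... | yes k≡j = contradiction k≡j k≢j
  ... | no _    = refl
  kind-unused : ∀ j → kind (j ≟F j) ≡ unused
  kind-unused j with j ≟F j
  ... | yes _ = refl
  ... | no j≢j = contradiction refl j≢j
  δ : ∀ {j k : Fin d} → Dec (k ≡ j) → ℚ
  δ (yes _) = 1ℚ
  δ (no _)  = 0ℚ
  δ-same : ∀ j → δ (j ≟F j) ≡ 1ℚ
  δ-same j with j ≟F j
  ... | yes _ = refl
  ... | no j≢j = contradiction refl j≢j
  δ-other : ∀ {j k} → k ≢ j → δ (k ≟F j) ≡ 0ℚ
  δ-other {j} {k} k≢j with k ≟F j
  ... | yes k≡j = contradiction k≡j k≢j
  ... | no _    = refl
  annihilator : ∀ j → ∃ λ z → (∀ {k} → j ≢ k → z · g k ≡ 0ℚ) × z · g j ≢ 0ℚ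
  annihilator j with farkas (λ k → kind (k ≟F j)) g (g j)
  ... | inj₂ (z , z-ok , <0) = z , (λ {k} j≢k → subst (λ κ → Sep κ (z · g k)) (kind-free (j≢k ∘ sym)) (z-ok k)) , <⇒≢ <0
  ... | inj₁ (c , c-ok , eq) = contradiction (trans (sym c′j) (indep c′ c′≡0 j)) (<⇒≢ (pos⇒-<0 0<1))
    where
    c′ : Fin d → ℚ
    c′ k = c k + δ (k ≟F j) * - 1ℚ
    c′j : c′ j ≡ - 1ℚ
    c′j = cong₂ (λ a b → a + b * - 1ℚ) (subst (λ κ → Coeff κ (c j)) (kind-unused j) (c-ok j)) (δ-same j)
    ring : ∀ x → x + x * - 1ℚ ≡ 0ℚ
    ring = solve-∀ ringℚ
    ring′ : ∀ c δ x → (c + δ * - 1ℚ) * x ≡ x * (c + δ * - 1ℚ)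
    ring′ = solve-∀ ringℚ
    c′≡0 : lincomb c′ g ≡ zeroV
    c′≡0 = ·-ext _ _ λ z → begin
      z · lincomb c′ g
        ≡⟨ ·-lincomb z c′ g ⟩
      sum (λ k → (c k + δ (k ≟F j) * - 1ℚ) * (z · g k))
        ≡⟨ sum-cong-≗ (λ k → ring′ (c k) (δ (k ≟F j)) (z · g k)) ⟩
      sum (λ k → (z · g k) * (c k + δ (k ≟F j) * - 1ℚ))
        ≡⟨ sum-*-+ (λ k → z · g k) c (λ k → δ (k ≟F j)) (- 1ℚ) ⟩
      sum (λ k → (z · g k) * c k) + sum (λ k → (z · g k) * δ (k ≟F j)) * - 1ℚ
        ≡⟨ cong₂ (λ a b → a + b * - 1ℚ)
             (trans (sum-cong-≗ λ k → *-comm (z · g k) (c k)) (trans (sym (·-lincomb z c g)) (cong (z ·_) eq)))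
             (trans (sum-single (λ k → (z · g k) * δ (k ≟F j)) j λ k k≢j → trans (cong (z · g k *_) (δ-other k≢j)) (*-zeroʳ (z · g k)))
               (trans (cong (z · g j *_) (δ-same j)) (*-identityʳ (z · g j)))) ⟩
      z · g j + z · g j * - 1ℚ
        ≡⟨ ring (z · g j) ⟩
      0ℚ
        ≡⟨ ·-zeroʳ z ⟨
      z · zeroV ∎
  ann : Fin d → Pt d
  ann j = proj₁ (annihilator j)
  dual : Fin d → Pt d
  dual j = zeroV ⊕ (inv (ann j · g j) • ann j)
  dual≡ : ∀ j w → dual j · w ≡ inv (ann j · g j) * (ann j · w)
  dual≡ j w = trans (·-axpyˡ zeroV (inv (ann j · g j)) (ann j) w) (trans (cong (_+ inv (ann j · g j) * (ann j · w)) (·-zeroˡ w)) (+-identityˡ _))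
  same : ∀ j → dual j · g j ≡ 1ℚ
  same j = trans (dual≡ j (g j)) (trans (*-comm (inv (ann j · g j)) (ann j · g j)) (*-inv (proj₂ (proj₂ (annihilator j)))))
  other : ∀ {j k} → j ≢ k → dual j · g k ≡ 0ℚ
  other {j} {k} j≢k = trans (dual≡ j (g k)) (trans (cong (inv (ann j · g j) *_) (proj₁ (proj₂ (annihilator j)) j≢k)) (*-zeroʳ (inv (ann j · g j))))
  expand : ∀ w z → z · w ≡ sum (λ j → (dual j · w) * (z · g j))
  expand w z with farkas (λ _ → free) g w
  ... | inj₁ (c , _ , refl) = trans (·-lincomb z c g) (sum-cong-≗ λ j → cong (_* (z · g j)) (sym (dual-lincomb dual same other c j)))
  ... | inj₂ (y , y-ok , <0) = contradiction indep⁺ (too-many (w VF.∷ g))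
    where
    indep⁺ : LinIndep (w VF.∷ g)
    indep⁺ c c≡0 = go
      where
      drop : ∀ x y → 0ℚ * x + y ≡ y
      drop = solve-∀ ringℚ
      c₀ : c zero ≡ 0ℚ
      c₀ = *≡0⇒≡0 (<⇒≢ <0) (begin
        (y · w) * c zero
          ≡⟨ *-comm (y · w) (c zero) ⟩
        c zero * (y · w)
          ≡⟨ +-identityʳ (c zero * (y · w)) ⟨
        c zero * (y · w) + 0ℚ
          ≡⟨ cong (c zero * (y · w) +_) (sum-zero λ k → trans (cong (c (suc k) *_) (y-ok k)) (*-zeroʳ (c (suc k)))) ⟨
        c zero * (y · w) + sum (λ k → c (suc k) * (y · g k))
          ≡⟨ ·-lincomb y c (w VF.∷ g) ⟨
        y · lincomb c (w VF.∷ g)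
          ≡⟨ trans (cong (y ·_) c≡0) (·-zeroʳ y) ⟩
        0ℚ ∎)
      rest : lincomb (c ∘ suc) g ≡ zeroV
      rest = ·-ext _ _ λ x → begin
        x · lincomb (c ∘ suc) g
          ≡⟨ ·-lincomb x (c ∘ suc) g ⟩
        sum (λ k → c (suc k) * (x · g k))
          ≡⟨ drop (x · w) _ ⟨
        0ℚ * (x · w) + sum (λ k → c (suc k) * (x · g k))
          ≡⟨ cong (λ a → a * (x · w) + sum (λ k → c (suc k) * (x · g k))) (sym c₀) ⟩
        c zero * (x · w) + sum (λ k → c (suc k) * (x · g k))
          ≡⟨ ·-lincomb x c (w VF.∷ g) ⟨
        x · lincomb c (w VF.∷ g)
          ≡⟨ cong (x ·_) c≡0 ⟩
        x · zeroV ∎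
      go : ∀ i → c i ≡ 0ℚ
      go zero    = c₀
      go (suc k) = indep (c ∘ suc) rest k

-- A vanishing coefficient would put `ξ` into the span of the d - 1 remaining normals. These are
-- independent because the remaining dual vectors are dual to them, so genericity is violated.
coefficients-nonzero : ∀ {d m} (A : Fin m → Pt d) b {ξ v} → Generic A b ξ → IsVertex A b v →
  (s : Fin d → Fin m) → (∀ j → Active A b v (s j)) → Dual (A ∘ s) →
  ∀ a → lincomb a (A ∘ s) ≡ ξ → ∀ j → a j ≢ 0ℚ
coefficients-nonzero {suc d} A b {ξ} {v} generic isV s act D a a≡ξ j aj≡0 =
  generic v isV (s ∘ punchIn j) (act ∘ punchIn j) independent (a ∘ punchIn j , spanned)
  where
  open Dual D
  open ≡-Reasoning
  independent : LinIndep (A ∘ s ∘ punchIn j)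
  independent c c≡0 k = trans
    (sym (dual-lincomb (dual ∘ punchIn j) (same ∘ punchIn j) (λ k≢l → other (k≢l ∘ punchIn-injective j _ _)) c k))
    (trans (cong (dual (punchIn j k) ·_) c≡0) (·-zeroʳ (dual (punchIn j k))))
  drop : ∀ x y → y ≡ 0ℚ * x + y
  drop = solve-∀ ringℚ
  spanned : lincomb (a ∘ punchIn j) (A ∘ s ∘ punchIn j) ≡ ξ
  spanned = ·-ext _ _ λ z → begin
    z · lincomb (a ∘ punchIn j) (A ∘ s ∘ punchIn j)
      ≡⟨ ·-lincomb z (a ∘ punchIn j) (A ∘ s ∘ punchIn j) ⟩
    rest z
      ≡⟨ drop (z · A (s j)) (rest z) ⟩
    0ℚ * (z · A (s j)) + rest z
      ≡⟨ cong (λ o → o * (z · A (s j)) + rest z) aj≡0 ⟨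
    a j * (z · A (s j)) + rest z
      ≡⟨ sum-remove {i = j} (λ k → a k * (z · A (s k))) ⟨
    sum (λ k → a k * (z · A (s k)))
      ≡⟨ ·-lincomb z a (A ∘ s) ⟨
    z · lincomb a (A ∘ s)
      ≡⟨ cong (z ·_) a≡ξ ⟩
    z · ξ ∎
    where
    rest : Pt (suc d) → ℚ
    rest z = sum (λ k → a (punchIn j k) * (z · A (s (punchIn j k))))

-- Vertices and normal cones

*-monoˡ : ∀ {a b c} → 0ℚ ≤ a → b ≤ c → a * b ≤ a * c
*-monoˡ {a} 0≤a = *-monoˡ-≤-nonNeg a {{nonNegative 0≤a}}

-- The ratio test of the simplex method: `s` are slacks and `r` their rates along a direction.
-- Either no slack ever decreases, or the longest feasible step is the one that exhausts some
-- decreasing slack.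
ratio-test : ∀ {n} (s r : Fin n → ℚ) → (∀ k → 0ℚ ≤ s k) →
  (∀ k → 0ℚ ≤ r k) ⊎
  (∃ λ t → 0ℚ ≤ t × (∀ k → 0ℚ ≤ s k + t * r k) × ∃ λ k → r k < 0ℚ × s k + t * r k ≡ 0ℚ)
ratio-test {zero}  s r 0≤s = inj₁ λ ()
ratio-test {suc n} s r 0≤s with 0ℚ ≤? r zero | ratio-test (s ∘ suc) (r ∘ suc) (0≤s ∘ suc)
... | yes 0≤r₀ | inj₁ 0≤r = inj₁ λ { zero → 0≤r₀ ; (suc k) → 0≤r k }
... | yes 0≤r₀ | inj₂ (t , 0≤t , ok , k , r<0 , tight) =
  inj₂ (t , 0≤t , (λ { zero → +-mono-≤ (0≤s zero) (*-nonNeg 0≤t 0≤r₀) ; (suc k) → ok k }) , suc k , r<0 , tight)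
... | no 0≰r₀ | rest = choose rest
  where
  r₀<0 = ≰⇒> 0≰r₀
  t₀ = s zero * inv (- r zero)
  0≤t₀ : 0ℚ ≤ t₀
  0≤t₀ = *-nonNeg (0≤s zero) (<⇒≤ (inv-pos (neg⇒0<- r₀<0)))
  tight₀ : s zero + t₀ * r zero ≡ 0ℚ
  tight₀ = trans (ring (s zero) (inv (- r zero)) (r zero))
    (trans (cong (λ o → s zero + - (s zero) * o) (*-inv (<⇒≢ (neg⇒0<- r₀<0) ∘ sym))) (ring′ (s zero)))
    where
    ring : ∀ s i r → s + s * i * r ≡ s + - s * (- r * i)
    ring = solve-∀ ringℚ
    ring′ : ∀ s → s + - s * 1ℚ ≡ 0ℚ
    ring′ = solve-∀ ringℚ
  Result : Set
  Result = (∀ k → 0ℚ ≤ r k) ⊎ (∃ λ t → 0ℚ ≤ t × (∀ k → 0ℚ ≤ s k + t * r k) × ∃ λ k → r k < 0ℚ × s k + t * r k ≡ 0ℚ)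
  choose : (∀ k → 0ℚ ≤ r (suc k)) ⊎ (∃ λ t → 0ℚ ≤ t × (∀ k → 0ℚ ≤ s (suc k) + t * r (suc k)) ×
             ∃ λ k → r (suc k) < 0ℚ × s (suc k) + t * r (suc k) ≡ 0ℚ) → Result
  choose (inj₁ 0≤r) = inj₂ (t₀ , 0≤t₀ ,
    (λ { zero → ≤-reflexive (sym tight₀) ; (suc k) → +-mono-≤ (0≤s (suc k)) (*-nonNeg 0≤t₀ (0≤r k)) }) , zero , r₀<0 , tight₀)
  choose (inj₂ (t , 0≤t , ok , k , r<0 , tight)) with 0ℚ ≤? s zero + t * r zero
  ... | yes ok₀ = inj₂ (t , 0≤t , (λ { zero → ok₀ ; (suc k) → ok k }) , suc k , r<0 , tight)
  -- The step `t` overshoots the first constraint, so `t₀` is the shorter one and stays feasible for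
  -- all the others.
  ... | no ¬ok₀ = inj₂ (t₀ , 0≤t₀ , (λ { zero → ≤-reflexive (sym tight₀) ; (suc k) → ok′ k }) , zero , r₀<0 , tight₀)
    where
    t₀≤t : t₀ ≤ t
    t₀≤t = ≮⇒≥ λ t<t₀ → ¬ok₀ (subst₂ _≤_ tight₀ refl
      (+-monoʳ-≤ (s zero) (0≤-⇒≤ (subst (0ℚ ≤_) (ring t₀ t (r zero)) (*-nonNeg (≤⇒0≤- (<⇒≤ t<t₀)) (<⇒≤ (neg⇒0<- r₀<0)))))))
      where
      ring : ∀ a b r → (a - b) * - r ≡ b * r - a * r
      ring = solve-∀ ringℚ
    ok′ : ∀ k → 0ℚ ≤ s (suc k) + t₀ * r (suc k)
    ok′ k with 0ℚ ≤? r (suc k)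
    ... | yes 0≤r = +-mono-≤ (0≤s (suc k)) (*-nonNeg 0≤t₀ 0≤r)
    ... | no 0≰r  = ≤-trans (ok k) (+-monoʳ-≤ (s (suc k)) (0≤-⇒≤ (subst (0ℚ ≤_) (ring t t₀ (r (suc k)))
                      (*-nonNeg (≤⇒0≤- t₀≤t) (<⇒≤ (neg⇒0<- (≰⇒> 0≰r)))))))
      where
      ring : ∀ a b r → (a - b) * - r ≡ b * r - a * r
      ring = solve-∀ ringℚ

unit : ∀ {d} → Fin d → Pt d
unit zero    = 1ℚ ∷ zeroV
unit (suc i) = 0ℚ ∷ unit i

units-separate : ∀ {d} (z : Pt d) → (∀ i → z · unit i ≡ 0ℚ) → z ≡ zeroV
units-separate []      _   = refl
units-separate (a ∷ z) z≡0 = cong₂ _∷_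
  (trans (sym (trans (cong₂ _+_ (*-identityʳ a) (·-zeroʳ z)) (+-identityʳ a))) (z≡0 zero))
  (units-separate z λ i → trans (sym (trans (cong (_+ z · unit i) (*-zeroʳ a)) (+-identityˡ (z · unit i)))) (z≡0 (suc i)))

all-or-some : ∀ {n} {P Q : Fin n → Set} → (∀ i → P i ⊎ Q i) → (∀ i → P i) ⊎ ∃ Q
all-or-some {zero}  f = inj₁ λ ()
all-or-some {suc n} f with f zero | all-or-some (f ∘ suc)
... | inj₂ q | _            = inj₂ (zero , q)
... | inj₁ _ | inj₂ (i , q) = inj₂ (suc i , q)
... | inj₁ p | inj₁ ps      = inj₁ λ { zero → p ; (suc i) → ps i }

functional-bounded : ∀ {d} M (y : Pt d) → ∃ λ B → ∀ x → All (λ xi → - M ≤ xi × xi ≤ M) (Vec.toList x) → y · x ≤ B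
functional-bounded M []      = 0ℚ , λ { [] [] → ≤-refl }
functional-bounded M (a ∷ y) with functional-bounded M y | ≤-total 0ℚ a
... | B , bound | inj₁ 0≤a = a * M + B , λ { (s ∷ x) ((_ , s≤M) ∷ xs) → +-mono-≤ (*-monoˡ 0≤a s≤M) (bound x xs) }
... | B , bound | inj₂ a≤0 = - a * M + B , λ { (s ∷ x) ((-M≤s , _) ∷ xs) →
    +-mono-≤ (0≤-⇒≤ {a * s} {(- a) * M} (subst (0ℚ ≤_) (ring a M s) (*-nonNeg (neg-antimono-≤ a≤0) (≤⇒0≤- -M≤s)))) (bound x xs) }
  where
  ring : ∀ a M s → - a * (s - - M) ≡ - a * M - a * s
  ring = solve-∀ ringℚ

module Polytope {d m : ℕ} (A : Fin m → Pt d) (b : Fin m → ℚ) (bounded : Bounded A b) where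

  slack : Pt d → Fin m → ℚ
  slack x k = A k · x - b k

  slack-axpy : ∀ x t z k → slack (x ⊕ (t • z)) k ≡ slack x k + t * (A k · z)
  slack-axpy x t z k = trans (cong (_- b k) (·-axpy (A k) x t z)) (ring (A k · x) (t * (A k · z)) (b k))
    where
    ring : ∀ x y b → x + y - b ≡ x - b + y
    ring = solve-∀ ringℚ

  InP-axpy : ∀ {x t z} → (∀ k → 0ℚ ≤ slack x k + t * (A k · z)) → InP A b (x ⊕ (t • z))
  InP-axpy {x} {t} {z} ok k = 0≤-⇒≤ (subst (0ℚ ≤_) (sym (slack-axpy x t z k)) (ok k))

  slack≡0⇒active : ∀ {x k} → slack x k ≡ 0ℚ → Active A b x k
  slack≡0⇒active {x} {k} s≡0 = trans (ring (A k · x) (b k)) (trans (cong (_+ b k) s≡0) (+-identityˡ (b k)))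
    where
    ring : ∀ x b → x ≡ x - b + b
    ring = solve-∀ ringℚ

  active⇒slack≡0 : ∀ {x k} → Active A b x k → slack x k ≡ 0ℚ
  active⇒slack≡0 {x} {k} act = trans (cong (_- b k) act) (+-inverseʳ (b k))

  no-ray : ∀ {x z y} → InP A b x → 0ℚ < y · z → ¬ (∀ k → 0ℚ ≤ A k · z)
  no-ray {x} {z} {y} x∈P 0<yz ray = <-irrefl refl (<-≤-trans beyond (bound (x ⊕ (t • z)) inside))
    where
    M = proj₁ bounded
    B = proj₁ (functional-bounded M y)
    bound : ∀ x → InP A b x → y · x ≤ B
    bound x x∈P = proj₂ (functional-bounded M y) x (proj₂ bounded x x∈P)
    -- The step after which `y` takes the value 1 + B, although it is at most B on the polytope.
    t = (1ℚ + (B - y · x)) * inv (y · z)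
    0≤t : 0ℚ ≤ t
    0≤t = *-nonNeg (+-mono-≤ (<⇒≤ 0<1) (≤⇒0≤- (bound x x∈P))) (<⇒≤ (inv-pos 0<yz))
    inside : InP A b (x ⊕ (t • z))
    inside = InP-axpy λ k → +-mono-≤ (≤⇒0≤- (x∈P k)) (*-nonNeg 0≤t (ray k))
    value : y · (x ⊕ (t • z)) ≡ 1ℚ + B
    value = begin
      y · (x ⊕ (t • z))                                                    ≡⟨ ·-axpy y x t z ⟩
      y · x + (1ℚ + (B - y · x)) * inv (y · z) * (y · z)                   ≡⟨ ring (y · x) B (inv (y · z)) (y · z) ⟩
      y · x + (1ℚ + (B - y · x)) * (y · z * inv (y · z))                   ≡⟨ cong (λ o → y · x + (1ℚ + (B - y · x)) * o) (*-inv (<⇒≢ 0<yz ∘ sym)) ⟩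
      y · x + (1ℚ + (B - y · x)) * 1ℚ                                      ≡⟨ ring′ (y · x) B ⟩
      1ℚ + B                                                               ∎
      where
      open ≡-Reasoning
      ring : ∀ x B i p → x + (1ℚ + (B - x)) * i * p ≡ x + (1ℚ + (B - x)) * (p * i)
      ring = solve-∀ ringℚ
      ring′ : ∀ x B → x + (1ℚ + (B - x)) * 1ℚ ≡ 1ℚ + B
      ring′ = solve-∀ ringℚ
    beyond : B < y · (x ⊕ (t • z))
    beyond = subst₂ _<_ (+-identityˡ B) (sym value) (+-monoˡ-< B 0<1)

  -- If the point lies strictly between two points of the polytope, both lie on every facet active
  -- there, so their difference is killed by all active normals.
  vertex-if-rigid : ∀ {x} → InP A b x → (∀ z → (∀ k → Active A b x k → A k · z ≡ 0ℚ) → z ≡ zeroV) → IsVertex A b x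
  vertex-if-rigid {v} v∈P rigid = v∈P , λ x y t x∈P y∈P 0<t t<1 v≡ → ·-ext x y λ z → begin
      z · x
        ≡⟨ ring (z · x) (z · y) ⟩
      (z · x + - 1ℚ * (z · y)) + z · y
        ≡⟨ cong (_+ z · y) (sym (·-axpy z x (- 1ℚ) y)) ⟩
      z · (x ⊕ ((- 1ℚ) • y)) + z · y
        ≡⟨ cong (λ u → z · u + z · y) (rigid _ λ k act → trans (·-axpy (A k) x (- 1ℚ) y)
             (trans (cong₂ (λ p r → p + - 1ℚ * r) (on-facet x y t x∈P y∈P 0<t t<1 v≡ k act)
               (on-facet y x (1ℚ - t) y∈P x∈P (<⇒0<- t<1) (0<-⇒< (subst (0ℚ <_) (ring₃ t) 0<t)) (trans v≡ (swap x y t)) k act)) (ring₂ (b k)))) ⟩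
      z · zeroV + z · y
        ≡⟨ trans (cong (_+ z · y) (·-zeroʳ z)) (+-identityˡ (z · y)) ⟩
      z · y ∎
    where
    open ≡-Reasoning
    ring : ∀ x y → x ≡ x + - 1ℚ * y + y
    ring = solve-∀ ringℚ
    ring₂ : ∀ b → b + - 1ℚ * b ≡ 0ℚ
    ring₂ = solve-∀ ringℚ
    ring₃ : ∀ t → t ≡ 1ℚ - (1ℚ - t)
    ring₃ = solve-∀ ringℚ
    swap : ∀ x y t → (t • x) ⊕ ((1ℚ - t) • y) ≡ ((1ℚ - t) • y) ⊕ ((1ℚ - (1ℚ - t)) • x)
    swap x y t = ·-ext _ _ λ z → trans (·-comb z t x (1ℚ - t) y) (trans (ring₄ t (z · x) (z · y)) (sym (·-comb z (1ℚ - t) y (1ℚ - (1ℚ - t)) x)))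
      where
      ring₄ : ∀ t x y → t * x + (1ℚ - t) * y ≡ (1ℚ - t) * y + (1ℚ - (1ℚ - t)) * x
      ring₄ = solve-∀ ringℚ
    on-facet : ∀ x y t → InP A b x → InP A b y → 0ℚ < t → t < 1ℚ → v ≡ (t • x) ⊕ ((1ℚ - t) • y) →
               ∀ k → Active A b v k → A k · x ≡ b k
    on-facet x y t x∈P y∈P 0<t t<1 v≡ k act = slack≡0⇒active (decidable-stable (slack x k ≟ 0ℚ) λ s≢0 →
      <-irrefl refl (subst (0ℚ <_) total (+-mono-<-≤ (*-pos 0<t (≤∧≢⇒< (≤⇒0≤- (x∈P k)) (s≢0 ∘ sym)))
                                                   (*-nonNeg (<⇒≤ (<⇒0<- t<1)) (≤⇒0≤- (y∈P k))))))
      where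
      ring₅ : ∀ t x y b → t * (x - b) + (1ℚ - t) * (y - b) ≡ t * x + (1ℚ - t) * y - b
      ring₅ = solve-∀ ringℚ
      total : t * slack x k + (1ℚ - t) * slack y k ≡ 0ℚ
      total = trans (ring₅ t (A k · x) (A k · y) (b k))
        (trans (cong (_- b k) (trans (sym (·-comb (A k) t x (1ℚ - t) y)) (trans (cong (A k ·_) (sym v≡)) act))) (+-inverseʳ (b k)))

  tight-kind : ∀ {x k} → Kind → Dec (Active A b x k) → Kind
  tight-kind κ (yes _) = κ
  tight-kind κ (no _)  = unused

  kinds : Kind → Pt d → Fin m → Kind
  kinds κ x k = tight-kind {x} {k} κ (A k · x ≟ b k)

  kinds-active : ∀ κ {x k} → Active A b x k → kinds κ x k ≡ κ
  kinds-active κ {x} {k} act with A k · x ≟ b k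
  ... | yes _   = refl
  ... | no ¬act = contradiction act ¬act

  kinds-inactive : ∀ κ {x k} → ¬ Active A b x k → kinds κ x k ≡ unused
  kinds-inactive κ {x} {k} ¬act with A k · x ≟ b k
  ... | yes act = contradiction act ¬act
  ... | no _    = refl

  -- Either the active normals span every unit vector, and nothing nonzero is orthogonal to them, or
  -- a covector separating some unit vector from their span is a tangent direction. The unit vector
  -- is then returned as the witness that this direction is nonzero.
  rigid? : ∀ x → (∀ z → (∀ k → Active A b x k → A k · z ≡ 0ℚ) → z ≡ zeroV) ⊎
    (∃ λ z → (∀ k → Active A b x k → A k · z ≡ 0ℚ) × ∃ λ y → y · z < 0ℚ)
  rigid? x with all-or-some (λ i → farkas (kinds free x) A (unit i))
  ... | inj₂ (i , z , z-ok , <0) = inj₂ (z ,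
        (λ k act → trans (·-comm (A k) z) (subst (λ κ → Sep κ (z · A k)) (kinds-active free act) (z-ok k))) ,
        unit i , subst (_< 0ℚ) (·-comm z (unit i)) <0)
  ... | inj₁ spans = inj₁ λ z z≡0 → units-separate z λ i → let c , c-ok , c≡ = spans i in
      trans (cong (z ·_) (sym c≡)) (trans (·-lincomb z c A) (sum-zero λ k → term z z≡0 k (c-ok k)))
    where
    term : ∀ z → (∀ k → Active A b x k → A k · z ≡ 0ℚ) → ∀ k {c} → Coeff (kinds free x k) c → c * (z · A k) ≡ 0ℚ
    term z z≡0 k {c} c-ok = case A k · x ≟ b k of λ
      { (yes act) → trans (cong (c *_) (trans (·-comm z (A k)) (z≡0 k act))) (*-zeroʳ c)
      ; (no ¬act) → trans (cong (_* (z · A k)) (subst (λ κ → Coeff κ c) (kinds-inactive free ¬act) c-ok)) (*-zeroˡ (z · A k)) }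

  -- Each step along a direction tangent to all active facets makes a further facet active.
  descend : ∀ w n (L : List (Fin m)) → length L ℕ.≤ n → ∀ x → InP A b x → (∀ k → ¬ Active A b x k → k ∈ L) →
    ∃ λ v → IsVertex A b v × w · v ≤ w · x
  descend w n L len x x∈P L-ok with rigid? x
  ... | inj₁ rigid = x , vertex-if-rigid x∈P rigid , ≤-refl
  ... | inj₂ (z₀ , tangent₀ , y₀ , y₀z₀<0) = move (orient (≤-total (w · z₀) 0ℚ))
    where
    Direction : Set
    Direction = ∃ λ z → (∀ k → Active A b x k → A k · z ≡ 0ℚ) × (∃ λ y → 0ℚ < y · z) × w · z ≤ 0ℚ
    ·-neg : ∀ (u z : Pt d) → u · (zeroV ⊕ ((- 1ℚ) • z)) ≡ - (u · z)
    ·-neg u z = trans (·-axpy u zeroV (- 1ℚ) z) (trans (cong (_+ - 1ℚ * (u · z)) (·-zeroʳ u)) (ring (u · z)))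
      where
      ring : ∀ a → 0ℚ + - 1ℚ * a ≡ - a
      ring = solve-∀ ringℚ
    -- The direction is reversed if `w` would grow along it. As `y₀ · z₀` is negative, exactly one
    -- of `y₀` and `z₀` has to be negated.
    orient : w · z₀ ≤ 0ℚ ⊎ 0ℚ ≤ w · z₀ → Direction
    orient (inj₁ wz≤0) = z₀ , tangent₀ , (zeroV ⊕ ((- 1ℚ) • y₀) ,
      subst (0ℚ <_) (sym (trans (·-comm _ z₀) (trans (·-neg z₀ y₀) (cong -_ (·-comm z₀ y₀))))) (neg⇒0<- y₀z₀<0)) , wz≤0
    orient (inj₂ 0≤wz) = zeroV ⊕ ((- 1ℚ) • z₀) , (λ k act → trans (·-neg (A k) z₀) (cong -_ (tangent₀ k act))) ,
      (y₀ , subst (0ℚ <_) (sym (·-neg y₀ z₀)) (neg⇒0<- y₀z₀<0)) , subst (_≤ 0ℚ) (sym (·-neg w z₀)) (neg-antimono-≤ 0≤wz)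
    move : Direction → ∃ λ v → IsVertex A b v × w · v ≤ w · x
    move (z , tangent , (y , 0<yz) , wz≤0) with ratio-test (slack x) (λ k → A k · z) (λ k → ≤⇒0≤- (x∈P k))
    ... | inj₁ ray = contradiction ray (no-ray {y = y} x∈P 0<yz)
    ... | inj₂ (t , 0≤t , ok , k₀ , r<0 , tight) = next n len
      where
      x′ = x ⊕ (t • z)
      inactive₀ : ¬ Active A b x k₀
      inactive₀ act = <-irrefl (tangent k₀ act) r<0
      L′ = filter (λ k → ¬? (k ≟F k₀)) L
      shorter : length L′ ℕ.< length L
      shorter = filter-notAll (λ k → ¬? (k ≟F k₀)) L (lose (L-ok k₀ inactive₀) λ ≢ → ≢ refl)
      L′-ok : ∀ k → ¬ Active A b x′ k → k ∈ L′
      L′-ok k ¬act′ = ∈-filter⁺ (λ k → ¬? (k ≟F k₀)) (L-ok k λ act → ¬act′ (slack≡0⇒active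
          (trans (slack-axpy x t z k) (trans (cong₂ (λ p r → p + t * r) (active⇒slack≡0 act) (tangent k act)) (ring t)))))
        λ { refl → ¬act′ (slack≡0⇒active (trans (slack-axpy x t z k₀) tight)) }
        where
        ring : ∀ t → 0ℚ + t * 0ℚ ≡ 0ℚ
        ring = solve-∀ ringℚ
      lower : w · x′ ≤ w · x
      lower = subst (_≤ w · x) (sym (·-axpy w x t z)) (0≤-⇒≤ (subst (0ℚ ≤_) (ring (w · x) t (w · z)) (*-nonNeg 0≤t (neg-antimono-≤ wz≤0))))
        where
        ring : ∀ x t r → t * - r ≡ x - (x + t * r)
        ring = solve-∀ ringℚ
      next : ∀ n → length L ℕ.≤ n → ∃ λ v → IsVertex A b v × w · v ≤ w · x
      next zero    len = contradiction (ℕ.<-≤-trans shorter len) λ ()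
      next (suc n) len =
        let v , isV , v≤ = descend w n L′ (ℕ.s≤s⁻¹ (ℕ.<-≤-trans shorter len)) x′ (InP-axpy ok) L′-ok
        in v , isV , ≤-trans v≤ lower

  vertex-below : ∀ w x → InP A b x → ∃ λ v → IsVertex A b v × w · v ≤ w · x
  vertex-below w x x∈P = descend w (length (List.allFin m)) (List.allFin m) ℕ.≤-refl x x∈P λ k _ → ∈-allFin k

  argmin : ∀ w (vs : List (Pt d)) {v} → v ∈ vs → ∃ λ v → v ∈ vs × ∀ {v′} → v′ ∈ vs → w · v ≤ w · v′
  argmin w (v ∷ [])          _ = v , here refl , λ { (here refl) → ≤-refl }
  argmin w (v ∷ vs@(_ ∷ _)) _ with argmin w vs (here refl)
  ... | v₁ , v₁∈ , min with ≤-total (w · v) (w · v₁)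
  ...   | inj₁ v≤v₁ = v , here refl , λ { (here refl) → ≤-refl ; (there v′∈) → ≤-trans v≤v₁ (min v′∈) }
  ...   | inj₂ v₁≤v = v₁ , there v₁∈ , λ { (here refl) → v₁≤v ; (there v′∈) → min v′∈ }

  -- Farkas' lemma with the active normals: if `w` is not in their cone, some direction decreases
  -- `w` without decreasing any active slack, and a short step along it stays in the polytope.
  minimiser-normal : ∀ w {v} → InP A b v → (∀ x → InP A b x → w · v ≤ w · x) → InNormalCone A b v w
  minimiser-normal w {v} v∈P min with farkas (kinds nonneg v) A w
  ... | inj₁ (c , c-ok , eq) = c , (λ k → nn k (c-ok k)) , (λ k ¬act → subst (λ κ → Coeff κ (c k)) (kinds-inactive nonneg ¬act) (c-ok k)) , eq
    where
    nn : ∀ k {c} → Coeff (kinds nonneg v k) c → 0ℚ ≤ c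
    nn k {c} c-ok = case A k · v ≟ b k of λ
      { (yes act) → subst (λ κ → Coeff κ c) (kinds-active nonneg act) c-ok
      ; (no ¬act) → ≤-reflexive (sym (subst (λ κ → Coeff κ c) (kinds-inactive nonneg ¬act) c-ok)) }
  ... | inj₂ (z , z-ok , zw<0) = contradiction feasible λ (t , 0<t , ok) →
      <-irrefl refl (<-≤-trans (subst₂ _<_ (sym (·-axpy w v t z)) (+-identityʳ (w · v))
        (+-monoʳ-< (w · v) (*-pos-neg 0<t (subst (_< 0ℚ) (·-comm z w) zw<0)))) (min (v ⊕ (t • z)) (InP-axpy ok)))
    where
    active-ok : ∀ {k} → Active A b v k → 0ℚ ≤ A k · z
    active-ok {k} act = subst (0ℚ ≤_) (·-comm z (A k)) (subst (λ κ → Sep κ (z · A k)) (kinds-active nonneg act) (z-ok k))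
    feasible : ∃ λ t → 0ℚ < t × ∀ k → 0ℚ ≤ slack v k + t * (A k · z)
    feasible with ratio-test (slack v) (λ k → A k · z) (λ k → ≤⇒0≤- (v∈P k))
    ... | inj₁ ray = 1ℚ , 0<1 , λ k → +-mono-≤ (≤⇒0≤- (v∈P k)) (*-nonNeg (<⇒≤ 0<1) (ray k))
    ... | inj₂ (t , 0≤t , ok , k , r<0 , tight) = t , ≤∧≢⇒< 0≤t t≢0 , ok
      where
      ring : ∀ s r → s ≡ s + 0ℚ * r
      ring = solve-∀ ringℚ
      -- A blocking facet at step 0 would be active at `v`, but `z` does not decrease active slacks.
      t≢0 : 0ℚ ≢ t
      t≢0 refl = <-irrefl refl (<-≤-trans r<0 (active-ok (slack≡0⇒active (trans (ring (slack v k) (A k · z)) tight))))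

  -- Every point of the polytope has a vertex that is at least as low for `w`, so the lowest of the
  -- finitely many vertices minimises `w` over the whole polytope.
  normal-fan-complete : FullDim A b → (vs : List (Pt d)) → (∀ v → IsVertex A b v ⇔ (v ∈ vs)) →
    ∀ w → ∃ λ v → v ∈ vs × InNormalCone A b v w
  normal-fan-complete (x₀ , inside) vs verts w =
    let v₀ , isV₀ , _ = vertex-below w x₀ (<⇒≤ ∘ inside)
        v , v∈ , min = argmin w vs (proj₁ (verts v₀) isV₀)
    in v , v∈ , minimiser-normal w (proj₁ (proj₂ (verts v) v∈)) λ x x∈P →
         let v′ , isV′ , v′≤x = vertex-below w x x∈P in ≤-trans (min (proj₁ (verts v′) isV′)) v′≤x

-- Sums and products of integers

⟦_⟧ : ∀ {p} {P : Set p} → Dec P → ℤ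
⟦ P? ⟧ = if does P? then 1ℤ else 0ℤ

⟦⟧-yes : ∀ {p} {P : Set p} (P? : Dec P) → P → ⟦ P? ⟧ ≡ 1ℤ
⟦⟧-yes (yes _) _ = refl
⟦⟧-yes (no ¬p) p = contradiction p ¬p

⟦⟧-no : ∀ {p} {P : Set p} (P? : Dec P) → ¬ P → ⟦ P? ⟧ ≡ 0ℤ
⟦⟧-no (yes p) ¬p = contradiction p ¬p
⟦⟧-no (no _)  _  = refl

sumFinℤ-cong : ∀ {n} {f g : Fin n → ℤ} → (∀ i → f i ≡ g i) → sumFinℤ f ≡ sumFinℤ g
sumFinℤ-cong {zero}  f≡g = refl
sumFinℤ-cong {suc n} f≡g = cong₂ _+ℤ_ (f≡g zero) (sumFinℤ-cong (f≡g ∘ suc))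

sumFinℤ-zero : ∀ {n} {f : Fin n → ℤ} → (∀ i → f i ≡ 0ℤ) → sumFinℤ f ≡ 0ℤ
sumFinℤ-zero {zero}  f≡0 = refl
sumFinℤ-zero {suc n} f≡0 = cong₂ _+ℤ_ (f≡0 zero) (sumFinℤ-zero (f≡0 ∘ suc))

sumFinℤ-linear : ∀ {n} a b (f g : Fin n → ℤ) →
  sumFinℤ (λ i → a *ℤ f i +ℤ b *ℤ g i) ≡ a *ℤ sumFinℤ f +ℤ b *ℤ sumFinℤ g
sumFinℤ-linear {zero}  a b f g = sym (cong₂ _+ℤ_ (ℤ.*-zeroʳ a) (ℤ.*-zeroʳ b))
sumFinℤ-linear {suc n} a b f g =
  trans (cong (a *ℤ f zero +ℤ b *ℤ g zero +ℤ_) (sumFinℤ-linear a b (f ∘ suc) (g ∘ suc)))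
        (eq a b (f zero) (g zero) (sumFinℤ (f ∘ suc)) (sumFinℤ (g ∘ suc)))
  where
  eq : ∀ a b x y s t → a *ℤ x +ℤ b *ℤ y +ℤ (a *ℤ s +ℤ b *ℤ t) ≡ a *ℤ (x +ℤ s) +ℤ b *ℤ (y +ℤ t)
  eq = solveℤ-∀

sumFinℤ-* : ∀ {n} a (f : Fin n → ℤ) → sumFinℤ (λ i → a *ℤ f i) ≡ a *ℤ sumFinℤ f
sumFinℤ-* {zero}  a f = sym (ℤ.*-zeroʳ a)
sumFinℤ-* {suc n} a f = trans (cong (a *ℤ f zero +ℤ_) (sumFinℤ-* a (f ∘ suc)))
                              (sym (ℤ.*-distribˡ-+ a (f zero) (sumFinℤ (f ∘ suc))))

sumL : ∀ {A : Set} → (A → ℤ) → List A → ℤ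
sumL f []       = 0ℤ
sumL f (x ∷ xs) = f x +ℤ sumL f xs

sumL-cong : ∀ {A : Set} {f g : A → ℤ} xs → (∀ {x} → x ∈ xs → f x ≡ g x) → sumL f xs ≡ sumL g xs
sumL-cong []       f≡g = refl
sumL-cong (x ∷ xs) f≡g = cong₂ _+ℤ_ (f≡g (here refl)) (sumL-cong xs (f≡g ∘ there))

sumL-zero : ∀ {A : Set} {f : A → ℤ} xs → (∀ {x} → x ∈ xs → f x ≡ 0ℤ) → sumL f xs ≡ 0ℤ
sumL-zero []       f≡0 = refl
sumL-zero (x ∷ xs) f≡0 = cong₂ _+ℤ_ (f≡0 (here refl)) (sumL-zero xs (f≡0 ∘ there))

sumL-+ : ∀ {A : Set} (f g : A → ℤ) xs → sumL (λ x → f x +ℤ g x) xs ≡ sumL f xs +ℤ sumL g xs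
sumL-+ f g []       = refl
sumL-+ f g (x ∷ xs) = trans (cong (f x +ℤ g x +ℤ_) (sumL-+ f g xs)) (eq (f x) (g x) (sumL f xs) (sumL g xs))
  where
  eq : ∀ x y s t → x +ℤ y +ℤ (s +ℤ t) ≡ x +ℤ s +ℤ (y +ℤ t)
  eq = solveℤ-∀

sumL-* : ∀ {A : Set} a (f : A → ℤ) xs → sumL (λ x → a *ℤ f x) xs ≡ a *ℤ sumL f xs
sumL-* a f []       = sym (ℤ.*-zeroʳ a)
sumL-* a f (x ∷ xs) = trans (cong (a *ℤ f x +ℤ_) (sumL-* a f xs)) (sym (ℤ.*-distribˡ-+ a (f x) (sumL f xs)))

sumL-++ : ∀ {A : Set} (f : A → ℤ) xs ys → sumL f (xs ++ ys) ≡ sumL f xs +ℤ sumL f ys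
sumL-++ f []       ys = sym (ℤ.+-identityˡ (sumL f ys))
sumL-++ f (x ∷ xs) ys = trans (cong (f x +ℤ_) (sumL-++ f xs ys)) (sym (ℤ.+-assoc (f x) (sumL f xs) (sumL f ys)))

sumL-map : ∀ {A B : Set} (f : B → ℤ) (h : A → B) xs → sumL f (map h xs) ≡ sumL (f ∘ h) xs
sumL-map f h []       = refl
sumL-map f h (x ∷ xs) = cong (f (h x) +ℤ_) (sumL-map f h xs)

sumL-tabulate : ∀ {A : Set} {n} (f : A → ℤ) (h : Fin n → A) → sumL f (tabulate h) ≡ sumFinℤ (f ∘ h)
sumL-tabulate {n = zero}  f h = refl
sumL-tabulate {n = suc n} f h = cong (f (h zero) +ℤ_) (sumL-tabulate f (h ∘ suc))

sumL-filter : ∀ {A : Set} {P : A → Set} (P? : Decidable P) (f : A → ℤ) xs →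
  sumL f (filter P? xs) ≡ sumL (λ x → ⟦ P? x ⟧ *ℤ f x) xs
sumL-filter P? f []       = refl
sumL-filter P? f (x ∷ xs) with P? x
... | yes _ = cong₂ _+ℤ_ (sym (ℤ.*-identityˡ (f x))) (sumL-filter P? f xs)
... | no  _ = trans (sumL-filter P? f xs) (sym (ℤ.+-identityˡ _))

sumL-product : ∀ {A B : Set} (f : A × B → ℤ) xs ys →
  sumL f (cartesianProduct xs ys) ≡ sumL (λ x → sumL (λ y → f (x , y)) ys) xs
sumL-product f []       ys = refl
sumL-product f (x ∷ xs) ys =
  trans (sumL-++ f (map (x ,_) ys) (cartesianProduct xs ys))
        (cong₂ _+ℤ_ (sumL-map f (x ,_) ys) (sumL-product f xs ys))

-- The occurring keys are cleared one after another. Terms are set to zero rather than removed, so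
-- the list stays fixed; the invariant is that every term either has its key in the remaining list
-- or has become 0.
sumL-fibres : ∀ {A : Set} (key : A → ℚ) (a : A → ℤ) xs →
  (∀ T → sumL (λ x → ⟦ key x ≟ T ⟧ *ℤ a x) xs ≡ 0ℤ) → sumL a xs ≡ 0ℤ
sumL-fibres {A} key a xs h = go (map key xs) a h (λ x∈xs → inj₁ (∈-map⁺ key x∈xs))
  where
  go : ∀ Ts a → (∀ T → sumL (λ x → ⟦ key x ≟ T ⟧ *ℤ a x) xs ≡ 0ℤ) →
       (∀ {x} → x ∈ xs → key x ∈ Ts ⊎ a x ≡ 0ℤ) → sumL a xs ≡ 0ℤ
  go [] a h cov = sumL-zero xs λ x∈xs → case (cov x∈xs)
    where
    case : ∀ {x} → key x ∈ [] ⊎ a x ≡ 0ℤ → a x ≡ 0ℤ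
    case (inj₂ eq) = eq
  go (T ∷ Ts) a h cov = begin
    sumL a xs                                                      ≡⟨ sumL-cong xs (λ {x} _ → split x) ⟩
    sumL (λ x → ⟦ key x ≟ T ⟧ *ℤ a x +ℤ a′ x) xs                  ≡⟨ sumL-+ (λ x → ⟦ key x ≟ T ⟧ *ℤ a x) a′ xs ⟩
    sumL (λ x → ⟦ key x ≟ T ⟧ *ℤ a x) xs +ℤ sumL a′ xs            ≡⟨ cong₂ _+ℤ_ (h T) (go Ts a′ h′ cov′) ⟩
    0ℤ                                                             ∎
    where
    open ≡-Reasoning
    a′ : A → ℤ
    a′ x = (1ℤ -ℤ ⟦ key x ≟ T ⟧) *ℤ a x
    split : ∀ x → a x ≡ ⟦ key x ≟ T ⟧ *ℤ a x +ℤ a′ x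
    split x = eq (⟦ key x ≟ T ⟧) (a x)
      where
      eq : ∀ b c → c ≡ b *ℤ c +ℤ (1ℤ -ℤ b) *ℤ c
      eq = solveℤ-∀
    cov′ : ∀ {x} → x ∈ xs → key x ∈ Ts ⊎ a′ x ≡ 0ℤ
    cov′ {x} x∈xs with cov x∈xs
    ... | inj₁ (here eq)  = inj₂ (trans (cong (λ b → (1ℤ -ℤ b) *ℤ a x) (⟦⟧-yes (key x ≟ T) eq)) (ℤ.*-zeroˡ (a x)))
    ... | inj₁ (there k∈) = inj₁ k∈
    ... | inj₂ eq         = inj₂ (trans (cong ((1ℤ -ℤ ⟦ key x ≟ T ⟧) *ℤ_) eq) (ℤ.*-zeroʳ (1ℤ -ℤ ⟦ key x ≟ T ⟧)))
    h′ : ∀ T′ → sumL (λ x → ⟦ key x ≟ T′ ⟧ *ℤ a′ x) xs ≡ 0ℤ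
    h′ T′ with T′ ≟ T
    ... | yes refl = sumL-zero xs λ {x} _ → vanish x
      where
      vanish : ∀ x → ⟦ key x ≟ T ⟧ *ℤ a′ x ≡ 0ℤ
      vanish x with key x ≟ T
      ... | yes _ = refl
      ... | no  _ = refl
    ... | no T′≢T = trans (sumL-cong xs λ {x} _ → same x) (h T′)
      where
      same : ∀ x → ⟦ key x ≟ T′ ⟧ *ℤ a′ x ≡ ⟦ key x ≟ T′ ⟧ *ℤ a x
      same x with key x ≟ T′
      ... | no  _ = refl
      ... | yes refl = cong (1ℤ *ℤ_) (trans (cong (λ b → (1ℤ -ℤ b) *ℤ a x) (⟦⟧-no (key x ≟ T) T′≢T)) (ℤ.*-identityˡ (a x)))

-- Discrete product rules

prodFin : ∀ {n} → (Fin n → ℤ) → ℤ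
prodFin {zero}  f = 1ℤ
prodFin {suc n} f = f zero *ℤ prodFin (f ∘ suc)

prodFin-cong : ∀ {n} {f g : Fin n → ℤ} → (∀ i → f i ≡ g i) → prodFin f ≡ prodFin g
prodFin-cong {zero}  f≡g = refl
prodFin-cong {suc n} f≡g = cong₂ _*ℤ_ (f≡g zero) (prodFin-cong (f≡g ∘ suc))

prodFin-zero : ∀ {n} (f : Fin n → ℤ) i → f i ≡ 0ℤ → prodFin f ≡ 0ℤ
prodFin-zero f zero    fi≡0 = cong (_*ℤ prodFin (f ∘ suc)) fi≡0
prodFin-zero f (suc i) fi≡0 = trans (cong (f zero *ℤ_) (prodFin-zero (f ∘ suc) i fi≡0)) (ℤ.*-zeroʳ (f zero))

prodFin-one : ∀ {n} {f : Fin n → ℤ} → (∀ i → f i ≡ 1ℤ) → prodFin f ≡ 1ℤ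
prodFin-one {zero}  f≡1 = refl
prodFin-one {suc n} f≡1 = cong₂ _*ℤ_ (f≡1 zero) (prodFin-one (f≡1 ∘ suc))

prodExcept : ∀ {n} → (Fin n → ℤ) → Fin n → ℤ
prodExcept f zero    = prodFin (f ∘ suc)
prodExcept f (suc j) = f zero *ℤ prodExcept (f ∘ suc) j

prodExcept-punchIn : ∀ {n} (f : Fin (suc n) → ℤ) j → prodExcept f j ≡ prodFin (f ∘ punchIn j)
prodExcept-punchIn         f zero    = refl
prodExcept-punchIn {suc n} f (suc j) = cong (f zero *ℤ_) (prodExcept-punchIn (f ∘ suc) j)

-- Discrete product rule: every f j is a step function of time with a single jump s j at time t j.
product-rule : ∀ {n} (f∞ : Fin n → ℤ) (f : Fin n → ℚ → ℤ) (s : Fin n → ℤ) (t : Fin n → ℚ) →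
  (∀ j a → a < t j → f∞ j ≡ f j a +ℤ s j) → (∀ j a → t j < a → f∞ j ≡ f j a) →
  (∀ {j k} → j ≢ k → t j ≢ t k) → ∀ a → (∀ j → a ≢ t j) →
  prodFin f∞ ≡ prodFin (λ j → f j a) +ℤ
    sumFinℤ (λ j → ⟦ a <? t j ⟧ *ℤ (s j *ℤ prodExcept (λ k → f k (t j)) j))
product-rule {zero}  f∞ f s t before after inj a a≢t = refl
product-rule {suc n} f∞ f s t before after inj a a≢t = go
  where
  open ≡-Reasoning
  IH : ∀ b → (∀ j → b ≢ t (suc j)) → prodFin (f∞ ∘ suc) ≡ prodFin (λ j → f (suc j) b) +ℤ
         sumFinℤ (λ j → ⟦ b <? t (suc j) ⟧ *ℤ (s (suc j) *ℤ prodExcept (λ k → f (suc k) (t (suc j))) j))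
  IH = product-rule (f∞ ∘ suc) (f ∘ suc) (s ∘ suc) (t ∘ suc) (before ∘ suc) (after ∘ suc)
         (λ j≢k → inj (j≢k ∘ suc-injective))
  E : Fin n → ℤ
  E j = s (suc j) *ℤ prodExcept (λ k → f (suc k) (t (suc j))) j
  X : ℚ → Fin n → ℤ
  X b j = ⟦ b <? t (suc j) ⟧ *ℤ E j
  F∞ = prodFin (f∞ ∘ suc)
  F : ℚ → ℤ
  F b = prodFin (λ j → f (suc j) b)
  G : Fin n → ℤ
  G j = ⟦ a <? t (suc j) ⟧ *ℤ (s (suc j) *ℤ (f zero (t (suc j)) *ℤ prodExcept (λ k → f (suc k) (t (suc j))) j))
  go : f∞ zero *ℤ F∞ ≡ f zero a *ℤ F a +ℤ (⟦ a <? t zero ⟧ *ℤ (s zero *ℤ F (t zero)) +ℤ sumFinℤ G)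
  go with <-cmp a (t zero)
  ... | tri≈ _ a≡t _ = contradiction a≡t (a≢t zero)
  ... | tri> a≮t _ t<a = begin
    f∞ zero *ℤ F∞
      ≡⟨ cong₂ _*ℤ_ (after zero a t<a) (IH a (a≢t ∘ suc)) ⟩
    f zero a *ℤ (F a +ℤ sumFinℤ (X a))
      ≡⟨ eq (f zero a) (F a) (sumFinℤ (X a)) (s zero *ℤ F (t zero)) ⟩
    f zero a *ℤ F a +ℤ (0ℤ *ℤ (s zero *ℤ F (t zero)) +ℤ f zero a *ℤ sumFinℤ (X a))
      ≡⟨ cong₂ (λ b c → f zero a *ℤ F a +ℤ (b *ℤ (s zero *ℤ F (t zero)) +ℤ c))
           (sym (⟦⟧-no (a <? t zero) a≮t)) (trans (sym (sumFinℤ-* (f zero a) (X a))) (sumFinℤ-cong (sym ∘ G≡))) ⟩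
    f zero a *ℤ F a +ℤ (⟦ a <? t zero ⟧ *ℤ (s zero *ℤ F (t zero)) +ℤ sumFinℤ G) ∎
    where
    eq : ∀ x y z w → x *ℤ (y +ℤ z) ≡ x *ℤ y +ℤ (0ℤ *ℤ w +ℤ x *ℤ z)
    eq = solveℤ-∀
    G≡ : ∀ j → G j ≡ f zero a *ℤ X a j
    G≡ j = case a <? t (suc j) of λ
      { (no a≮tj) → trans (cong (_*ℤ (s (suc j) *ℤ (f zero (t (suc j)) *ℤ p))) (⟦⟧-no (a <? t (suc j)) a≮tj))
          (sym (trans (cong (λ c → f zero a *ℤ (c *ℤ E j)) (⟦⟧-no (a <? t (suc j)) a≮tj)) (ℤ.*-zeroʳ (f zero a))))
      ; (yes a<tj) → trans (cong (λ c → ⟦ a <? t (suc j) ⟧ *ℤ (s (suc j) *ℤ (c *ℤ p)))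
                       (trans (sym (after zero (t (suc j)) (<-trans t<a a<tj))) (after zero a t<a)))
          (eq′ ⟦ a <? t (suc j) ⟧ (s (suc j)) (f zero a) p) }
      where
      p = prodExcept (λ k → f (suc k) (t (suc j))) j
      eq′ : ∀ b x y z → b *ℤ (x *ℤ (y *ℤ z)) ≡ y *ℤ (b *ℤ (x *ℤ z))
      eq′ = solveℤ-∀
  -- The product of the tail is expanded twice, from time `a` against `f zero a` and from time
  -- `t zero` against `s zero`. A later jump at `t (suc j)` thus receives the factor `f zero a`,
  -- increased by `s zero` if it comes after `t zero`, which is the value of the first factor at
  -- that jump.
  ... | tri< a<t _ _ = begin
    f∞ zero *ℤ F∞
      ≡⟨ cong (_*ℤ F∞) (before zero a a<t) ⟩
    (f zero a +ℤ s zero) *ℤ F∞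
      ≡⟨ ℤ.*-distribʳ-+ F∞ (f zero a) (s zero) ⟩
    f zero a *ℤ F∞ +ℤ s zero *ℤ F∞
      ≡⟨ cong₂ (λ b c → f zero a *ℤ b +ℤ s zero *ℤ c) (IH a (a≢t ∘ suc)) (IH (t zero) (λ j → inj λ ())) ⟩
    f zero a *ℤ (F a +ℤ sumFinℤ (X a)) +ℤ s zero *ℤ (F (t zero) +ℤ sumFinℤ (X (t zero)))
      ≡⟨ eq (f zero a) (F a) (sumFinℤ (X a)) (s zero) (F (t zero)) (sumFinℤ (X (t zero))) ⟩
    f zero a *ℤ F a +ℤ (1ℤ *ℤ (s zero *ℤ F (t zero)) +ℤ (f zero a *ℤ sumFinℤ (X a) +ℤ s zero *ℤ sumFinℤ (X (t zero))))
      ≡⟨ cong₂ (λ b c → f zero a *ℤ F a +ℤ (b *ℤ (s zero *ℤ F (t zero)) +ℤ c)) (sym (⟦⟧-yes (a <? t zero) a<t))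
           (trans (sym (sumFinℤ-linear (f zero a) (s zero) (X a) (X (t zero)))) (sumFinℤ-cong (sym ∘ G≡))) ⟩
    f zero a *ℤ F a +ℤ (⟦ a <? t zero ⟧ *ℤ (s zero *ℤ F (t zero)) +ℤ sumFinℤ G) ∎
    where
    eq : ∀ x y z s v w → x *ℤ (y +ℤ z) +ℤ s *ℤ (v +ℤ w) ≡ x *ℤ y +ℤ (1ℤ *ℤ (s *ℤ v) +ℤ (x *ℤ z +ℤ s *ℤ w))
    eq = solveℤ-∀
    G≡ : ∀ j → G j ≡ f zero a *ℤ X a j +ℤ s zero *ℤ X (t zero) j
    G≡ j with <-cmp (t zero) (t (suc j))
    ... | tri≈ _ t≡t _ = contradiction t≡t (inj λ ())
    ... | tri< t0<tj _ _ = trans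
        (cong₂ (λ b c → b *ℤ (s (suc j) *ℤ (c *ℤ p))) (⟦⟧-yes (a <? t (suc j)) (<-trans a<t t0<tj))
          (trans (sym (after zero (t (suc j)) t0<tj)) (before zero a a<t)))
        (trans (eq′ (s (suc j)) (f zero a) (s zero) p)
          (sym (cong₂ (λ b c → f zero a *ℤ (b *ℤ E j) +ℤ s zero *ℤ (c *ℤ E j))
            (⟦⟧-yes (a <? t (suc j)) (<-trans a<t t0<tj)) (⟦⟧-yes (t zero <? t (suc j)) t0<tj))))
      where
      p = prodExcept (λ k → f (suc k) (t (suc j))) j
      eq′ : ∀ x y s z → 1ℤ *ℤ (x *ℤ ((y +ℤ s) *ℤ z)) ≡ y *ℤ (1ℤ *ℤ (x *ℤ z)) +ℤ s *ℤ (1ℤ *ℤ (x *ℤ z))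
      eq′ = solveℤ-∀
    ... | tri> t0≮tj _ tj<t0 = trans
        (cong (λ c → ⟦ a <? t (suc j) ⟧ *ℤ (s (suc j) *ℤ (c *ℤ p))) f0≡)
        (trans (eq′ ⟦ a <? t (suc j) ⟧ (s (suc j)) (f zero a) (s zero) p)
          (cong (λ c → f zero a *ℤ X a j +ℤ s zero *ℤ (c *ℤ E j)) (sym (⟦⟧-no (t zero <? t (suc j)) t0≮tj))))
      where
      p = prodExcept (λ k → f (suc k) (t (suc j))) j
      f0≡ : f zero (t (suc j)) ≡ f zero a
      f0≡ = +ℤ-cancelʳ (s zero) (f zero (t (suc j))) (f zero a)
              (trans (sym (before zero (t (suc j)) tj<t0)) (before zero a a<t))
      eq′ : ∀ b x y s z → b *ℤ (x *ℤ (y *ℤ z)) ≡ y *ℤ (b *ℤ (x *ℤ z)) +ℤ s *ℤ (0ℤ *ℤ (x *ℤ z))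
      eq′ = solveℤ-∀

-- At most one factor differs, so at most one term on the right survives, and in it the remaining
-- factors may be taken from `f⁺`.
prodFin-difference : ∀ {n} {P : Fin n → Set} (P? : Decidable P) (f⁺ f⁻ s : Fin n → ℤ) →
  (∀ {j k} → P j → P k → j ≡ k) → (∀ j → ¬ P j → f⁻ j ≡ f⁺ j) → (∀ j → P j → f⁺ j ≡ f⁻ j +ℤ s j) →
  prodFin f⁺ ≡ prodFin f⁻ +ℤ sumFinℤ (λ j → ⟦ P? j ⟧ *ℤ (s j *ℤ prodExcept f⁺ j))
prodFin-difference {zero}  P? f⁺ f⁻ s uniq same jump = refl
prodFin-difference {suc n} P? f⁺ f⁻ s uniq same jump with P? zero
... | yes P0 = begin
    f⁺ zero *ℤ F                             ≡⟨ cong (_*ℤ F) (jump zero P0) ⟩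
    (f⁻ zero +ℤ s zero) *ℤ F                 ≡⟨ eq (f⁻ zero) (s zero) F ⟩
    f⁻ zero *ℤ F +ℤ (1ℤ *ℤ (s zero *ℤ F) +ℤ 0ℤ)
      ≡⟨ cong₂ (λ a b → f⁻ zero *ℤ a +ℤ (1ℤ *ℤ (s zero *ℤ F) +ℤ b))
           (prodFin-cong λ j → sym (same (suc j) (¬P j))) (sym (sumFinℤ-zero λ j → cong (_*ℤ _) (⟦⟧-no (P? (suc j)) (¬P j)))) ⟩
    _ ∎
  where
  open ≡-Reasoning
  F = prodFin (f⁺ ∘ suc)
  ¬P : ∀ j → ¬ _
  ¬P j Pj = contradiction (uniq P0 Pj) λ ()
  eq : ∀ x s y → (x +ℤ s) *ℤ y ≡ x *ℤ y +ℤ (1ℤ *ℤ (s *ℤ y) +ℤ 0ℤ)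
  eq = solveℤ-∀
... | no ¬P0 = begin
    f⁺ zero *ℤ prodFin (f⁺ ∘ suc)
      ≡⟨ cong (f⁺ zero *ℤ_) (prodFin-difference (P? ∘ suc) (f⁺ ∘ suc) (f⁻ ∘ suc) (s ∘ suc)
           (λ p q → suc-injective (uniq p q)) (same ∘ suc) (jump ∘ suc)) ⟩
    f⁺ zero *ℤ (prodFin (f⁻ ∘ suc) +ℤ sumFinℤ S)
      ≡⟨ eq (f⁺ zero) (prodFin (f⁻ ∘ suc)) (sumFinℤ S) (s zero *ℤ prodFin (f⁺ ∘ suc)) ⟩
    f⁺ zero *ℤ prodFin (f⁻ ∘ suc) +ℤ (0ℤ *ℤ (s zero *ℤ prodFin (f⁺ ∘ suc)) +ℤ f⁺ zero *ℤ sumFinℤ S)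
      ≡⟨ cong₂ (λ a b → a *ℤ prodFin (f⁻ ∘ suc) +ℤ (0ℤ *ℤ (s zero *ℤ prodFin (f⁺ ∘ suc)) +ℤ b))
           (sym (same zero ¬P0)) (trans (sym (sumFinℤ-* (f⁺ zero) S)) (sumFinℤ-cong λ j → eq′ (f⁺ zero) ⟦ P? (suc j) ⟧ (s (suc j)) (prodExcept (f⁺ ∘ suc) j))) ⟩
    _ ∎
  where
  open ≡-Reasoning
  S : Fin n → ℤ
  S j = ⟦ P? (suc j) ⟧ *ℤ (s (suc j) *ℤ prodExcept (f⁺ ∘ suc) j)
  eq : ∀ x y z w → x *ℤ (y +ℤ z) ≡ x *ℤ y +ℤ (0ℤ *ℤ w +ℤ x *ℤ z)
  eq = solveℤ-∀
  eq′ : ∀ x b s y → x *ℤ (b *ℤ (s *ℤ y)) ≡ b *ℤ (s *ℤ (x *ℤ y))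
  eq′ = solveℤ-∀

-- Signs as integer-valued step functions

abstract
  -- Both are 0 at 0. For `neg` this encodes the half-open convention that boundary points count as
  -- satisfying the weak inequality and violating the strict one.
  pos neg : ℚ → ℤ
  pos a = ⟦ 0ℚ <? a ⟧
  neg a = ⟦ a <? 0ℚ ⟧

  pos-1 : ∀ {a} → 0ℚ < a → pos a ≡ 1ℤ
  pos-1 {a} = ⟦⟧-yes (0ℚ <? a)

  pos-0 : ∀ {a} → a ≤ 0ℚ → pos a ≡ 0ℤ
  pos-0 {a} a≤0 = ⟦⟧-no (0ℚ <? a) λ 0<a → <-irrefl refl (<-≤-trans 0<a a≤0)

  neg-1 : ∀ {a} → a < 0ℚ → neg a ≡ 1ℤ
  neg-1 {a} = ⟦⟧-yes (a <? 0ℚ)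

  neg-0 : ∀ {a} → 0ℚ ≤ a → neg a ≡ 0ℤ
  neg-0 {a} 0≤a = ⟦⟧-no (a <? 0ℚ) λ a<0 → <-irrefl refl (<-≤-trans a<0 0≤a)

sgn : ℚ → ℤ
sgn a = pos a -ℤ pos (- a)

sgn-pos : ∀ {a} → 0ℚ < a → sgn a ≡ 1ℤ
sgn-pos 0<a = cong₂ _-ℤ_ (pos-1 0<a) (pos-0 (<⇒≤ (pos⇒-<0 0<a)))

sgn-neg : ∀ {a} → a < 0ℚ → sgn a ≡ -1ℤ
sgn-neg a<0 = cong₂ _-ℤ_ (pos-0 (<⇒≤ a<0)) (pos-1 (neg⇒0<- a<0))

pos-SameSign : ∀ {a b} → a ≢ 0ℚ → SameSign a b → pos a ≡ pos b
pos-SameSign a≢0 (p , n) with ≢0⇒<⊎> a≢0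
... | inj₁ a<0 = trans (pos-0 (<⇒≤ a<0)) (sym (pos-0 (<⇒≤ (n a<0))))
... | inj₂ 0<a = trans (pos-1 0<a) (sym (pos-1 (p 0<a)))

-- For α ≠ 0 this is [α > 0][y ≥ 0] − [α < 0][y < 0].
flip : ℚ → ℚ → ℤ
flip α y = pos α -ℤ neg y

flip≡0⊎0≤* : ∀ α y → flip α y ≡ 0ℤ ⊎ 0ℚ ≤ α * y
flip≡0⊎0≤* α y = cases (0ℚ <? α) (y <? 0ℚ)
  where
  eq : ∀ α y → - α * - y ≡ α * y
  eq = solve-∀ ringℚ
  cases : Dec (0ℚ < α) → Dec (y < 0ℚ) → flip α y ≡ 0ℤ ⊎ 0ℚ ≤ α * y
  cases (yes 0<α) (yes y<0) = inj₁ (cong₂ _-ℤ_ (pos-1 0<α) (neg-1 y<0))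
  cases (no 0≮α)  (no y≮0)  = inj₁ (cong₂ _-ℤ_ (pos-0 (≮⇒≥ 0≮α)) (neg-0 (≮⇒≥ y≮0)))
  cases (yes 0<α) (no y≮0)  = inj₂ (*-nonNeg (<⇒≤ 0<α) (≮⇒≥ y≮0))
  cases (no 0≮α)  (yes y<0) = inj₂ (subst (0ℚ ≤_) (eq α y) (*-nonNeg (neg-antimono-≤ (≮⇒≥ 0≮α)) (<⇒≤ (neg⇒0<- y<0))))

flip-nonNeg : ∀ α {y} → 0ℚ ≤ y → flip α y ≡ pos α
flip-nonNeg α {y} 0≤y = trans (cong (λ c → pos α -ℤ c) (neg-0 0≤y)) (ℤ.+-identityʳ (pos α))

prod-flip-zero : ∀ {n} (α y : Fin n → ℚ) → sum (λ j → α j * y j) < 0ℚ → prodFin (λ j → flip (α j) (y j)) ≡ 0ℤ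
prod-flip-zero α y s<0 with any? (λ j → flip (α j) (y j) ℤ.≟ 0ℤ)
... | yes (j , eq) = prodFin-zero _ j eq
... | no none = contradiction (<-≤-trans s<0 (sum-nonNeg nonNeg)) (<-irrefl refl)
  where
  nonNeg : ∀ j → 0ℚ ≤ α j * y j
  nonNeg j with flip≡0⊎0≤* (α j) (y j)
  ... | inj₁ eq = contradiction (j , eq) none
  ... | inj₂ p  = p

root-shift : ∀ α β t a → α + t * β ≡ 0ℚ → (a - t) * β ≡ α + a * β
root-shift α β t a root = trans (ring α β t a)
  (trans (cong (λ c → α + a * β + - c) root) (+-identityʳ (α + a * β)))
  where
  ring : ∀ α β t a → (a - t) * β ≡ α + a * β + - (α + t * β)
  ring = solve-∀ ringℚ

-- Before the root the sign of α + a β is opposite to that of β, and `sgn β` is the difference of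
-- the two values of `pos`. The left side is the value for large times.
pos-before : ∀ {α β t} a → β ≢ 0ℚ → α + t * β ≡ 0ℚ → a < t → pos β ≡ pos (α + a * β) +ℤ sgn β
pos-before {α} {β} {t} a β≢0 root a<t with ≢0⇒<⊎> β≢0
... | inj₁ β<0 = trans (pos-0 (<⇒≤ β<0)) (sym (cong₂ _+ℤ_
      (pos-1 (subst (0ℚ <_) (root-shift α β t a root) (*-neg-neg (<⇒-<0 a<t) β<0))) (sgn-neg β<0)))
... | inj₂ 0<β = trans (pos-1 0<β) (sym (cong₂ _+ℤ_
      (pos-0 (<⇒≤ (subst (_< 0ℚ) (root-shift α β t a root) (*-neg-pos (<⇒-<0 a<t) 0<β)))) (sgn-pos 0<β)))

pos-after : ∀ {α β t} a → β ≢ 0ℚ → α + t * β ≡ 0ℚ → t < a → pos β ≡ pos (α + a * β)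
pos-after {α} {β} {t} a β≢0 root t<a = pos-SameSign β≢0
  ( (λ 0<β → subst (0ℚ <_) (root-shift α β t a root) (*-pos (<⇒0<- t<a) 0<β))
  , (λ β<0 → subst (_< 0ℚ) (root-shift α β t a root) (*-pos-neg (<⇒0<- t<a) β<0)))

-- Signed sums of simplicial cones

-- A simplicial cone with weight ε; dual gives the coordinates with respect to gen on the e-dimensional
-- subspace spanned by gen, and q stands for x − v.
record Piece (d e : ℕ) : Set where
  field
    ε        : ℤ
    gen dual : Fin e → Pt d
    q        : Pt d

open Piece

-- `φ` is the weighted signed indicator evaluated at x, as a function of the covector; `ι` is the
-- weighted indicator of the open cone, relative to its span.
φ ι : ∀ {d e} → Piece d e → Pt d → ℤ
φ π ξ = ε π *ℤ prodFin (λ j → flip (dual π j · ξ) (q π · gen π j))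
ι π w = ε π *ℤ prodFin (λ j → pos (dual π j · w))

-- The generators form a basis of `W` whose coordinates are given by `dual`. Nothing is fixed about
-- `dual` off `W`, so a facet keeps the covectors of its cone when `W` shrinks to a hyperplane.
record Frame {d e} (W : Pt d → Set) (π : Piece d e) : Set where
  field
    gen∈   : ∀ j → W (gen π j)
    same   : ∀ j → dual π j · gen π j ≡ 1ℚ
    other  : ∀ {j k} → j ≢ k → dual π j · gen π k ≡ 0ℚ
    expand : ∀ w → W w → ∀ z → z · w ≡ sum (λ j → (dual π j · w) * (z · gen π j))

open Frame

Regular : ∀ {d e} → List (Piece d e) → Pt d → Set
Regular πs w = ∀ {π} → π ∈ πs → ∀ j → dual π j · w ≢ 0ℚ

Balanced : ∀ {d e} → (Pt d → Set) → ℤ → List (Piece d e) → Set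
Balanced W c πs = ∀ w → W w → Regular πs w → sumL (λ π → ι π w) πs ≡ c

-- Since q = x − v, this says that among the vertices v of the pieces the one of π minimises gen π j.
Compatible : ∀ {d e} → List (Piece d e) → Set
Compatible πs = ∀ {π π′} → π ∈ πs → π′ ∈ πs → ∀ j → q π′ · gen π j ≤ q π · gen π j

-- The claim for the induction on the dimension `e` of the cones; the ambient dimension stays fixed.
-- It ranges over all `W` because each crossing time brings its own hyperplane.
Vanishing : ℕ → ℕ → Set₁
Vanishing d e = ∀ {W : Pt d → Set} → Closed W → (πs : List (Piece d e)) →
  (∀ {π} → π ∈ πs → Frame W π) → Compatible πs → Balanced W 0ℤ πs →
  ∀ ξ → W ξ → Regular πs ξ → sumL (λ π → φ π ξ) πs ≡ 0ℤ

-- The generators of a single piece already span `W`, so finitely many values decide.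
vanishes? : ∀ {d e} {W : Pt d → Set} {π : Piece d e} → Frame W π → ∀ m →
  (∃ λ z → W z × m · z ≢ 0ℚ) ⊎ (∀ w → W w → m · w ≡ 0ℚ)
vanishes? {π = π} F m with any? (λ j → ¬? (m · gen π j ≟ 0ℚ))
... | yes (j , ≢0) = inj₁ (gen π j , gen∈ F j , ≢0)
... | no none = inj₂ λ w Ww → trans (expand F w Ww m) (sum-zero λ j →
        trans (cong (dual π j · w *_) (decidable-stable (m · gen π j ≟ 0ℚ) λ ≢0 → none (j , ≢0))) (*-zeroʳ (dual π j · w)))

-- The minor vanishes on u exactly when the path ξ + t u crosses both kernels at the same time.
minor : ∀ {d} → Pt d → Pt d → Pt d → Pt d
minor ξ ℓ ℓ′ = ((ℓ · ξ) • ℓ′) ⊕ ((- (ℓ′ · ξ)) • ℓ)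

-- The constant `c` is arbitrary because only the difference of the coverings on the two sides of a
-- wall enters. The facets are balanced with 0 in any case.
module Sweep {d e : ℕ} (IH : Vanishing d e) {W : Pt d → Set} (cl : Closed W)
  (πs : List (Piece d (suc e))) (fr : ∀ {π} → π ∈ πs → Frame W π) (compat : Compatible πs)
  {c : ℤ} (bal : Balanced W c πs) (ξ : Pt d) (Wξ : W ξ) (regξ : Regular πs ξ)
  (u : Pt d) (Wu : W u) (descent : ∀ {π} → π ∈ πs → q π · u < 0ℚ) (regu : Regular πs u)
  (transversal : ∀ {π π′} → π ∈ πs → π′ ∈ πs → ∀ j j′ →
     minor ξ (dual π j) (dual π′ j′) · u ≢ 0ℚ ⊎ (∀ w → W w → minor ξ (dual π j) (dual π′ j′) · w ≡ 0ℚ))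
  where

  Wall : Set
  Wall = Piece d (suc e) × Fin (suc e)

  ℓ : Wall → Pt d
  ℓ (π , j) = dual π j

  time : Wall → ℚ
  time f = - (ℓ f · ξ) * inv (ℓ f · u)

  at : ℚ → Pt d
  at T = ξ ⊕ (T • u)

  -- The extra sign is the direction of crossing: the factor of index `j` jumps by
  -- `sgn (dual π j · u)` there, so that the jump of `φ` of the cone is `φ` of the facet.
  facet : Wall → Piece d e
  facet (π , j) = record
    { ε    = ε π *ℤ sgn (dual π j · u)
    ; gen  = gen π ∘ punchIn j
    ; dual = dual π ∘ punchIn j
    ; q    = q π }

  walls : List Wall
  walls = cartesianProduct πs (List.allFin (suc e))

  ∈walls : ∀ {π} → π ∈ πs → ∀ j → (π , j) ∈ walls
  ∈walls π∈ j = ∈-cartesianProduct⁺ π∈ (∈-allFin j)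

  walls∈ : ∀ {π j} → (π , j) ∈ walls → π ∈ πs
  walls∈ f∈ = proj₁ (∈-cartesianProduct⁻ πs (List.allFin (suc e)) f∈)

  root : ∀ {π} → π ∈ πs → ∀ j → dual π j · ξ + time (π , j) * (dual π j · u) ≡ 0ℚ
  root {π} π∈ j = trans (eq α β (inv β)) (trans (cong (λ c → α + - α * c) (*-inv (regu π∈ j))) (eq′ α))
    where
    α = dual π j · ξ
    β = dual π j · u
    eq : ∀ α β i → α + - α * i * β ≡ α + - α * (β * i)
    eq = solve-∀ ringℚ
    eq′ : ∀ α → α + - α * 1ℚ ≡ 0ℚ
    eq′ = solve-∀ ringℚ

  at-root : ∀ {π} → π ∈ πs → ∀ j {T} → time (π , j) ≡ T → dual π j · at T ≡ 0ℚ
  at-root {π} π∈ j refl = trans (·-axpy (dual π j) ξ (time (π , j)) u) (root π∈ j)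

  root-unique : ∀ {π} → π ∈ πs → ∀ j {T} → dual π j · at T ≡ 0ℚ → time (π , j) ≡ T
  root-unique {π} π∈ j {T} zero-at = begin
      t                          ≡⟨ eq t T ⟩
      (t - T) + T                ≡⟨ cong (_+ T) (*≡0⇒≡0 (regu π∈ j) diff) ⟩
      0ℚ + T                     ≡⟨ +-identityˡ T ⟩
      T                          ∎
    where
    open ≡-Reasoning
    t = time (π , j)
    α = dual π j · ξ
    β = dual π j · u
    eq : ∀ t T → t ≡ t - T + T
    eq = solve-∀ ringℚ
    eq′ : ∀ α β t T → β * (t - T) ≡ α + t * β - (α + T * β)
    eq′ = solve-∀ ringℚ
    diff : β * (t - T) ≡ 0ℚ
    diff = trans (eq′ α β t T) (cong₂ _-_ (root π∈ j) (trans (sym (·-axpy (dual π j) ξ T u)) zero-at))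

  -- At a common crossing time the minor vanishes at `u`, so by transversality it vanishes on all of
  -- `W`: the two covectors are proportional there.
  parallel : ∀ {π π′} → π ∈ πs → π′ ∈ πs → ∀ j j′ → time (π , j) ≡ time (π′ , j′) → ∀ w → W w →
    (dual π j · ξ) * (dual π′ j′ · w) ≡ (dual π′ j′ · ξ) * (dual π j · w)
  parallel {π} {π′} π∈ π′∈ j j′ t≡t′ w Ww with transversal π∈ π′∈ j j′
  ... | inj₁ ≢0 = contradiction mu≡0 ≢0
    where
    t = time (π , j)
    α = dual π j · ξ
    β = dual π j · u
    α′ = dual π′ j′ · ξ
    β′ = dual π′ j′ · u
    eq : ∀ α β α′ β′ t → α * β′ + - α′ * β ≡ (α + t * β) * β′ - (α′ + t * β′) * β
    eq = solve-∀ ringℚ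
    eq′ : ∀ β β′ → 0ℚ * β′ - 0ℚ * β ≡ 0ℚ
    eq′ = solve-∀ ringℚ
    mu≡0 : minor ξ (dual π j) (dual π′ j′) · u ≡ 0ℚ
    mu≡0 = begin
      minor ξ (dual π j) (dual π′ j′) · u          ≡⟨ ·-combˡ α (dual π′ j′) (- α′) (dual π j) u ⟩
      α * β′ + - α′ * β                            ≡⟨ eq α β α′ β′ t ⟩
      (α + t * β) * β′ - (α′ + t * β′) * β         ≡⟨ cong₂ (λ a b → a * β′ - b * β) (root π∈ j)
                                                        (trans (cong (λ s → α′ + s * β′) t≡t′) (root π′∈ j′)) ⟩
      0ℚ * β′ - 0ℚ * β                             ≡⟨ eq′ β β′ ⟩
      0ℚ                                           ∎
      where open ≡-Reasoning
  ... | inj₂ ≡0 = begin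
      α * x                       ≡⟨ eq α α′ x y ⟩
      α * x + - α′ * y + α′ * y   ≡⟨ cong (_+ α′ * y) (trans (sym (·-combˡ α (dual π′ j′) (- α′) (dual π j) w)) (≡0 w Ww)) ⟩
      0ℚ + α′ * y                 ≡⟨ +-identityˡ (α′ * y) ⟩
      α′ * y                      ∎
    where
    open ≡-Reasoning
    α = dual π j · ξ
    α′ = dual π′ j′ · ξ
    x = dual π′ j′ · w
    y = dual π j · w
    eq : ∀ α α′ x y → α * x ≡ α * x + - α′ * y + α′ * y
    eq = solve-∀ ringℚ

  -- Proportionality of two dual vectors of one cone, tested on a generator that only one of them
  -- sees, would make the other vanish at `ξ`.
  times-distinct : ∀ {π} → π ∈ πs → ∀ {j k} → j ≢ k → time (π , j) ≢ time (π , k)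
  times-distinct {π} π∈ {j} {k} j≢k t≡t = regξ π∈ j (begin
      dual π j · ξ                              ≡⟨ *-identityʳ (dual π j · ξ) ⟨
      (dual π j · ξ) * 1ℚ                       ≡⟨ cong (dual π j · ξ *_) (same (fr π∈) k) ⟨
      (dual π j · ξ) * (dual π k · gen π k)     ≡⟨ parallel π∈ π∈ j k t≡t (gen π k) (gen∈ (fr π∈) k) ⟩
      (dual π k · ξ) * (dual π j · gen π k)     ≡⟨ cong (dual π k · ξ *_) (other (fr π∈) j≢k) ⟩
      (dual π k · ξ) * 0ℚ                       ≡⟨ *-zeroʳ (dual π k · ξ) ⟩
      0ℚ                                        ∎)
    where open ≡-Reasoning

  jump : Wall → ℤ
  jump f = ⟦ 0ℚ <? time f ⟧ *ℤ φ (facet f) (at (time f))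

  -- φ vanishes at infinity because ξ + t u is eventually negative on q, whereas a nonzero φ makes
  -- all the products (dual j · ξ) (q · gen j) nonnegative.
  φ-jumps : ∀ {π} → π ∈ πs → φ π ξ +ℤ sumFinℤ (λ j → jump (π , j)) ≡ 0ℤ
  φ-jumps {π} π∈ = begin
      φ π ξ +ℤ sumFinℤ (λ j → jump (π , j))
        ≡⟨ cong₂ _+ℤ_ (cong (ε π *ℤ_) (prodFin-cong λ j → cong (λ a → flip a (y j)) (start (α j) (β j))))
                      (trans (sumFinℤ-cong jump≡) (sumFinℤ-* (ε π) S)) ⟩
      ε π *ℤ prodFin (λ j → f j 0ℚ) +ℤ ε π *ℤ sumFinℤ S
        ≡⟨ ℤ.*-distribˡ-+ (ε π) (prodFin (λ j → f j 0ℚ)) (sumFinℤ S) ⟨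
      ε π *ℤ (prodFin (λ j → f j 0ℚ) +ℤ sumFinℤ S)
        -- For large times α + t β has the sign of β, so `flip (β j) (y j)` is the final value of
        -- each factor.
        ≡⟨ cong (ε π *ℤ_) (product-rule (λ j → flip (β j) (y j)) f (sgn ∘ β) t before after
             (times-distinct π∈) 0ℚ nonzero) ⟨
      ε π *ℤ prodFin (λ j → flip (β j) (y j))
        ≡⟨ cong (ε π *ℤ_) (prod-flip-zero β y (subst (_< 0ℚ) (expand (fr π∈) u Wu (q π)) (descent π∈))) ⟩
      ε π *ℤ 0ℤ
        ≡⟨ ℤ.*-zeroʳ (ε π) ⟩
      0ℤ ∎
    where
    open ≡-Reasoning
    α β y t : Fin (suc e) → ℚ
    α j = dual π j · ξ
    β j = dual π j · u
    y j = q π · gen π j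
    t j = time (π , j)
    f : Fin (suc e) → ℚ → ℤ
    f j a = flip (α j + a * β j) (y j)
    S : Fin (suc e) → ℤ
    S j = ⟦ 0ℚ <? t j ⟧ *ℤ (sgn (β j) *ℤ prodExcept (λ k → f k (t j)) j)
    start : ∀ α β → α ≡ α + 0ℚ * β
    start = solve-∀ ringℚ
    before : ∀ j a → a < t j → flip (β j) (y j) ≡ f j a +ℤ sgn (β j)
    before j a a<t = trans (cong (λ b → b -ℤ neg (y j)) (pos-before {α j} {β j} {t j} a (regu π∈ j) (root π∈ j) a<t))
                           (eq (pos (α j + a * β j)) (sgn (β j)) (neg (y j)))
      where
      eq : ∀ x s n → x +ℤ s -ℤ n ≡ x -ℤ n +ℤ s
      eq = solveℤ-∀
    after : ∀ j a → t j < a → flip (β j) (y j) ≡ f j a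
    after j a t<a = cong (λ b → b -ℤ neg (y j)) (pos-after {α j} {β j} {t j} a (regu π∈ j) (root π∈ j) t<a)
    nonzero : ∀ j → 0ℚ ≢ t j
    nonzero j 0≡t = regξ π∈ j (trans (start (α j) (β j)) (trans (cong (λ s → α j + s * β j) 0≡t) (root π∈ j)))
    jump≡ : ∀ j → jump (π , j) ≡ ε π *ℤ S j
    jump≡ j = trans (cong (λ p → b *ℤ (ε π *ℤ sgn (β j) *ℤ p)) prods) (eq b (ε π) (sgn (β j)) (prodExcept (λ k → f k (t j)) j))
      where
      b = ⟦ 0ℚ <? t j ⟧
      eq : ∀ b x s p → b *ℤ (x *ℤ s *ℤ p) ≡ x *ℤ (b *ℤ (s *ℤ p))
      eq = solveℤ-∀
      prods : prodFin (λ k → flip (dual π (punchIn j k) · at (t j)) (y (punchIn j k))) ≡ prodExcept (λ k → f k (t j)) j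
      prods = trans (prodFin-cong λ k → cong (λ a → flip a (y (punchIn j k))) (·-axpy (dual π (punchIn j k)) ξ (t j) u))
                    (sym (prodExcept-punchIn (λ k → f k (t j)) j))

  crossed? : ∀ T (f : Wall) → Dec (time f ≡ T)
  crossed? T f = time f ≟ T

  -- The walls crossed at time T all have the same kernel H in W.
  module Group (T : ℚ) where

    -- By `parallel` any single wall of the group would cut out the same subspace. Imposing all of
    -- them avoids a choice and also makes sense for an empty group.
    H : Pt d → Set
    H w = W w × (∀ {π} → π ∈ πs → ∀ j → time (π , j) ≡ T → dual π j · w ≡ 0ℚ)

    group : List Wall
    group = filter (crossed? T) walls

    facets : List (Piece d e)
    facets = map facet group

    facet-inv : ∀ {ρ} → ρ ∈ facets → ∃ λ π → ∃ λ j → π ∈ πs × time (π , j) ≡ T × ρ ≡ facet (π , j)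
    facet-inv ρ∈ =
      let (π , j) , f∈ , ρ≡ = ∈-map⁻ facet ρ∈
          f∈walls , t≡T = ∈-filter⁻ (crossed? T) {xs = walls} f∈
      in π , j , walls∈ f∈walls , t≡T , ρ≡

    ∈facets : ∀ {π} → π ∈ πs → ∀ j → time (π , j) ≡ T → facet (π , j) ∈ facets
    ∈facets π∈ j t≡T = ∈-map⁺ facet (∈-filter⁺ (crossed? T) (∈walls π∈ j) t≡T)

    closedH : Closed H
    closedH {u₁} {w₁} s (Wu₁ , u≡0) (Ww₁ , w≡0) = cl s Wu₁ Ww₁ , λ {π} π∈ j t≡T →
      trans (·-axpy (dual π j) u₁ s w₁) (trans (cong₂ (λ a b → a + s * b) (u≡0 π∈ j t≡T) (w≡0 π∈ j t≡T)) (eq s))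
      where
      eq : ∀ s → 0ℚ + s * 0ℚ ≡ 0ℚ
      eq = solve-∀ ringℚ

    H-at : H (at T)
    H-at = cl T Wξ Wu , λ π∈ j t≡T → at-root π∈ j t≡T

    frameH : ∀ {ρ} → ρ ∈ facets → Frame H ρ
    frameH ρ∈ with facet-inv ρ∈
    ... | π , j , π∈ , t≡T , refl = record
      -- Duality puts the generator on the facet's own wall; proportionality carries this over to
      -- every other wall of the group.
      { gen∈   = λ k → gen∈ F (punchIn j k) , λ {π′} π′∈ j′ t′≡T → *≡0⇒≡0 (regξ π∈ j) (begin
          (dual π j · ξ) * (dual π′ j′ · gen π (punchIn j k))
            ≡⟨ parallel π∈ π′∈ j j′ (trans t≡T (sym t′≡T)) (gen π (punchIn j k)) (gen∈ F (punchIn j k)) ⟩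
          (dual π′ j′ · ξ) * (dual π j · gen π (punchIn j k))
            ≡⟨ cong (dual π′ j′ · ξ *_) (other F (punchInᵢ≢i j k ∘ sym)) ⟩
          (dual π′ j′ · ξ) * 0ℚ
            ≡⟨ *-zeroʳ (dual π′ j′ · ξ) ⟩
          0ℚ ∎)
      ; same   = λ k → same F (punchIn j k)
      ; other  = λ k≢l → other F (k≢l ∘ punchIn-injective j _ _)
      ; expand = λ w Hw z → begin
          z · w
            ≡⟨ expand F w (proj₁ Hw) z ⟩
          sum (λ i → (dual π i · w) * (z · gen π i))
            ≡⟨ sum-remove {i = j} (λ i → (dual π i · w) * (z · gen π i)) ⟩
          (dual π j · w) * (z · gen π j) + rest w z
            ≡⟨ cong (λ a → a * (z · gen π j) + rest w z) (proj₂ Hw π∈ j t≡T) ⟩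
          0ℚ * (z · gen π j) + rest w z
            ≡⟨ eq (z · gen π j) (rest w z) ⟩
          rest w z ∎ }
      where
      open ≡-Reasoning
      F = fr π∈
      rest : Pt d → Pt d → ℚ
      rest w z = sum (λ k → (dual π (punchIn j k) · w) * (z · gen π (punchIn j k)))
      eq : ∀ a r → 0ℚ * a + r ≡ r
      eq = solve-∀ ringℚ

    compatH : Compatible facets
    compatH ρ∈ ρ′∈ k with facet-inv ρ∈ | facet-inv ρ′∈
    ... | π , j , π∈ , _ , refl | π′ , j′ , π′∈ , _ , refl = compat π∈ π′∈ (punchIn j k)

    regularH : Regular facets (at T)
    regularH ρ∈ k with facet-inv ρ∈
    ... | π , j , π∈ , t≡T , refl = λ zero-at →
      times-distinct π∈ (punchInᵢ≢i j k) (trans (root-unique π∈ (punchIn j k) zero-at) (sym t≡T))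

    sumL-facets : (g : Piece d e → ℤ) →
      sumL g facets ≡ sumL (λ π → sumFinℤ (λ j → ⟦ crossed? T (π , j) ⟧ *ℤ g (facet (π , j)))) πs
    sumL-facets g = begin
      sumL g (map facet group)
        ≡⟨ sumL-map g facet group ⟩
      sumL (g ∘ facet) (filter (crossed? T) walls)
        ≡⟨ sumL-filter (crossed? T) (g ∘ facet) walls ⟩
      sumL (λ f → ⟦ crossed? T f ⟧ *ℤ g (facet f)) walls
        ≡⟨ sumL-product (λ f → ⟦ crossed? T f ⟧ *ℤ g (facet f)) πs (List.allFin (suc e)) ⟩
      sumL (λ π → sumL (λ j → ⟦ crossed? T (π , j) ⟧ *ℤ g (facet (π , j))) (List.allFin (suc e))) πs
        ≡⟨ sumL-cong πs (λ {π} _ → sumL-tabulate (λ j → ⟦ crossed? T (π , j) ⟧ *ℤ g (facet (π , j))) id) ⟩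
      sumL (λ π → sumFinℤ (λ j → ⟦ crossed? T (π , j) ⟧ *ℤ g (facet (π , j)))) πs ∎
      where open ≡-Reasoning

    -- A point of H is moved to a point lying on no wall outside the group and then pushed off H
    -- to both sides along u; the two balances differ by the balance of the facets.
    balancedH : Balanced H 0ℤ facets
    balancedH w (Ww , w≡0) regw = begin
        sumL (λ ρ → ι ρ w) facets
          ≡⟨ sumL-facets (λ ρ → ι ρ w) ⟩
        sumL D πs
          ≡⟨ eq (sumL (λ π → ι π w⁻) πs) (sumL D πs) ⟩
        sumL (λ π → ι π w⁻) πs +ℤ sumL D πs -ℤ sumL (λ π → ι π w⁻) πs
          ≡⟨ cong (λ s → s -ℤ sumL (λ π → ι π w⁻) πs) (trans (sym (sumL-+ (λ π → ι π w⁻) D πs)) (sumL-cong πs λ π∈ → sym (difference π∈))) ⟩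
        sumL (λ π → ι π w⁺) πs -ℤ sumL (λ π → ι π w⁻) πs
          ≡⟨ cong₂ _-ℤ_ (bal w⁺ (cl η Ww′ Wu) reg⁺) (bal w⁻ (cl η Ww′ W-u) reg⁻) ⟩
        c -ℤ c
          ≡⟨ ℤ.+-inverseʳ c ⟩
        0ℤ ∎
      where
      open ≡-Reasoning
      eq : ∀ a b → b ≡ a +ℤ b -ℤ a
      eq = solveℤ-∀
      L = map ℓ walls
      D : Piece d (suc e) → ℤ
      D π = sumFinℤ (λ j → ⟦ crossed? T (π , j) ⟧ *ℤ ι (facet (π , j)) w)
      st₀ = signs-stable L w (at T)
      δ = proj₁ st₀
      0<δ = proj₁ (proj₂ st₀)
      -- `at T` belongs to H and lies on no wall outside the group, so a small move towards it
      -- leaves such walls while keeping all nonzero signs.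
      w′ = w ⊕ (δ • at T)
      Ww′ : W w′
      Ww′ = cl δ Ww (proj₁ H-at)
      ss₀ : ∀ {π} → π ∈ πs → ∀ j → SameSign (dual π j · w) (dual π j · w′)
      ss₀ π∈ j = proj₂ (proj₂ st₀) δ 0<δ ≤-refl (∈-map⁺ ℓ (∈walls π∈ j))
      on-wall : ∀ {π} → π ∈ πs → ∀ j → time (π , j) ≡ T → dual π j · w′ ≡ 0ℚ
      on-wall π∈ j t≡T = proj₂ (closedH δ (Ww , w≡0) H-at) π∈ j t≡T
      off-wall : ∀ {π} → π ∈ πs → ∀ j → time (π , j) ≢ T → dual π j · w′ ≢ 0ℚ
      off-wall {π} π∈ j t≢T with dual π j · w ≟ 0ℚ
      ... | no ≢0 = SameSign⇒≢0 (ss₀ π∈ j) ≢0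
      ... | yes ≡0 = λ w′≡0 → t≢T (root-unique π∈ j (*≡0⇒≡0 (<⇒≢ 0<δ ∘ sym) (begin
          δ * (dual π j · at T)                     ≡⟨ +-identityˡ (δ * (dual π j · at T)) ⟨
          0ℚ + δ * (dual π j · at T)                ≡⟨ cong (_+ δ * (dual π j · at T)) ≡0 ⟨
          dual π j · w + δ * (dual π j · at T)      ≡⟨ ·-axpy (dual π j) w δ (at T) ⟨
          dual π j · w′                             ≡⟨ w′≡0 ⟩
          0ℚ                                        ∎)))
      -- Written as u - 2u, the form in which `Closed` yields membership in `W`.
      -u = u ⊕ ((- 1ℚ - 1ℚ) • u)
      W-u : W -u
      W-u = cl (- 1ℚ - 1ℚ) Wu Wu
      ·-u : ∀ z → z · -u ≡ - (z · u)
      ·-u z = trans (·-axpy z u (- 1ℚ - 1ℚ) u) (ring (z · u))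
        where
        ring : ∀ a → a + (- 1ℚ - 1ℚ) * a ≡ - a
        ring = solve-∀ ringℚ
      st⁺ = signs-stable L w′ u
      st⁻ = signs-stable L w′ -u
      η = proj₁ st⁺ ⊓ proj₁ st⁻
      0<η : 0ℚ < η
      0<η = ⊓-pos (proj₁ (proj₂ st⁺)) (proj₁ (proj₂ st⁻))
      w⁺ = w′ ⊕ (η • u)
      w⁻ = w′ ⊕ (η • -u)
      ss⁺ : ∀ {π} → π ∈ πs → ∀ j → SameSign (dual π j · w′) (dual π j · w⁺)
      ss⁺ π∈ j = proj₂ (proj₂ st⁺) η 0<η (p⊓q≤p (proj₁ st⁺) (proj₁ st⁻)) (∈-map⁺ ℓ (∈walls π∈ j))
      ss⁻ : ∀ {π} → π ∈ πs → ∀ j → SameSign (dual π j · w′) (dual π j · w⁻)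
      ss⁻ π∈ j = proj₂ (proj₂ st⁻) η 0<η (p⊓q≤q (proj₁ st⁺) (proj₁ st⁻)) (∈-map⁺ ℓ (∈walls π∈ j))
      crossing⁺ : ∀ {π} → π ∈ πs → ∀ j → time (π , j) ≡ T → dual π j · w⁺ ≡ η * (dual π j · u)
      crossing⁺ {π} π∈ j t≡T = trans (·-axpy (dual π j) w′ η u)
        (trans (cong (_+ η * (dual π j · u)) (on-wall π∈ j t≡T)) (+-identityˡ (η * (dual π j · u))))
      crossing⁻ : ∀ {π} → π ∈ πs → ∀ j → time (π , j) ≡ T → dual π j · w⁻ ≡ η * - (dual π j · u)
      crossing⁻ {π} π∈ j t≡T = trans (·-axpy (dual π j) w′ η -u)
        (trans (cong₂ (λ a b → a + η * b) (on-wall π∈ j t≡T) (·-u (dual π j))) (+-identityˡ (η * - (dual π j · u))))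
      scale : ∀ a → SameSign a (η * a)
      scale a = *-pos 0<η , *-pos-neg 0<η
      -≢0 : ∀ {a} → a ≢ 0ℚ → - a ≢ 0ℚ
      -≢0 {a} a≢0 -a≡0 = a≢0 (neg-injective -a≡0)
      reg⁺ : Regular πs w⁺
      reg⁺ {π} π∈ j with crossed? T (π , j)
      ... | yes t≡T = subst (_≢ 0ℚ) (sym (crossing⁺ π∈ j t≡T)) (SameSign⇒≢0 (scale _) (regu π∈ j))
      ... | no  t≢T = SameSign⇒≢0 (ss⁺ π∈ j) (off-wall π∈ j t≢T)
      reg⁻ : Regular πs w⁻
      reg⁻ {π} π∈ j with crossed? T (π , j)
      ... | yes t≡T = subst (_≢ 0ℚ) (sym (crossing⁻ π∈ j t≡T)) (SameSign⇒≢0 (scale _) (-≢0 (regu π∈ j)))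
      ... | no  t≢T = SameSign⇒≢0 (ss⁻ π∈ j) (off-wall π∈ j t≢T)
      difference : ∀ {π} → π ∈ πs → ι π w⁺ ≡ ι π w⁻ +ℤ D π
      difference {π} π∈ = begin
          ε π *ℤ prodFin f⁺
            ≡⟨ cong (ε π *ℤ_) (prodFin-difference (λ j → crossed? T (π , j)) f⁺ f⁻ s uniq
                 (λ j t≢T → trans (sym (pos-SameSign (off-wall π∈ j t≢T) (ss⁻ π∈ j)))
                                  (pos-SameSign (off-wall π∈ j t≢T) (ss⁺ π∈ j))) jump±) ⟩
          ε π *ℤ (prodFin f⁻ +ℤ sumFinℤ (λ j → ⟦ crossed? T (π , j) ⟧ *ℤ (s j *ℤ prodExcept f⁺ j)))
            ≡⟨ ℤ.*-distribˡ-+ (ε π) (prodFin f⁻) (sumFinℤ (λ j → ⟦ crossed? T (π , j) ⟧ *ℤ (s j *ℤ prodExcept f⁺ j))) ⟩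
          ι π w⁻ +ℤ ε π *ℤ sumFinℤ (λ j → ⟦ crossed? T (π , j) ⟧ *ℤ (s j *ℤ prodExcept f⁺ j))
            ≡⟨ cong (ι π w⁻ +ℤ_) (trans (sym (sumFinℤ-* (ε π) (λ j → ⟦ crossed? T (π , j) ⟧ *ℤ (s j *ℤ prodExcept f⁺ j)))) (sumFinℤ-cong term)) ⟩
          ι π w⁻ +ℤ D π ∎
        where
        f⁺ f⁻ s : Fin (suc e) → ℤ
        f⁺ j = pos (dual π j · w⁺)
        f⁻ j = pos (dual π j · w⁻)
        s j = sgn (dual π j · u)
        uniq : ∀ {j k} → time (π , j) ≡ T → time (π , k) ≡ T → j ≡ k
        uniq {j} {k} p r = decidable-stable (j ≟F k) λ j≢k → times-distinct π∈ j≢k (trans p (sym r))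
        jump± : ∀ j → time (π , j) ≡ T → f⁺ j ≡ f⁻ j +ℤ s j
        jump± j t≡T = trans (trans (cong pos (crossing⁺ π∈ j t≡T)) (sym (pos-SameSign (regu π∈ j) (scale _))))
          (trans (ring (pos β) (pos (- β)))
            (cong (_+ℤ s j) (trans (pos-SameSign (-≢0 (regu π∈ j)) (scale _)) (cong pos (sym (crossing⁻ π∈ j t≡T))))))
          where
          β = dual π j · u
          ring : ∀ a b → a ≡ b +ℤ (a -ℤ b)
          ring = solveℤ-∀
        term : ∀ j → ε π *ℤ (⟦ crossed? T (π , j) ⟧ *ℤ (s j *ℤ prodExcept f⁺ j)) ≡ ⟦ crossed? T (π , j) ⟧ *ℤ ι (facet (π , j)) w
        term j = case crossed? T (π , j) of λ
          { (no t≢T) → trans (cong (λ b → ε π *ℤ (b *ℤ (s j *ℤ prodExcept f⁺ j))) (⟦⟧-no (crossed? T (π , j)) t≢T))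
              (trans (ℤ.*-zeroʳ (ε π)) (sym (cong (_*ℤ ι (facet (π , j)) w) (⟦⟧-no (crossed? T (π , j)) t≢T))))
          ; (yes t≡T) → trans (ring (ε π) ⟦ crossed? T (π , j) ⟧ (s j) (prodExcept f⁺ j))
              (cong (λ p → ⟦ crossed? T (π , j) ⟧ *ℤ (ε π *ℤ s j *ℤ p))
                (trans (prodExcept-punchIn f⁺ j) (prodFin-cong λ k →
                  let k′ = punchIn j k
                      w≢0 = regw (∈facets π∈ j t≡T) k
                  in sym (trans (pos-SameSign w≢0 (ss₀ π∈ k′)) (pos-SameSign (SameSign⇒≢0 (ss₀ π∈ k′) w≢0) (ss⁺ π∈ k′)))))) }
          where
          ring : ∀ x b s p → x *ℤ (b *ℤ (s *ℤ p)) ≡ b *ℤ (x *ℤ s *ℤ p)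
          ring = solveℤ-∀

    jumps-cancel : sumL (λ f → ⟦ crossed? T f ⟧ *ℤ jump f) walls ≡ 0ℤ
    jumps-cancel = begin
      sumL (λ f → ⟦ crossed? T f ⟧ *ℤ jump f) walls
        ≡⟨ sumL-cong walls (λ {f} _ → same-time f) ⟩
      sumL (λ f → ⟦ 0ℚ <? T ⟧ *ℤ (⟦ crossed? T f ⟧ *ℤ φ (facet f) (at T))) walls
        ≡⟨ sumL-* ⟦ 0ℚ <? T ⟧ (λ f → ⟦ crossed? T f ⟧ *ℤ φ (facet f) (at T)) walls ⟩
      ⟦ 0ℚ <? T ⟧ *ℤ sumL (λ f → ⟦ crossed? T f ⟧ *ℤ φ (facet f) (at T)) walls
        ≡⟨ cong (⟦ 0ℚ <? T ⟧ *ℤ_) (sym (trans (sumL-map (λ ρ → φ ρ (at T)) facet group)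
             (sumL-filter (crossed? T) (λ f → φ (facet f) (at T)) walls))) ⟩
      ⟦ 0ℚ <? T ⟧ *ℤ sumL (λ ρ → φ ρ (at T)) facets
        ≡⟨ cong (⟦ 0ℚ <? T ⟧ *ℤ_) (IH closedH facets frameH compatH balancedH (at T) H-at regularH) ⟩
      ⟦ 0ℚ <? T ⟧ *ℤ 0ℤ
        ≡⟨ ℤ.*-zeroʳ ⟦ 0ℚ <? T ⟧ ⟩
      0ℤ ∎
      where
      open ≡-Reasoning
      same-time : ∀ f → ⟦ crossed? T f ⟧ *ℤ jump f ≡ ⟦ 0ℚ <? T ⟧ *ℤ (⟦ crossed? T f ⟧ *ℤ φ (facet f) (at T))
      same-time f = case crossed? T f of λ
        { (yes t≡T) → trans (cong (λ s → ⟦ crossed? T f ⟧ *ℤ (⟦ 0ℚ <? s ⟧ *ℤ φ (facet f) (at s))) t≡T)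
                            (ring ⟦ crossed? T f ⟧ ⟦ 0ℚ <? T ⟧ (φ (facet f) (at T)))
        ; (no t≢T) → trans (cong (_*ℤ jump f) (⟦⟧-no (crossed? T f) t≢T))
            (sym (trans (cong (λ b → ⟦ 0ℚ <? T ⟧ *ℤ (b *ℤ φ (facet f) (at T))) (⟦⟧-no (crossed? T f) t≢T)) (ℤ.*-zeroʳ ⟦ 0ℚ <? T ⟧))) }
        where
        ring : ∀ a b x → a *ℤ (b *ℤ x) ≡ b *ℤ (a *ℤ x)
        ring = solveℤ-∀

  vanish : sumL (λ π → φ π ξ) πs ≡ 0ℤ
  vanish = begin
    sumL (λ π → φ π ξ) πs
      ≡⟨ ℤ.+-identityʳ _ ⟨
    sumL (λ π → φ π ξ) πs +ℤ 0ℤ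
      ≡⟨ cong (sumL (λ π → φ π ξ) πs +ℤ_) (trans (sym (sumL-fibres time jump walls λ T → Group.jumps-cancel T))
           (trans (sumL-product jump πs (List.allFin (suc e)))
             (sumL-cong πs λ {π} _ → sumL-tabulate (λ j → jump (π , j)) id))) ⟩
    sumL (λ π → φ π ξ) πs +ℤ sumL (λ π → sumFinℤ (λ j → jump (π , j))) πs
      ≡⟨ sumL-+ (λ π → φ π ξ) (λ π → sumFinℤ (λ j → jump (π , j))) πs ⟨
    sumL (λ π → φ π ξ +ℤ sumFinℤ (λ j → jump (π , j))) πs
      ≡⟨ sumL-zero πs φ-jumps ⟩
    0ℤ ∎
    where open ≡-Reasoning

-- The strict inequalities at `u₀` survive a small perturbation, which is used to leave the kernels
-- of all dual vectors and of all minors that do not vanish on `W`.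
sweep : ∀ {d e} → Vanishing d e → ∀ {W : Pt d → Set} → Closed W → (πs : List (Piece d (suc e))) →
  (∀ {π} → π ∈ πs → Frame W π) → Compatible πs → ∀ {c} → Balanced W c πs →
  ∀ ξ → W ξ → Regular πs ξ → ∀ u₀ → W u₀ → (∀ {π} → π ∈ πs → q π · u₀ < 0ℚ) →
  sumL (λ π → φ π ξ) πs ≡ 0ℤ
sweep IH cl [] fr compat bal ξ Wξ regξ u₀ Wu₀ descent = refl
sweep {d} {e} IH {W} cl πs@(π₀ ∷ _) fr compat bal ξ Wξ regξ u₀ Wu₀ descent =
  Sweep.vanish IH cl πs fr compat bal ξ Wξ regξ u Wu (λ π∈ → Ku (∈-map⁺ q π∈)) regu
    (λ π∈ π′∈ j j′ → Lu (∈-++⁺ʳ duals (∈-cartesianProductWith⁺ (minor ξ) (∈duals π∈ j) (∈duals π′∈ j′))))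
  where
  duals minors : List (Pt d)
  duals = map (λ (π , j) → dual π j) (cartesianProduct πs (List.allFin (suc e)))
  minors = cartesianProductWith (minor ξ) duals duals
  ∈duals : ∀ {π} → π ∈ πs → ∀ j → dual π j ∈ duals
  ∈duals π∈ j = ∈-map⁺ (λ (π , j) → dual π j) (∈-cartesianProduct⁺ π∈ (∈-allFin j))
  chosen = generic-point cl (map q πs) (duals ++ minors) (λ {m} _ → vanishes? (fr (here refl)) m) u₀ Wu₀
    (λ κ∈ → let π , π∈ , κ≡ = ∈-map⁻ q κ∈ in subst (λ κ → κ · u₀ < 0ℚ) (sym κ≡) (descent π∈))
  u = proj₁ chosen
  Wu = proj₁ (proj₂ chosen)
  Ku = proj₁ (proj₂ (proj₂ chosen))
  Lu = proj₂ (proj₂ (proj₂ chosen))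
  regu : Regular πs u
  regu {π} π∈ j with Lu (∈-++⁺ˡ (∈duals π∈ j))
  ... | inj₁ ≢0 = ≢0
  ... | inj₂ ≡0 = contradiction (trans (sym (≡0 (gen π j) (gen∈ (fr π∈) j))) (same (fr π∈) j)) (<⇒≢ 0<1)

φ≡ι : ∀ {d e} (π : Piece d e) ξ → (∀ j → 0ℚ ≤ q π · gen π j) → φ π ξ ≡ ι π ξ
φ≡ι π ξ 0≤q = cong (ε π *ℤ_) (prodFin-cong λ j → flip-nonNeg (dual π j · ξ) (0≤q j))

-- If some `q π · gen π j` is negative, `gen π j` itself is a descent direction, and by
-- compatibility it is one for every piece. Otherwise `φ` agrees with `ι`, and the balance at `ξ` is
-- the claim. In dimension 0 there are no generators, so only the latter case occurs.
vanishing : ∀ d e → Vanishing d e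
vanishing d e cl πs fr compat bal ξ Wξ regξ
  with anyL? (λ π → any? (λ j → q π · gen π j <? 0ℚ)) πs
... | no none = trans (sumL-cong πs λ {π} π∈ → φ≡ι π ξ λ j → ≮⇒≥ λ <0 → none (lose π∈ (j , <0))) (bal ξ Wξ regξ)
vanishing d (suc e) cl πs fr compat bal ξ Wξ regξ | yes some =
  let π , π∈ , j , <0 = find some
  in sweep (vanishing d e) cl πs fr compat bal ξ Wξ regξ (gen π j) (gen∈ (fr π∈) j)
       (λ π′∈ → ≤-<-trans (compat π∈ π′∈ j) <0)
vanishing d zero cl πs fr compat bal ξ Wξ regξ | yes some with find some
... | _ , _ , () , _

-- Triangulated normal cones

sumFinℤ-single : ∀ {n} (f : Fin n → ℤ) i → (∀ k → k ≢ i → f k ≡ 0ℤ) → sumFinℤ f ≡ f i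
sumFinℤ-single f zero    f≡0 = trans (cong (f zero +ℤ_) (sumFinℤ-zero λ k → f≡0 (suc k) λ ())) (ℤ.+-identityʳ (f zero))
sumFinℤ-single f (suc i) f≡0 = trans (cong₂ _+ℤ_ (f≡0 zero λ ()) (sumFinℤ-single (f ∘ suc) i λ k k≢i → f≡0 (suc k) λ { refl → k≢i refl }))
                                     (ℤ.+-identityˡ (f (suc i)))

term≤sum : ∀ {n} (f : Fin n → ℚ) → (∀ k → 0ℚ ≤ f k) → ∀ j → f j ≤ sum f
term≤sum {suc n} f 0≤f j = subst₂ _≤_ (+-identityʳ (f j)) (sym (sum-remove {i = j} f))
  (+-monoʳ-≤ (f j) (sum-nonNeg λ k → 0≤f (punchIn j k)))

allFin-true : ∀ {n} {p : Fin n → Bool} → (∀ k → p k ≡ true) → allFin p ≡ true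
allFin-true {zero}  all = refl
allFin-true {suc n} all = cong₂ _∧_ (all zero) (allFin-true (all ∘ suc))

allFin-false : ∀ {n} (p : Fin n → Bool) k → p k ≡ false → allFin p ≡ false
allFin-false p zero    pk = cong (_∧ allFin (p ∘ suc)) pk
allFin-false p (suc k) pk with p zero
... | true  = allFin-false (p ∘ suc) k pk
... | false = refl

signed : Bool → Bool → ℤ
signed p c = if p then (if c then -1ℤ else 1ℤ) else 0ℤ

-- Both the membership test and the sign (-1)^ind factor over the generators, which turns a summand
-- of the theorem into a product.
prodFin-signed : ∀ {n} (p c : Fin n → Bool) →
  (if allFin p then signℤ (countFin c) else 0ℤ) ≡ prodFin (λ j → signed (p j) (c j))
prodFin-signed {zero}  p c = refl
prodFin-signed {suc n} p c = trans (step (p zero) (c zero) (allFin (p ∘ suc)) (countFin (c ∘ suc)))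
                                   (cong (signed (p zero) (c zero) *ℤ_) (prodFin-signed (p ∘ suc) (c ∘ suc)))
  where
  step : ∀ p₀ c₀ P N → (if p₀ ∧ P then signℤ ((if c₀ then 1 else 0) ℕ.+ N) else 0ℤ) ≡
                        signed p₀ c₀ *ℤ (if P then signℤ N else 0ℤ)
  step false c₀    P     N = refl
  step true  false true  N = sym (ℤ.*-identityˡ (signℤ N))
  step true  false false N = refl
  step true  true  true  N = sym (ℤ.-1*i≡-i (signℤ N))
  step true  true  false N = refl

-- The branch with default `true` is reached only for a zero coefficient, which genericity excludes.
flip-signed : ∀ {a} → a ≢ 0ℚ → ∀ s t →
  signed (if does (0ℚ <? a) then does (s ≤? t) else if does (a <? 0ℚ) then does (t <? s) else true) (does (a <? 0ℚ))
    ≡ flip a (t - s)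
flip-signed {a} a≢0 s t with ≢0⇒<⊎> a≢0
... | inj₂ 0<a = trans (cong₂ signed (cong (λ o → if o then does (s ≤? t) else rest) (dec-true (0ℚ <? a) 0<a)) (dec-false (a <? 0ℚ) (<-asym 0<a)))
                       (cases (s ≤? t))
  where
  rest = if does (a <? 0ℚ) then does (t <? s) else true
  cases : Dec (s ≤ t) → signed (does (s ≤? t)) false ≡ flip a (t - s)
  cases (yes s≤t) = trans (cong (λ o → signed o false) (dec-true (s ≤? t) s≤t)) (sym (cong₂ _-ℤ_ (pos-1 0<a) (neg-0 (≤⇒0≤- s≤t))))
  cases (no s≰t)  = trans (cong (λ o → signed o false) (dec-false (s ≤? t) s≰t)) (sym (cong₂ _-ℤ_ (pos-1 0<a) (neg-1 (<⇒-<0 (≰⇒> s≰t)))))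
... | inj₁ a<0 = trans (cong₂ signed (trans (cong (λ o → if o then does (s ≤? t) else rest) (dec-false (0ℚ <? a) (<-asym a<0)))
                                            (cong (λ o → if o then does (t <? s) else true) (dec-true (a <? 0ℚ) a<0)))
                                     (dec-true (a <? 0ℚ) a<0))
                       (cases (t <? s))
  where
  rest = if does (a <? 0ℚ) then does (t <? s) else true
  cases : Dec (t < s) → signed (does (t <? s)) true ≡ flip a (t - s)
  cases (yes t<s) = trans (cong (λ o → signed o true) (dec-true (t <? s) t<s)) (sym (cong₂ _-ℤ_ (pos-0 (<⇒≤ a<0)) (neg-1 (<⇒-<0 t<s))))
  cases (no t≮s)  = trans (cong (λ o → signed o true) (dec-false (t <? s) t≮s)) (sym (cong₂ _-ℤ_ (pos-0 (<⇒≤ a<0)) (neg-0 (≤⇒0≤- (≮⇒≥ t≮s)))))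

module Fan {d m : ℕ} (A : Fin m → Pt d) (b : Fin m → ℚ) (bounded : Bounded A b)
           (ξ : Pt d) (generic : Generic A b ξ) where

  open Polytope A b bounded
  open RegTriang

  Everywhere : Pt d → Set
  Everywhere _ = ⊤

  Triang : Pt d → Set
  Triang v = RegTriang A b v ξ

  basis : ∀ {v} (Δ : Triang v) i → Dual (A ∘ cones Δ i)
  basis Δ i = dual-basis (A ∘ cones Δ i) (indep Δ i)

  coord : ∀ {v} (Δ : Triang v) → Fin (M Δ) → Fin d → Pt d
  coord Δ i = Dual.dual (basis Δ i)

  coord-lincomb : ∀ {v} (Δ : Triang v) i c j → coord Δ i j · lincomb c (A ∘ cones Δ i) ≡ c j
  coord-lincomb Δ i = dual-lincomb (coord Δ i) (Dual.same (basis Δ i)) (Dual.other (basis Δ i))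

  coord-ξ : ∀ {v} (Δ : Triang v) i j → coord Δ i j · ξ ≡ α Δ i j
  coord-ξ Δ i j = trans (cong (coord Δ i j ·_) (sym (αspec Δ i))) (coord-lincomb Δ i (α Δ i) j)

  Interior : ∀ {v} (Δ : Triang v) → Pt d → Fin (M Δ) → Set
  Interior Δ w i = ∀ j → 0ℚ < coord Δ i j · w

  interior? : ∀ {v} (Δ : Triang v) w i → Dec (Interior Δ w i)
  interior? Δ w i = all? λ j → 0ℚ <? coord Δ i j · w

  -- The common point is a combination of common generators. All its coordinates in the first cone
  -- are positive, so every generator of that cone must occur among them and hence belong to the
  -- second cone, against `distinct`.
  interior-unique : ∀ {v} (Δ : Triang v) {w i i′} → Interior Δ w i → Interior Δ w i′ → i ≡ i′
  interior-unique Δ {w} {i} {i′} int int′ = decidable-stable (i ≟F i′) λ i≢i′ → distinct Δ i i′ i≢i′ shared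
    where
    closed : ∀ {i} → Interior Δ w i → InCone (A ∘ cones Δ i) w
    closed {i} int = (λ j → coord Δ i j · w) , <⇒≤ ∘ int , ·-ext _ _ λ z →
      trans (·-lincomb z (λ j → coord Δ i j · w) (A ∘ cones Δ i)) (sym (Dual.expand (basis Δ i) w z))
    common = faces Δ i i′ w (closed int) (closed int′)
    c = proj₁ common
    support = proj₁ (proj₂ (proj₂ common))
    shared : ∀ j → ∃ λ j′ → cones Δ i j ≡ cones Δ i′ j′
    shared j with c (cones Δ i j) ≟ 0ℚ
    ... | no  c≢0 = let _ , j′ , eq = support (cones Δ i j) c≢0 in j′ , sym eq
    ... | yes c≡0 = contradiction (trans (cong (coord Δ i j ·_) (sym (proj₂ (proj₂ (proj₂ common)))))
                      (trans (·-lincomb (coord Δ i j) c A) (sum-zero term))) (<⇒≢ (int j) ∘ sym)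
      where
      term : ∀ k → c k * (coord Δ i j · A k) ≡ 0ℚ
      term k with c k ≟ 0ℚ
      ... | yes ck≡0 = trans (cong (_* (coord Δ i j · A k)) ck≡0) (*-zeroˡ (coord Δ i j · A k))
      ... | no  ck≢0 with proj₁ (support k ck≢0)
      ...   | j″ , refl = trans (cong (c k *_) (Dual.other (basis Δ i) λ { refl → ck≢0 c≡0 })) (*-zeroʳ (c k))

  interior-minimises : ∀ {v} (Δ : Triang v) {w i} → Interior Δ w i → ∀ x → InP A b x → w · v ≤ w · x
  interior-minimises {v} Δ {w} {i} int x x∈P = subst₂ _≤_ (sym (value v)) (sym (value x)) (sum-mono λ j →
      *-monoˡ (<⇒≤ (int j)) (subst₂ _≤_ (sym (trans (·-comm v (A (cones Δ i j))) (active Δ i j))) (·-comm (A (cones Δ i j)) x) (x∈P (cones Δ i j))))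
    where
    value : ∀ y → w · y ≡ sum (λ j → (coord Δ i j · w) * (y · A (cones Δ i j)))
    value y = trans (·-comm w y) (Dual.expand (basis Δ i) w y)

  interior⇒normal : ∀ {v} (Δ : Triang v) → IsVertex A b v → ∀ {w i} → Interior Δ w i → InNormalCone A b v w
  interior⇒normal Δ isV {w} int = minimiser-normal w (proj₁ isV) (interior-minimises Δ int)

  -- Complementary slackness: both vertices minimise `w`, so the nonnegative gaps between them,
  -- weighted with positive coordinates, add up to 0. All gaps vanish, and the generators form a
  -- basis.
  interior-vertex : ∀ {v v′} (Δ : Triang v) (Δ′ : Triang v′) → IsVertex A b v → IsVertex A b v′ →
    ∀ {w i i′} → Interior Δ w i → Interior Δ′ w i′ → v ≡ v′
  interior-vertex {v} {v′} Δ Δ′ isV isV′ {w} {i} {i′} int int′ = ·-ext v v′ λ z → begin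
      z · v                                                          ≡⟨ value z v ⟩
      sum (λ j → (coord Δ i j · z) * (v · A (cones Δ i j)))          ≡⟨ sum-cong-≗ (λ j → cong (coord Δ i j · z *_) (agree j)) ⟩
      sum (λ j → (coord Δ i j · z) * (v′ · A (cones Δ i j)))         ≡⟨ value z v′ ⟨
      z · v′                                                         ∎
    where
    open ≡-Reasoning
    n : Fin d → Pt d
    n j = A (cones Δ i j)
    value : ∀ z y → z · y ≡ sum (λ j → (coord Δ i j · z) * (y · n j))
    value z y = trans (·-comm z y) (Dual.expand (basis Δ i) z y)
    gap : Fin d → ℚ
    gap j = v′ · n j - v · n j
    0≤gap : ∀ j → 0ℚ ≤ gap j
    0≤gap j = ≤⇒0≤- (subst₂ _≤_ (sym (trans (·-comm v (n j)) (active Δ i j))) (·-comm (n j) v′) (proj₁ isV′ (cones Δ i j)))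
    f : Fin d → ℚ
    f j = (coord Δ i j · w) * gap j
    ring : ∀ c x y → c * (x - y) ≡ c * (x + y * - 1ℚ)
    ring = solve-∀ ringℚ
    ring′ : ∀ x y → x + y * - 1ℚ ≡ x - y
    ring′ = solve-∀ ringℚ
    total : sum f ≡ w · v′ - w · v
    total = begin
      sum f
        ≡⟨ sum-cong-≗ (λ j → ring (coord Δ i j · w) (v′ · n j) (v · n j)) ⟩
      sum (λ j → (coord Δ i j · w) * (v′ · n j + (v · n j) * - 1ℚ))
        ≡⟨ sum-*-+ (λ j → coord Δ i j · w) (λ j → v′ · n j) (λ j → v · n j) (- 1ℚ) ⟩
      sum (λ j → (coord Δ i j · w) * (v′ · n j)) + sum (λ j → (coord Δ i j · w) * (v · n j)) * - 1ℚ
        ≡⟨ cong₂ (λ p r → p + r * - 1ℚ) (sym (value w v′)) (sym (value w v)) ⟩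
      w · v′ + (w · v) * - 1ℚ
        ≡⟨ ring′ (w · v′) (w · v) ⟩
      w · v′ - w · v ∎
    total≡0 : sum f ≡ 0ℚ
    total≡0 = trans total (trans (cong (λ s → s - w · v) (≤-antisym (interior-minimises Δ′ int′ v (proj₁ isV)) (interior-minimises Δ int v′ (proj₁ isV′))))
                                 (+-inverseʳ (w · v)))
    gap≡0 : ∀ j → gap j ≡ 0ℚ
    gap≡0 j = *≡0⇒≡0 (<⇒≢ (int j) ∘ sym) (≤-antisym
      (subst (f j ≤_) total≡0 (term≤sum f (λ k → *-nonNeg (<⇒≤ (int k)) (0≤gap k)) j)) (*-nonNeg (<⇒≤ (int j)) (0≤gap j)))
    agree : ∀ j → v · n j ≡ v′ · n j
    agree j = sym (trans (ring₂ (v′ · n j) (v · n j)) (trans (cong (_+ v · n j) (gap≡0 j)) (+-identityˡ (v · n j))))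
      where
      ring₂ : ∀ x y → x ≡ x - y + y
      ring₂ = solve-∀ ringℚ

  OffWalls : ∀ {v} → Triang v → Pt d → Set
  OffWalls Δ w = ∀ i j → coord Δ i j · w ≢ 0ℚ

  normal⇒interior : ∀ {v} (Δ : Triang v) {w} → OffWalls Δ w → InNormalCone A b v w → ∃ (Interior Δ w)
  normal⇒interior Δ {w} off w∈N =
    let i , c , 0≤c , c≡w = cover Δ w w∈N
    in i , λ j → ≤∧≢⇒< (subst (0ℚ ≤_) (trans (sym (coord-lincomb Δ i c j)) (cong (coord Δ i j ·_) c≡w)) (0≤c j)) (off i j ∘ sym)

  coord-ξ≢0 : ∀ {v} (Δ : Triang v) → IsVertex A b v → OffWalls Δ ξ
  coord-ξ≢0 Δ isV i j = subst (_≢ 0ℚ) (sym (coord-ξ Δ i j))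
    (coefficients-nonzero A b generic isV (cones Δ i) (active Δ i) (basis Δ i) (α Δ i) (αspec Δ i) j)

  module At (x : Pt d) where

    from : Pt d → Pt d
    from v = x ⊕ ((- 1ℚ) • v)

    from· : ∀ v z → from v · z ≡ z · x - z · v
    from· v z = trans (·-comm (from v) z) (trans (·-axpy z x (- 1ℚ) v) (ring (z · x) (z · v)))
      where
      ring : ∀ a b → a + - 1ℚ * b ≡ a - b
      ring = solve-∀ ringℚ

    piece : ∀ {v} → ℤ → (Δ : Triang v) → Fin (M Δ) → Piece d d
    piece {v} s Δ i = record { ε = s ; gen = A ∘ cones Δ i ; dual = coord Δ i ; q = from v }

    pieces : ∀ {v} → ℤ → Triang v → List (Piece d d)
    pieces s Δ = tabulate (piece s Δ)

    -- The origin of a piece, which gives access to its vertex and triangulation after lists of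
    -- pieces have been concatenated.
    Cone : Piece d d → Set
    Cone π = ∃ λ v → IsVertex A b v × ∃ λ (Δ : Triang v) → ∃ λ s → ∃ λ i → π ≡ piece s Δ i

    pieces-cone : ∀ {v} → IsVertex A b v → ∀ s (Δ : Triang v) {π} → π ∈ pieces s Δ → Cone π
    pieces-cone {v} isV s Δ π∈ = let i , π≡ = ∈-tabulate⁻ π∈ in v , isV , Δ , s , i , π≡

    cone-frame : ∀ {π} → Cone π → Frame Everywhere π
    cone-frame (v , isV , Δ , s , i , refl) = record
      { gen∈ = λ _ → tt ; same = Dual.same (basis Δ i) ; other = Dual.other (basis Δ i) ; expand = λ w _ → Dual.expand (basis Δ i) w }

    -- A generator is active at its own vertex, and every other vertex satisfies its inequality.
    cone-compatible : ∀ {πs} → (∀ {π} → π ∈ πs → Cone π) → Compatible πs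
    cone-compatible cone π∈ π′∈ j with cone π∈ | cone π′∈
    ... | v , isV , Δ , s , i , refl | v′ , isV′ , Δ′ , s′ , i′ , refl =
      subst₂ _≤_ (sym (from· v′ n)) (sym (from· v n)) (+-monoʳ-≤ (n · x) (neg-antimono-≤ (subst (_≤ n · v′) (sym (active Δ i j)) (proj₁ isV′ (cones Δ i j)))))
      where n = A (cones Δ i j)

    cone-regular : ∀ {πs} → (∀ {π} → π ∈ πs → Cone π) → Regular πs ξ
    cone-regular cone π∈ j with cone π∈
    ... | v , isV , Δ , s , i , refl = coord-ξ≢0 Δ isV i j

    summand : ∀ {v} (Δ : Triang v) → Fin (M Δ) → ℤ
    summand {v} Δ i = if inTσ A b v (cones Δ i) (α Δ i) x then signℤ (indξ A b (α Δ i)) else 0ℤ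

    φ-piece : ∀ {v} → IsVertex A b v → ∀ s (Δ : Triang v) i → φ (piece s Δ i) ξ ≡ s *ℤ summand Δ i
    φ-piece {v} isV s Δ i = cong (s *ℤ_) (sym (trans (prodFin-signed meets isNegative) (prodFin-cong λ j →
      trans (flip-signed (subst (_≢ 0ℚ) (coord-ξ Δ i j) (coord-ξ≢0 Δ isV i j)) (A (cones Δ i j) · v) (A (cones Δ i j) · x))
        (cong₂ flip (sym (coord-ξ Δ i j)) (sym (from· v (A (cones Δ i j))))))))
      where
      meets isNegative : Fin d → Bool
      meets j = if does (0ℚ <? α Δ i j) then does (A (cones Δ i j) · v ≤? A (cones Δ i j) · x)
                else if does (α Δ i j <? 0ℚ) then does (A (cones Δ i j) · x <? A (cones Δ i j) · v)
                else true
      isNegative j = does (α Δ i j <? 0ℚ)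

    φ-pieces : ∀ {v} → IsVertex A b v → ∀ s (Δ : Triang v) → sumL (λ π → φ π ξ) (pieces s Δ) ≡ s *ℤ indΔ A b Δ x
    φ-pieces isV s Δ = trans (sumL-tabulate (λ π → φ π ξ) (piece s Δ)) (trans (sumFinℤ-cong (φ-piece isV s Δ)) (sumFinℤ-* s (summand Δ)))

    ι-interior : ∀ {v} s (Δ : Triang v) {w i} → Interior Δ w i → ι (piece s Δ i) w ≡ s
    ι-interior s Δ int = trans (cong (s *ℤ_) (prodFin-one λ j → pos-1 (int j))) (ℤ.*-identityʳ s)

    ι-exterior : ∀ {v} s (Δ : Triang v) {w i} → ¬ Interior Δ w i → ι (piece s Δ i) w ≡ 0ℤ
    ι-exterior s Δ {w} {i} ¬int with any? (λ j → ¬? (0ℚ <? coord Δ i j · w))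
    ... | yes (j , ≯0) = trans (cong (s *ℤ_) (prodFin-zero (λ j → pos (coord Δ i j · w)) j (pos-0 (≮⇒≥ ≯0)))) (ℤ.*-zeroʳ s)
    ... | no none = contradiction (λ j → decidable-stable (0ℚ <? coord Δ i j · w) λ ≯0 → none (j , ≯0)) ¬int

    ι-inside : ∀ {v} s (Δ : Triang v) {w} → ∃ (Interior Δ w) → sumL (λ π → ι π w) (pieces s Δ) ≡ s
    ι-inside s Δ {w} (i , int) = trans (sumL-tabulate (λ π → ι π w) (piece s Δ)) (trans
      (sumFinℤ-single (λ k → ι (piece s Δ k) w) i λ k k≢i → ι-exterior s Δ λ int′ → k≢i (interior-unique Δ int′ int)) (ι-interior s Δ int))

    ι-outside : ∀ {v} s (Δ : Triang v) {w} → ¬ ∃ (Interior Δ w) → sumL (λ π → ι π w) (pieces s Δ) ≡ 0ℤ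
    ι-outside s Δ {w} none = trans (sumL-tabulate (λ π → ι π w) (piece s Δ)) (sumFinℤ-zero λ i → ι-exterior s Δ λ int → none (i , int))

    pieces-off : ∀ {v} s (Δ : Triang v) {w} → Regular (pieces s Δ) w → OffWalls Δ w
    pieces-off s Δ reg i = reg (∈-tabulate⁺ i)

    independence : ∀ {v} → IsVertex A b v → (Δ Δ′ : Triang v) → indΔ A b Δ x ≡ indΔ A b Δ′ x
    independence isV Δ Δ′ = ℤ.i-j≡0⇒i≡j (indΔ A b Δ x) (indΔ A b Δ′ x) (begin
      indΔ A b Δ x -ℤ indΔ A b Δ′ x
        ≡⟨ ring (indΔ A b Δ x) (indΔ A b Δ′ x) ⟩
      1ℤ *ℤ indΔ A b Δ x +ℤ -1ℤ *ℤ indΔ A b Δ′ x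
        ≡⟨ cong₂ _+ℤ_ (φ-pieces isV 1ℤ Δ) (φ-pieces isV -1ℤ Δ′) ⟨
      sumL (λ π → φ π ξ) (pieces 1ℤ Δ) +ℤ sumL (λ π → φ π ξ) (pieces -1ℤ Δ′)
        ≡⟨ sumL-++ (λ π → φ π ξ) (pieces 1ℤ Δ) (pieces -1ℤ Δ′) ⟨
      sumL (λ π → φ π ξ) πs
        ≡⟨ vanishing d d {Everywhere} (λ _ _ _ → tt) πs (cone-frame ∘ cone) (cone-compatible cone) balanced ξ tt (cone-regular cone) ⟩
      0ℤ ∎)
      where
      open ≡-Reasoning
      ring : ∀ a b → a -ℤ b ≡ 1ℤ *ℤ a +ℤ -1ℤ *ℤ b
      ring = solveℤ-∀
      πs = pieces 1ℤ Δ ++ pieces -1ℤ Δ′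
      cone : ∀ {π} → π ∈ πs → Cone π
      cone π∈ with ∈-++⁻ (pieces 1ℤ Δ) π∈
      ... | inj₁ π∈Δ  = pieces-cone isV 1ℤ Δ π∈Δ
      ... | inj₂ π∈Δ′ = pieces-cone isV -1ℤ Δ′ π∈Δ′
      balanced : Balanced Everywhere 0ℤ πs
      balanced w _ reg = trans (sumL-++ (λ π → ι π w) (pieces 1ℤ Δ) (pieces -1ℤ Δ′)) (cases (any? (interior? Δ w)))
        where
        off : OffWalls Δ w
        off = pieces-off 1ℤ Δ λ π∈ → reg (∈-++⁺ˡ π∈)
        off′ : OffWalls Δ′ w
        off′ = pieces-off -1ℤ Δ′ λ π∈ → reg (∈-++⁺ʳ (pieces 1ℤ Δ) π∈)
        -- Off all walls, lying inside some cone of a triangulation means lying in the normal cone,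
        -- which is the same for `Δ` and `Δ′`.
        cases : Dec (∃ (Interior Δ w)) → sumL (λ π → ι π w) (pieces 1ℤ Δ) +ℤ sumL (λ π → ι π w) (pieces -1ℤ Δ′) ≡ 0ℤ
        cases (yes (i , int)) = cong₂ _+ℤ_ (ι-inside 1ℤ Δ (i , int)) (ι-inside -1ℤ Δ′ (normal⇒interior Δ′ off′ (interior⇒normal Δ isV int)))
        cases (no none) = cong₂ _+ℤ_ (ι-outside 1ℤ Δ none) (ι-outside -1ℤ Δ′ λ (i′ , int′) → none (normal⇒interior Δ off (interior⇒normal Δ′ isV int′)))

    allPieces : ∀ {vs} → All Triang vs → List (Piece d d)
    allPieces []       = []
    allPieces (Δ ∷ Δs) = pieces 1ℤ Δ ++ allPieces Δs

    allPieces-cone : ∀ {vs} → (∀ {v} → v ∈ vs → IsVertex A b v) → (Δs : All Triang vs) → ∀ {π} → π ∈ allPieces Δs → Cone π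
    allPieces-cone isV (Δ ∷ Δs) π∈ with ∈-++⁻ (pieces 1ℤ Δ) π∈
    ... | inj₁ π∈Δ  = pieces-cone (isV (here refl)) 1ℤ Δ π∈Δ
    ... | inj₂ π∈Δs = allPieces-cone (isV ∘ there) Δs π∈Δs

    φ-allPieces : ∀ {vs} → (∀ {v} → v ∈ vs → IsVertex A b v) → (Δs : All Triang vs) →
      sumL (λ π → φ π ξ) (allPieces Δs) ≡ sumVerts A b Δs x
    φ-allPieces isV []       = refl
    φ-allPieces isV (Δ ∷ Δs) = trans (sumL-++ (λ π → φ π ξ) (pieces 1ℤ Δ) (allPieces Δs))
      (cong₂ _+ℤ_ (trans (φ-pieces (isV (here refl)) 1ℤ Δ) (ℤ.*-identityˡ (indΔ A b Δ x))) (φ-allPieces (isV ∘ there) Δs))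

    ι-allPieces-outside : ∀ {vs} w (Δs : All Triang vs) → (∀ {v} → v ∈ vs → ∀ (Δ : Triang v) → ¬ ∃ (Interior Δ w)) →
      sumL (λ π → ι π w) (allPieces Δs) ≡ 0ℤ
    ι-allPieces-outside w []       none = refl
    ι-allPieces-outside w (Δ ∷ Δs) none = trans (sumL-++ (λ π → ι π w) (pieces 1ℤ Δ) (allPieces Δs))
      (cong₂ _+ℤ_ (ι-outside 1ℤ Δ (none (here refl) Δ)) (ι-allPieces-outside w Δs (none ∘ there)))

    -- The last hypothesis provides one covering cone; a second one at another vertex is excluded by
    -- `interior-vertex`, since the vertices are listed without repetition.
    ι-allPieces : ∀ {vs} → Unique vs → (∀ {v} → v ∈ vs → IsVertex A b v) → (Δs : All Triang vs) →
      ∀ w → Regular (allPieces Δs) w → (∃ λ v → v ∈ vs × InNormalCone A b v w) → sumL (λ π → ι π w) (allPieces Δs) ≡ 1ℤ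
    ι-allPieces {v ∷ vs} (v∉vs ∷ uniq) isV (Δ ∷ Δs) w reg normal =
      trans (sumL-++ (λ π → ι π w) (pieces 1ℤ Δ) (allPieces Δs)) (cases (any? (interior? Δ w)) normal)
      where
      cases : Dec (∃ (Interior Δ w)) → (∃ λ v′ → v′ ∈ v ∷ vs × InNormalCone A b v′ w) →
        sumL (λ π → ι π w) (pieces 1ℤ Δ) +ℤ sumL (λ π → ι π w) (allPieces Δs) ≡ 1ℤ
      cases (yes (i , int)) _ = cong₂ _+ℤ_ (ι-inside 1ℤ Δ (i , int)) (ι-allPieces-outside w Δs λ v′∈ Δ′ (i′ , int′) →
        All¬⇒¬Any v∉vs (subst (_∈ vs) (sym (interior-vertex Δ Δ′ (isV (here refl)) (isV (there v′∈)) int int′)) v′∈))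
      cases (no none) (_ , here refl , w∈N) =
        contradiction (normal⇒interior Δ (pieces-off 1ℤ Δ λ π∈ → reg (∈-++⁺ˡ π∈)) w∈N) none
      cases (no none) (v′ , there v′∈ , w∈N) = cong₂ _+ℤ_ (ι-outside 1ℤ Δ none)
        (ι-allPieces uniq (isV ∘ there) Δs w (λ π∈ → reg (∈-++⁺ʳ (pieces 1ℤ Δ) π∈)) (v′ , v′∈ , w∈N))

    allPieces-balanced : FullDim A b → ∀ {vs} → Unique vs → (∀ v → IsVertex A b v ⇔ (v ∈ vs)) → (Δs : All Triang vs) →
      Balanced Everywhere 1ℤ (allPieces Δs)
    allPieces-balanced fullDim {vs} uniq verts Δs w _ reg =
      ι-allPieces uniq (λ {v} → proj₂ (verts v)) Δs w reg (normal-fan-complete fullDim vs verts w)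

    sum-inside : FullDim A b → ∀ {vs} → Unique vs → (∀ v → IsVertex A b v ⇔ (v ∈ vs)) → (Δs : All Triang vs) →
      InP A b x → sumVerts A b Δs x ≡ 1ℤ
    sum-inside fullDim uniq verts Δs x∈P = begin
      sumVerts A b Δs x                        ≡⟨ φ-allPieces (λ {v} → proj₂ (verts v)) Δs ⟨
      sumL (λ π → φ π ξ) (allPieces Δs)        ≡⟨ sumL-cong (allPieces Δs) (λ {π} π∈ → φ≡ι π ξ (nonNeg (cone π∈))) ⟩
      sumL (λ π → ι π ξ) (allPieces Δs)        ≡⟨ allPieces-balanced fullDim uniq verts Δs ξ tt (cone-regular cone) ⟩
      1ℤ                                       ∎
      where
      open ≡-Reasoning
      cone : ∀ {π} → π ∈ allPieces Δs → Cone π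
      cone = allPieces-cone (λ {v} → proj₂ (verts v)) Δs
      nonNeg : ∀ {π} → Cone π → ∀ j → 0ℚ ≤ q π · gen π j
      nonNeg (v , _ , Δ , s , i , refl) j =
        subst (0ℚ ≤_) (sym (from· v (A k))) (≤⇒0≤- (subst (_≤ A k · x) (sym (active Δ i j)) (x∈P k)))
        where k = cones Δ i j

-- Comparison with the indicator of the polytope

indP-inside : ∀ {d m} (A : Fin m → Pt d) b {x} → InP A b x → indP A b x ≡ 1ℤ
indP-inside A b {x} x∈P = cong (if_then 1ℤ else 0ℤ) (allFin-true λ k → dec-true (b k ≤? A k · x) (x∈P k))

indP-outside : ∀ {d m} (A : Fin m → Pt d) b {x} k → A k · x < b k → indP A b x ≡ 0ℤ
indP-outside A b {x} k <b = cong (if_then 1ℤ else 0ℤ)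
  (allFin-false _ k (dec-false (b k ≤? A k · x) λ b≤ → <-irrefl refl (<-≤-trans <b b≤)))

-- The cones cover once, not 0 times, so `vanishing` does not apply directly. `sweep` does, because
-- the violated normal is at least b k at every vertex and smaller at x.
sum-outside : ∀ {d m} (A : Fin m → Pt d) b → FullDim A b → (bounded : Bounded A b) → ∀ ξ → Generic A b ξ →
  ∀ {vs} → Unique vs → (∀ v → IsVertex A b v ⇔ (v ∈ vs)) → (Δs : All (λ v → RegTriang A b v ξ) vs) →
  ∀ x k → A k · x < b k → sumVerts A b Δs x ≡ 0ℤ
-- In dimension 0 the cones have no facets to sweep across, but there the only point belongs to the
-- polytope.
sum-outside {zero} A b (x₀ , inside) bounded ξ generic uniq verts Δs x k <b =
  contradiction (<-trans <b (subst (λ y → b k < A k · y) (unique x₀ x) (inside k))) (<-irrefl refl)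
  where
  unique : (u w : Pt 0) → u ≡ w
  unique [] [] = refl
sum-outside {suc d} A b fullDim bounded ξ generic uniq verts Δs x k <b = begin
    sumVerts A b Δs x
      ≡⟨ φ-allPieces isV Δs ⟨
    sumL (λ π → φ π ξ) (allPieces Δs)
      ≡⟨ sweep (vanishing (suc d) d) {Everywhere} (λ _ _ _ → tt) (allPieces Δs) (cone-frame ∘ cone) (cone-compatible cone)
           (allPieces-balanced fullDim uniq verts Δs) ξ tt (cone-regular cone) (A k) tt (descent ∘ cone) ⟩
    0ℤ ∎
  where
  open ≡-Reasoning
  open Fan A b bounded ξ generic
  open At x
  isV : ∀ {v} → v ∈ _ → IsVertex A b v
  isV {v} = proj₂ (verts v)
  cone : ∀ {π} → π ∈ allPieces Δs → Cone π
  cone = allPieces-cone isV Δs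
  descent : ∀ {π} → Cone π → Piece.q π · A k < 0ℚ
  descent (v , isV , _ , _ , _ , refl) = subst (_< 0ℚ) (sym (from· v (A k))) (<⇒-<0 (<-≤-trans <b (proj₁ isV k)))

theorem3p1 : (d m : ℕ) (A : Fin m → Pt d) (b : Fin m → ℚ) →
    FullDim A b → Bounded A b → Irredundant A b →
    (ξ : Pt d) → Generic A b ξ →
    (vs : List (Pt d)) → Unique vs → (∀ v → IsVertex A b v ⇔ (v ∈ vs)) →
    ((v : Pt d) → IsVertex A b v → (Δ Δ′ : RegTriang A b v ξ) →
    ∀ x → indΔ A b Δ x ≡ indΔ A b Δ′ x)
    × ((Δs : All (λ v → RegTriang A b v ξ) vs) →
    ∀ x → indP A b x ≡ sumVerts A b Δs x)
theorem3p1 d m A b fullDim bounded _ ξ generic vs uniq verts =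
  (λ v isV Δ Δ′ x → Fan.At.independence A b bounded ξ generic x isV Δ Δ′) , decomposition
  where
  decomposition : (Δs : All (λ v → RegTriang A b v ξ) vs) → ∀ x → indP A b x ≡ sumVerts A b Δs x
  decomposition Δs x with any? (λ k → A k · x <? b k)
  ... | yes (k , <b) = trans (indP-outside A b k <b) (sym (sum-outside A b fullDim bounded ξ generic uniq verts Δs x k <b))
  ... | no none = trans (indP-inside A b x∈P) (sym (Fan.At.sum-inside A b bounded ξ generic x fullDim uniq verts Δs x∈P))
    where
    x∈P : InP A b x
    x∈P k = ≮⇒≥ λ <b → none (k , <b)
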